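{- Let $d\ge1$ and $q\ge2$, and let $\mathfrak A$ be a $d$-colored ordinal having the least order type in its $\equiv_q$-equivalence class of $d$-colored ordinals. Put $k=|\rho_{q-1}(\mathfrak A)|$. Then: if $k\le 2^{q-1}-1$, then $\operatorname{otp}(A)=k$; and if $k>2^{q-1}-1$, then $\operatorname{otp}(A)\le\omega^{k-2^{q-1}+1}$.
   Context: A $d$-colored ordinal is a structure $\mathfrak A=(A,<,C_0,\dots,C_{d-1})$ where $(A,<)$ is an ordinal (well-order) and the unary predicates $C_i$ partition $A$; empty domains and empty color classes are allowed. $\operatorname{otp}(A)$ is the order type of $(A,<)$. $\mathfrak A\equiv_q\mathfrak B$ means agreement on all first-order sentences of quantifier rank at most $q$. $[[\mathfrak A]]^q$ denotes the $q$-characteristic sentence of $\mathfrak A$, so $[[\mathfrak A]]^q$ and $[[\mathfrak B]]^q$ are identified iff $\mathfrak A\equiv_q\mathfrak B$. For $a\in A$ of color $i$, the $q$-character of $a$ is $\rho_q^{\mathfrak A}(a)=(i,[[\mathfrak A_{<a}]]^q,[[\mathfrak A_{>a}]]^q)$, where $\mathfrak A_{<a},\mathfrak A_{>a}$ are the substructures on $\{b:b<a\}$ and $\{b:b>a\}$; and $\rho_q(\mathfrak A)=\{\rho_q^{\mathfrak A}(a):a\in A\}$. -}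

module Defs where

open import Data.Empty using (⊥)
open import Data.Fin.Base using (Fin)
import Data.Fin.Induction as Fin
import Data.Fin.Properties as Fin
open import Data.Nat.Base using (ℕ; zero; suc; _≤_; _⊔_)
import Data.Nat.Induction as ℕ
import Data.Nat.Properties as ℕ
open import Data.Product.Base using (∃-syntax; _×_; _,_; proj₁; proj₂)
open import Data.Product.Relation.Binary.Lex.Strict
  using (×-strictTotalOrder; ×-wellFounded')
open import Data.Product.Relation.Binary.Pointwise.NonDependent using (_×ₛ_)
open import Data.Sum.Base using (_⊎_)
open import Data.Vec.Base using (Vec; []; _∷_; lookup)
open import Function.Base using (_∘_)
open import Function.Bundles using (_⇔_; Bijection)
open import Function.Properties.Equivalence using (⇔-isEquivalence)
open import Induction.WellFounded using (WellFounded)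
open import Level using (0ℓ) renaming (suc to lsuc)
open import Relation.Binary.Bundles using (Setoid; StrictTotalOrder)
import Relation.Binary.Construct.On as On
open import Relation.Binary.Morphism.Structures
  using (IsOrderMonomorphism; IsOrderIsomorphism)
open import Relation.Binary.PropositionalEquality as ≡ using (_≡_)
open import Relation.Binary.Structures using (IsEquivalence)
open import Relation.Nullary.Negation using (¬_)

-- The equality is a setoid one so that substructures (Σ-types, whose second
-- components must not matter) are again well-orders.
record WellOrder : Set₁ where
  field
    strictTotalOrder : StrictTotalOrder 0ℓ 0ℓ 0ℓ
  open StrictTotalOrder strictTotalOrder public
  field
    <-wellFounded : WellFounded _<_

infix 4 _≅_ _≤ₒ_

record _≅_ (α β : WellOrder) : Set where
  private
    module α = WellOrder α
    module β = WellOrder β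
  field
    to                 : α.Carrier → β.Carrier
    isOrderIsomorphism : IsOrderIsomorphism α._≈_ β._≈_ α._<_ β._<_ to

-- Comparison of order types: α is isomorphic to an initial segment of β.
record _≤ₒ_ (α β : WellOrder) : Set where
  private
    module α = WellOrder α
    module β = WellOrder β
  field
    to                  : α.Carrier → β.Carrier
    isOrderMonomorphism : IsOrderMonomorphism α._≈_ β._≈_ α._<_ β._<_ to
    downwardClosed      : ∀ {x y} → y β.< to x → ∃[ x′ ] to x′ β.≈ y

fin : ℕ → WellOrder
fin n = record
  { strictTotalOrder = Fin.<-strictTotalOrder n
  ; <-wellFounded    = Fin.<-wellFounded
  }

ω : WellOrder
ω = record
  { strictTotalOrder = ℕ.<-strictTotalOrder
  ; <-wellFounded    = ℕ.<-wellFounded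
  }

infixl 7 _·_

-- α · β is β-many copies of α, so the β-component is the more significant
-- one and comes first.
_·_ : WellOrder → WellOrder → WellOrder
α · β = record
  { strictTotalOrder = ×-strictTotalOrder β.strictTotalOrder α.strictTotalOrder
  ; <-wellFounded    = ×-wellFounded' {_≈₁_ = β._≈_} {_<₁_ = β._<_} {_<₂_ = α._<_}
                         β.Eq.trans β.<-respʳ-≈ β.<-wellFounded α.<-wellFounded
  }
  where
  module α = WellOrder α
  module β = WellOrder β

infix 8 ω^_

ω^_ : ℕ → WellOrder
ω^ zero  = fin 1
ω^ suc n = ω^ n · ω

restrict : (α : WellOrder) → (WellOrder.Carrier α → Set) → WellOrder
restrict α P = record
  { strictTotalOrder = On.strictTotalOrder α.strictTotalOrder (proj₁ {B = P})
  ; <-wellFounded    = On.wellFounded proj₁ α.<-wellFounded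
  }
  where module α = WellOrder α

-- The partition into classes C₀, …, C_{d-1} is given by the function sending
-- each element to the index of its class, so C i = { a | color a ≡ i }.
record ColoredOrdinal (d : ℕ) : Set₁ where
  field
    otp : WellOrder
  open WellOrder otp public
  field
    color      : Carrier → Fin d
    color-cong : ∀ {a b} → a ≈ b → color a ≡ color b

module _ {d : ℕ} (A : ColoredOrdinal d) where
  open ColoredOrdinal A

  substructure : (Carrier → Set) → ColoredOrdinal d
  substructure P = record
    { otp        = restrict otp P
    ; color      = color ∘ proj₁
    ; color-cong = color-cong
    }

  below : Carrier → ColoredOrdinal d
  below a = substructure (λ b → b < a)

  above : Carrier → ColoredOrdinal d
  above a = substructure (λ b → a < b)

infix  9 _<′_ _≈′_
infixr 7 _∧′_
infixr 6 _∨′_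

-- Formulas with free variables among n de Bruijn indices.
data Formula (d n : ℕ) : Set where
  _<′_ _≈′_ : Fin n → Fin n → Formula d n
  C         : Fin d → Fin n → Formula d n
  ⊥′        : Formula d n
  ¬′_       : Formula d n → Formula d n
  _∧′_ _∨′_ : Formula d n → Formula d n → Formula d n
  ∀′_ ∃′_   : Formula d (suc n) → Formula d n

Sentence : ℕ → Set
Sentence d = Formula d 0

quantifierRank : ∀ {d n} → Formula d n → ℕ
quantifierRank (x <′ y) = 0
quantifierRank (x ≈′ y) = 0
quantifierRank (C i x)  = 0
quantifierRank ⊥′       = 0
quantifierRank (¬′ φ)   = quantifierRank φ
quantifierRank (φ ∧′ ψ) = quantifierRank φ ⊔ quantifierRank ψ
quantifierRank (φ ∨′ ψ) = quantifierRank φ ⊔ quantifierRank ψ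
quantifierRank (∀′ φ)   = suc (quantifierRank φ)
quantifierRank (∃′ φ)   = suc (quantifierRank φ)

module _ {d : ℕ} (A : ColoredOrdinal d) where
  open ColoredOrdinal A

  ⟦_⟧ : ∀ {n} → Formula d n → Vec Carrier n → Set
  ⟦ x <′ y ⟧ v = lookup v x < lookup v y
  ⟦ x ≈′ y ⟧ v = lookup v x ≈ lookup v y
  ⟦ C i x  ⟧ v = color (lookup v x) ≡ i
  ⟦ ⊥′     ⟧ v = ⊥
  ⟦ ¬′ φ   ⟧ v = ¬ ⟦ φ ⟧ v
  ⟦ φ ∧′ ψ ⟧ v = ⟦ φ ⟧ v × ⟦ ψ ⟧ v
  ⟦ φ ∨′ ψ ⟧ v = ⟦ φ ⟧ v ⊎ ⟦ ψ ⟧ v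
  ⟦ ∀′ φ   ⟧ v = ∀ a → ⟦ φ ⟧ (a ∷ v)
  ⟦ ∃′ φ   ⟧ v = ∃[ a ] ⟦ φ ⟧ (a ∷ v)

infix 4 _⊨_ _≡[_]_

_⊨_ : ∀ {d} → ColoredOrdinal d → Sentence d → Set
A ⊨ φ = ⟦ A ⟧ φ []

_≡[_]_ : ∀ {d} → ColoredOrdinal d → ℕ → ColoredOrdinal d → Set
A ≡[ q ] B = ∀ φ → quantifierRank φ ≤ q → (A ⊨ φ) ⇔ (B ⊨ φ)

≡[]-isEquivalence : ∀ {d} q → IsEquivalence {A = ColoredOrdinal d} _≡[ q ]_
≡[]-isEquivalence q = record
  { refl  = λ φ _ → ⇔.refl
  ; sym   = λ A≡B φ φ≤q → ⇔.sym (A≡B φ φ≤q)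
  ; trans = λ A≡B B≡C φ φ≤q → ⇔.trans (A≡B φ φ≤q) (B≡C φ φ≤q)
  }
  where module ⇔ = IsEquivalence (⇔-isEquivalence {0ℓ})

-- The q-characteristic sentences [[ A ]]^q: since [[ A ]]^q and [[ B ]]^q are
-- identified exactly when A ≡[ q ] B, they form the quotient of the colored
-- ordinals by ≡[ q ], and [[ A ]]^q is represented by A itself.
Characteristic : ℕ → ℕ → Setoid (lsuc 0ℓ) 0ℓ
Characteristic d q = record { isEquivalence = ≡[]-isEquivalence {d} q }

Character : ℕ → ℕ → Setoid (lsuc 0ℓ) 0ℓ
Character d q = ≡.setoid (Fin d) ×ₛ (Characteristic d q ×ₛ Characteristic d q)

module _ {d : ℕ} (q : ℕ) (A : ColoredOrdinal d) where
  open ColoredOrdinal A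

  character : Carrier → Setoid.Carrier (Character d q)
  character a = color a , below A a , above A a

  -- The set of characters { character a | a ∈ A }: a member is named by some
  -- a, and two names are equal when they name the same character.
  ρ : Setoid 0ℓ 0ℓ
  ρ = On.setoid (Character d q) character

∣_∣≡_ : Setoid 0ℓ 0ℓ → ℕ → Set
∣ S ∣≡ k = Bijection (≡.setoid (Fin k)) S

HasLeastOrderType : ∀ {d} → ℕ → ColoredOrdinal d → Set₁
HasLeastOrderType {d} q A =
  ∀ (B : ColoredOrdinal d) → B ≡[ q ] A → ColoredOrdinal.otp A ≤ₒ ColoredOrdinal.otp B

{-# OPTIONS --safe #-}

-- Two colored ordinals satisfy the same sentences of quantifier rank r iff the
-- duplicator wins the r-round game whose moves split a structure at a point.
-- By Löwenheim–Skolem and Ramsey, A is equivalent to a word, built from letters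
-- by concatenation and ω-powers. Suppose a word contains h ω. If the character
-- of the limit point after h ω already occurs in a late copy of h, then h ω can
-- be cut down to finitely many copies of h, and the finite monoid of types
-- being aperiodic, this is also possible in all copies at once when h ω occurs
-- in the body of a further ω-power. So in a word of least depth every level of
-- nesting adds a new character. The first 2^(q-1) − 1 points of A have
-- characters that do not occur in late copies, since fewer than 2^(q-1) points
-- are counted exactly by q - 1 quantifiers. Thus at most k − 2^(q-1) + 1 levels
-- remain, which bounds the order type of the word. By the same counting, A has
-- exactly k points when k is at most 2^(q-1) − 1.
module Submission where

open import Axiom.ExcludedMiddle using (ExcludedMiddle)
open import Data.Empty using (⊥; ⊥-elim)
open import Data.Fin.Base
  using (Fin; zero; suc; toℕ; fromℕ<; combine; remQuot; funToFin; finToFun)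
import Data.Fin.Properties as Fin
open import Data.List.Base
  using (List; []; _∷_; _++_; [_]; length; map; concatMap; allFin)
open import Data.List.Membership.Propositional using (_∈_; lose)
open import Data.List.Membership.Propositional.Properties
  using (∈-concatMap⁺; ∈-map⁺; ∈-++⁺ˡ; ∈-++⁺ʳ; ∈-allFin)
open import Data.List.Properties
  using (++-assoc; ++-identityʳ; ++-monoid; length-map; length-tabulate)
open import Data.List.Relation.Unary.Any using (Any; here; there)
open import Data.Maybe.Base as Maybe using (Maybe; just; nothing)
open import Data.Nat.Base as ℕ using (ℕ; zero; suc; _+_; _∸_; _^_; _≤_; _>_; _≥_; z≤n; s≤s)
import Data.Nat.Properties as ℕ
open import Data.Product.Base using (Σ; ∃; ∃-syntax; ∃₂; _×_; _,_; proj₁; proj₂)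
open import Data.Sum.Base using (_⊎_; inj₁; inj₂; [_,_]′)
open import Data.Sum.Relation.Binary.LeftOrder
  using (⊎-<-strictTotalOrder; ⊎-<-wellFounded; ₁∼₂; ₁∼₁; ₂∼₂)
open import Data.Sum.Relation.Binary.Pointwise using (inj₁; inj₂)
open import Data.Unit.Base using (⊤; tt)
open import Data.Vec.Base using (Vec; lookup) renaming ([] to []ᵛ; _∷_ to _∷ᵛ_)
open import Function.Base using (_∘_; id)
open import Function.Bundles using (mk⇔; Equivalence)
open import Function.Definitions using (Injective)
open import Induction.WellFounded using (Acc; acc)
open import Level using (0ℓ; Lift; lift; lower) renaming (suc to lsuc)
open import Relation.Binary.Bundles using (Setoid)
open import Relation.Binary.Definitions using (tri<; tri≈; tri>)
open import Relation.Binary.Morphism.Structures using (IsOrderMonomorphism)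
open import Relation.Binary.PropositionalEquality
  using (_≡_; refl; sym; trans; cong; cong₂; subst; subst₂)
import Relation.Binary.Reasoning.Setoid as ≈-Reasoning
open import Relation.Nullary.Decidable using (Dec; yes; no; map′)
open import Relation.Nullary.Negation using (¬_)
open import Tactic.MonoidSolver using (solve)
open import Defs

-- Words, structures and the game

open ColoredOrdinal using (Carrier)

-- A move of the game is a character: the color of a point and the types of its two sides with one
-- round fewer. So the q-type of a word is fixed by the set of its (q-1)-characters, and a factor
-- may be exchanged whenever these are kept, as seen between what stands before and after it
-- (`CtxEq`). The obstacle is a factor in the body of a further ω-power. There the context of one
-- copy contains the other copies, which change as well, so an equivalence in one fixed context does
-- not carry over. It must be freed of whatever surrounds the enclosing ω-power. This costs a round,
-- spent on a move at a first letter, and the passage to the ω-power regains it (`collapse-in-ω`).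
-- Depth alone gives too weak a bound: a word of depth m may have order type ω^m · n with n > 1.
-- Counting yields m = k - 2^(q-1) + 1, and the bound ω^m is reached by letting only the last factor
-- have depth m (`last-ω`): an ω-power with a point after it has a limit point, whose character is
-- one more to count.

variable
  d r n : ℕ

-- h ^ω stands for ω many copies of h, so a word denotes a colored ordinal
-- below ω^ω.
data Factor (d : ℕ) : Set where
  letter : Fin d → Factor d
  _^ω    : List (Factor d) → Factor d

Word : ℕ → Set
Word d = List (Factor d)

pow : Word d → ℕ → Word d
pow h zero    = []
pow h (suc n) = h ++ pow h n

data Pos {d : ℕ} : Word d → Set where
  here  : ∀ {c w} → Pos (letter c ∷ w)
  copy  : ∀ {h w} → ℕ → Pos h → Pos (h ^ω ∷ w)
  there : ∀ {f w} → Pos w → Pos (f ∷ w)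

colour : {w : Word d} → Pos w → Fin d
colour (here {c})  = c
colour (copy n p)  = colour p
colour (there p)   = colour p

left : {w : Word d} → Pos w → Word d
left here             = []
left (copy {h} n p)   = pow h n ++ left p
left (there {f} p)    = f ∷ left p

right : {w : Word d} → Pos w → Word d
right (here {w = w})   = w
-- Behind copy `n` there are again ω copies, so the whole factor reappears whatever `n` is.
right (copy {h} {w} n p) = right p ++ h ^ω ∷ w
right (there p)        = right p

-- Both kinds of arena share one type, so that a structure can be played against a word. The two
-- sides of a point of `sub A P` are again of the form `sub A`, which avoids iterated substructures.
data State (d : ℕ) : Set₁ where
  sub  : (A : ColoredOrdinal d) → (Carrier A → Set) → State d
  word : Word d → State d

Position : State d → Set
Position (sub A P) = ∃ P
Position (word w)  = Pos w

colourₛ : (s : State d) → Position s → Fin d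
colourₛ (sub A P) (a , _) = ColoredOrdinal.color A a
colourₛ (word w)  p       = colour p

leftₛ : (s : State d) → Position s → State d
leftₛ (sub A P) (a , _) = sub A (λ b → P b × ColoredOrdinal._<_ A b a)
leftₛ (word w)  p       = word (left p)

rightₛ : (s : State d) → Position s → State d
rightₛ (sub A P) (a , _) = sub A (λ b → P b × ColoredOrdinal._<_ A a b)
rightₛ (word w)  p       = word (right p)

infix 4 _~[_]_ _≈[_]_

record Match {d : ℕ} (s : State d) (p : Position s) (r : ℕ)
             (t : State d) (p′ : Position t) : Set

-- The duplicator wins the r-round Ehrenfeucht–Fraïssé game: a move splits
-- either side into the parts left and right of the chosen point.
record _~[_]_ {d : ℕ} (s : State d) (r : ℕ) (t : State d) : Set where
  inductive
  field
    forth : ∀ {r′} → r ≡ suc r′ → ∀ p → ∃[ p′ ] Match s p r′ t p′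
    back  : ∀ {r′} → r ≡ suc r′ → ∀ p′ → ∃[ p ] Match s p r′ t p′

record Match {d} s p r t p′ where
  inductive
  eta-equality
  constructor match
  field
    colour≡ : colourₛ s p ≡ colourₛ t p′
    left~   : leftₛ s p ~[ r ] leftₛ t p′
    right~  : rightₛ s p ~[ r ] rightₛ t p′

open _~[_]_
open Match

_≈[_]_ : Word d → ℕ → Word d → Set
u ≈[ r ] v = word u ~[ r ] word v

~-zero : {s t : State d} → s ~[ 0 ] t
~-zero .forth ()
~-zero .back ()

~-suc : {s t : State d} → (∀ p → ∃[ p′ ] Match s p r t p′) →
        (∀ p′ → ∃[ p ] Match s p r t p′) → s ~[ suc r ] t
~-suc f g .forth refl = f
~-suc f g .back refl = g

~-refl : ∀ {r} {s : State d} → s ~[ r ] s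
~-refl {r = zero}  = ~-zero
~-refl {r = suc r} = ~-suc (λ p → p , match refl ~-refl ~-refl) (λ p → p , match refl ~-refl ~-refl)

~-reflexive : {u v : Word d} → u ≡ v → u ≈[ r ] v
~-reflexive refl = ~-refl

~-sym : {s t : State d} → s ~[ r ] t → t ~[ r ] s
~-sym {r = zero}  e = ~-zero
~-sym {r = suc r} e = ~-suc
  (λ p → let p′ , m = back e refl p in p′ , match (sym (colour≡ m)) (~-sym (left~ m)) (~-sym (right~ m)))
  (λ p → let p′ , m = forth e refl p in p′ , match (sym (colour≡ m)) (~-sym (left~ m)) (~-sym (right~ m)))

match-sym : {s t : State d} {p : Position s} {p′ : Position t} →
            Match s p r t p′ → Match t p′ r s p
match-sym (match c l τ) = match (sym c) (~-sym l) (~-sym τ)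

~-trans : {s t u : State d} → s ~[ r ] t → t ~[ r ] u → s ~[ r ] u

match-trans : {s t u : State d} {p : Position s} {p′ : Position t} {p″ : Position u} →
              Match s p r t p′ → Match t p′ r u p″ → Match s p r u p″
match-trans (match c l τ) (match c′ l′ τ′) =
  match (trans c c′) (~-trans l l′) (~-trans τ τ′)

~-trans {r = zero}  e e′ = ~-zero
~-trans {r = suc r} e e′ = ~-suc
  (λ p → let p′ , m = forth e refl p ; p″ , m′ = forth e′ refl p′ in p″ , match-trans m m′)
  (λ p → let p′ , m = back e′ refl p ; p″ , m′ = back e refl p′ in p″ , match-trans m′ m)

~-pred : {s t : State d} → s ~[ suc r ] t → s ~[ r ] t
~-pred {r = zero}  e = ~-zero
~-pred {r = suc r} e = ~-suc
  (λ p → let p′ , match c l τ = forth e refl p in p′ , match c (~-pred l) (~-pred τ))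
  (λ p → let p′ , match c l τ = back e refl p in p′ , match c (~-pred l) (~-pred τ))

~-empty : {s t : State d} → ¬ Position s → ¬ Position t → ∀ {r} → s ~[ r ] t
~-empty e e′ {zero}  = ~-zero
~-empty e e′ {suc r} = ~-suc (λ p → ⊥-elim (e p)) (λ p → ⊥-elim (e′ p))

-- s is the ordered sum of s₁ and s₂, up to r rounds.
record Split {d : ℕ} (s s₁ s₂ : State d) (r : ℕ) : Set where
  inductive
  field
    cases : ∀ {r′} → r ≡ suc r′ → ∀ p →
      (∃[ p₁ ] (colourₛ s p ≡ colourₛ s₁ p₁) × (leftₛ s p ~[ r′ ] leftₛ s₁ p₁)
               × Split (rightₛ s p) (rightₛ s₁ p₁) s₂ r′)
      ⊎ (∃[ p₂ ] (colourₛ s p ≡ colourₛ s₂ p₂) × Split (leftₛ s p) s₁ (leftₛ s₂ p₂) r′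
                 × (rightₛ s p ~[ r′ ] rightₛ s₂ p₂))
    from₁ : ∀ {r′} → r ≡ suc r′ → ∀ p₁ →
      ∃[ p ] (colourₛ s p ≡ colourₛ s₁ p₁) × (leftₛ s p ~[ r′ ] leftₛ s₁ p₁)
             × Split (rightₛ s p) (rightₛ s₁ p₁) s₂ r′
    from₂ : ∀ {r′} → r ≡ suc r′ → ∀ p₂ →
      ∃[ p ] (colourₛ s p ≡ colourₛ s₂ p₂) × Split (leftₛ s p) s₁ (leftₛ s₂ p₂) r′
             × (rightₛ s p ~[ r′ ] rightₛ s₂ p₂)

open Split

-- A move falls into one summand and is answered there; the other summand passes unchanged to one
-- side, with a round to spare.
glue : {s s₁ s₂ t t₁ t₂ : State d} → Split s s₁ s₂ r → Split t t₁ t₂ r →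
       s₁ ~[ r ] t₁ → s₂ ~[ r ] t₂ → s ~[ r ] t
glue-forth : {s s₁ s₂ t t₁ t₂ : State d} → Split s s₁ s₂ (suc r) → Split t t₁ t₂ (suc r) →
             s₁ ~[ suc r ] t₁ → s₂ ~[ suc r ] t₂ → ∀ p → ∃[ p′ ] Match s p r t p′
glue-forth S T e₁ e₂ p with cases S refl p
... | inj₁ (p₁ , c , l , τ) =
  let p₁′ , match c₁ l₁ τ₁ = forth e₁ refl p₁
      p′ , c′ , l′ , τ′    = from₁ T refl p₁′
  in p′ , match (trans c (trans c₁ (sym c′))) (~-trans l (~-trans l₁ (~-sym l′)))
                (glue τ τ′ τ₁ (~-pred e₂))
... | inj₂ (p₂ , c , l , τ) =
  let p₂′ , match c₂ l₂ τ₂ = forth e₂ refl p₂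
      p′ , c′ , l′ , τ′    = from₂ T refl p₂′
  in p′ , match (trans c (trans c₂ (sym c′))) (glue l l′ (~-pred e₁) l₂)
                (~-trans τ (~-trans τ₂ (~-sym τ′)))

glue {r = zero}  S T e₁ e₂ = ~-zero
glue {r = suc r} S T e₁ e₂ = ~-suc (glue-forth S T e₁ e₂)
  (λ p → let p′ , m = glue-forth T S (~-sym e₁) (~-sym e₂) p in p′ , match-sym m)

module _ (A B : ColoredOrdinal d) where
  private
    module A = ColoredOrdinal A
    module B = ColoredOrdinal B

  -- The correspondence is a relation because carriers are setoids: in `singleton` every member of
  -- one `≈`-class corresponds to every member of the other.
  record Iso (P : A.Carrier → Set) (P′ : B.Carrier → Set)
             (R : A.Carrier → B.Carrier → Set) : Set where
    field
      total      : ∀ {a} → P a → ∃[ b ] P′ b × R a b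
      surjective : ∀ {b} → P′ b → ∃[ a ] P a × R a b
      preserves  : ∀ {a b a′ b′} → R a b → R a′ b′ → a A.< a′ → b B.< b′
      reflects   : ∀ {a b a′ b′} → R a b → R a′ b′ → b B.< b′ → a A.< a′
      colours    : ∀ {a b} → R a b → A.color a ≡ B.color b

iso : {A B : ColoredOrdinal d} {P : Carrier A → Set} {P′ : Carrier B → Set}
      {R : Carrier A → Carrier B → Set} → Iso A B P P′ R → ∀ {r} → sub A P ~[ r ] sub B P′
iso I {zero} = ~-zero
iso {A = A} {B = B} {P} {P′} {R} I {suc r} = ~-suc
  (λ (a , Pa) → let b , P′b , Rab = total Pa in (b , P′b) , at Rab)
  (λ (b , P′b) → let a , Pa , Rab = surjective P′b in (a , Pa) , at Rab)
  where
  open Iso I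
  module A = ColoredOrdinal A
  module B = ColoredOrdinal B
  at : ∀ {a b} {Pa : P a} {P′b : P′ b} → R a b → Match (sub A P) (a , Pa) r (sub B P′) (b , P′b)
  at {a} {b} Rab = match (colours Rab)
    (iso {P = λ x → P x × x A.< a} {P′ = λ y → P′ y × y B.< b} record
      { total      = λ (Px , x<a) → let y , P′y , Rxy = total Px in
                       y , (P′y , preserves Rxy Rab x<a) , Rxy
      ; surjective = λ (P′y , y<b) → let x , Px , Rxy = surjective P′y in
                       x , (Px , reflects Rxy Rab y<b) , Rxy
      ; preserves = preserves ; reflects = reflects ; colours = colours })
    (iso {P = λ x → P x × a A.< x} {P′ = λ y → P′ y × b B.< y} record
      { total      = λ (Px , a<x) → let y , P′y , Rxy = total Px in
                       y , (P′y , preserves Rab Rxy a<x) , Rxy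
      ; surjective = λ (P′y , b<y) → let x , Px , Rxy = surjective P′y in
                       x , (Px , reflects Rab Rxy b<y) , Rxy
      ; preserves = preserves ; reflects = reflects ; colours = colours })

sub-cong : {A : ColoredOrdinal d} {P P′ : Carrier A → Set} →
           (∀ {a} → P a → P′ a) → (∀ {a} → P′ a → P a) → sub A P ~[ r ] sub A P′
sub-cong f g = iso {R = _≡_} record
  { total      = λ Pa → _ , f Pa , refl
  ; surjective = λ P′a → _ , g P′a , refl
  ; preserves  = λ { refl refl lt → lt }
  ; reflects   = λ { refl refl lt → lt }
  ; colours    = λ { refl → refl }
  }

record Partition (A : ColoredOrdinal d) (P P₁ P₂ : Carrier A → Set) : Set where
  constructor partition
  field
    into    : ∀ {a} → P a → P₁ a ⊎ P₂ a
    out₁    : ∀ {a} → P₁ a → P a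
    out₂    : ∀ {a} → P₂ a → P a
    ordered : ∀ {a b} → P₁ a → P₂ b → ColoredOrdinal._<_ A a b

split-sub : {A : ColoredOrdinal d} {P P₁ P₂ : Carrier A → Set} → Partition A P P₁ P₂ →
            ∀ {r} → Split (sub A P) (sub A P₁) (sub A P₂) r
split-sub part {zero} = record { cases = λ () ; from₁ = λ () ; from₂ = λ () }
split-sub {A = A} {P} {P₁} {P₂} part {suc r} = record
  { cases = λ { refl (a , Pa) → [ (λ P₁a → inj₁ ((a , P₁a) , at₁ Pa P₁a)) ,
    (λ P₂a → inj₂ ((a , P₂a) , at₂ Pa P₂a)) ]′ (into Pa) }
  ; from₁ = λ { refl (a , P₁a) → (a , out₁ P₁a) , at₁ (out₁ P₁a) P₁a }
  ; from₂ = λ { refl (a , P₂a) → (a , out₂ P₂a) , at₂ (out₂ P₂a) P₂a }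
  }
  where
  open Partition part
  open ColoredOrdinal A using (color; _<_; asym; irrefl; module Eq) renaming (trans to <-trans)
  at₁ : ∀ {a} (Pa : P a) (P₁a : P₁ a) → (color a ≡ color a)
        × (leftₛ (sub A P) (a , Pa) ~[ r ] leftₛ (sub A P₁) (a , P₁a))
        × Split (rightₛ (sub A P) (a , Pa)) (rightₛ (sub A P₁) (a , P₁a)) (sub A P₂) r
  at₁ Pa P₁a = refl
    , sub-cong (λ (Pb , b<a) → [ (λ P₁b → P₁b , b<a) ,
      (λ P₂b → ⊥-elim (asym b<a (ordered P₁a P₂b))) ]′ (into Pb))
               (λ (P₁b , b<a) → out₁ P₁b , b<a)
    , split-sub (partition
        (λ (Pb , a<b) → [ (λ P₁b → inj₁ (P₁b , a<b)) , inj₂ ]′ (into Pb))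
        (λ (P₁b , a<b) → out₁ P₁b , a<b)
        (λ P₂b → out₂ P₂b , ordered P₁a P₂b)
        (λ (P₁b , _) P₂c → ordered P₁b P₂c))
  at₂ : ∀ {a} (Pa : P a) (P₂a : P₂ a) → (color a ≡ color a)
        × Split (leftₛ (sub A P) (a , Pa)) (sub A P₁) (leftₛ (sub A P₂) (a , P₂a)) r
        × (rightₛ (sub A P) (a , Pa) ~[ r ] rightₛ (sub A P₂) (a , P₂a))
  at₂ Pa P₂a = refl
    , split-sub (partition
        (λ (Pb , b<a) → [ inj₁ , (λ P₂b → inj₂ (P₂b , b<a)) ]′ (into Pb))
        (λ P₁b → out₁ P₁b , ordered P₁b P₂a)
        (λ (P₂b , b<a) → out₂ P₂b , b<a)
        (λ P₁b (P₂c , _) → ordered P₁b P₂c))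
    , sub-cong (λ (Pb , a<b) → [ (λ P₁b → ⊥-elim (asym a<b (ordered P₁b P₂a))) ,
      (λ P₂b → P₂b , a<b) ]′ (into Pb))
               (λ (P₂b , a<b) → out₂ P₂b , a<b)

-- The graph of `colour`, `left` and `right`. As a relation it can be carried along `++`, `pow` and
-- `^ω` and inverted by pattern matching, without comparing positions of different words.
data Cut {d : ℕ} (w : Word d) : Fin d → Word d → Word d → Set where
  at : (p : Pos w) → Cut w (colour p) (left p) (right p)

variable
  c         : Fin d
  h u v w   : Word d
  l l′ τ τ′ : Word d

cut-∷ : ∀ {f} → Cut w c l τ → Cut (f ∷ w) c (f ∷ l) τ
cut-∷ (at p) = at (there p)

cut-≡ : Cut w c l τ → l ≡ l′ → τ ≡ τ′ → Cut w c l′ τ′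
cut-≡ k refl refl = k

cut-++ˡ : Cut u c l τ → Cut (u ++ v) c l (τ ++ v)
cut-++ˡ (at here)       = at here
cut-++ˡ (at (copy {h} {w} n p)) = cut-≡ (at (copy n p)) refl (sym (++-assoc (right p) (h ^ω ∷ w) _))
cut-++ˡ (at (there p))  = cut-∷ (cut-++ˡ (at p))

cut-++ʳ : ∀ u → Cut v c l τ → Cut (u ++ v) c (u ++ l) τ
cut-++ʳ []      k = k
cut-++ʳ (f ∷ u) k = cut-∷ (cut-++ʳ u k)

data ++Cut (u v : Word d) : Fin d → Word d → Word d → Set where
  inˡ : Cut u c l τ → ++Cut u v c l (τ ++ v)
  inʳ : Cut v c l τ → ++Cut u v c (u ++ l) τ

cut-++⁻ : ∀ u → Cut (u ++ v) c l τ → ++Cut u v c l τ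
cut-++⁻ []             k                    = inʳ k
cut-++⁻ (letter c ∷ u) (at here)            = inˡ (at here)
cut-++⁻ {v = v} (h ^ω ∷ u) (at (copy n p))  =
  subst (++Cut _ v _ _) (++-assoc (right p) (h ^ω ∷ u) v) (inˡ (at (copy n p)))
cut-++⁻ (f ∷ u)        (at (there p)) with colour p | left p | right p | cut-++⁻ u (at p)
... | _ | _ | _ | inˡ k = inˡ (cut-∷ k)
... | _ | _ | _ | inʳ k = inʳ k

cut-pow : ∀ i j → Cut h c l τ → Cut (pow h (i + suc j)) c (pow h i ++ l) (τ ++ pow h j)
cut-pow zero    j k = cut-++ˡ k
cut-pow {h = h} {l = l} (suc i) j k = cut-≡ (cut-++ʳ h (cut-pow i j k))
  (sym (++-assoc h (pow h i) l)) refl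

data PowCut (h : Word d) : ℕ → Fin d → Word d → Word d → Set where
  inPow : ∀ i j → Cut h c l τ → PowCut h (i + suc j) c (pow h i ++ l) (τ ++ pow h j)

cut-pow⁻ : ∀ n → Cut (pow h n) c l τ → PowCut h n c l τ
cut-pow⁻ {h = h} (suc n) k with cut-++⁻ h k
... | inˡ k′ = inPow 0 n k′
... | inʳ k′ with cut-pow⁻ n k′
...   | inPow i j k″ = subst (λ x → PowCut h _ _ x _) (++-assoc h (pow h i) _) (inPow (suc i) j k″)
cut-pow⁻ zero (at ())

cut-ω : ∀ n → Cut h c l τ → Cut [ h ^ω ] c (pow h n ++ l) (τ ++ [ h ^ω ])
cut-ω n (at p) = at (copy n p)

data ωCut (h : Word d) : Fin d → Word d → Word d → Set where
  inω : ∀ n → Cut h c l τ → ωCut h c (pow h n ++ l) (τ ++ [ h ^ω ])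

cut-ω⁻ : Cut [ h ^ω ] c l τ → ωCut h c l τ
cut-ω⁻ (at (copy n p)) = inω n (at p)

HasCut : ℕ → Word d → Fin d → Word d → Word d → Set
HasCut r w c l τ = ∃₂ λ l′ τ′ → Cut w c l′ τ′ × l′ ≈[ r ] l × τ′ ≈[ r ] τ

hasCut : Cut w c l τ → HasCut r w c l τ
hasCut k = _ , _ , k , ~-refl , ~-refl

≈-suc : (∀ {c l τ} → Cut u c l τ → HasCut r v c l τ) →
        (∀ {c l τ} → Cut v c l τ → HasCut r u c l τ) → u ≈[ suc r ] v
≈-suc {u = u} {r = r} {v = v} f g = ~-suc
  (λ p → let p′ , m = aux {w = v} p (f (at p)) in p′ , match-sym m)
  (λ p → aux {w = u} p (g (at p)))
  where
  aux : ∀ {w′} (p : Pos w′) → HasCut r w (colour p) (left p) (right p) →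
        ∃[ p′ ] Match (word w) p′ r (word w′) p
  aux p (_ , _ , k , e , f) = go k refl e f
    where
    go : ∀ {c l τ} → Cut w c l τ → c ≡ colour p → l ≈[ r ] left p → τ ≈[ r ] right p →
         ∃[ p′ ] Match (word w) p′ r (word _) p
    go (at p′) eq e f = p′ , match eq e f

≈-cut : u ≈[ suc r ] v → Cut u c l τ → HasCut r v c l τ
≈-cut e (at p) with forth e refl p
... | p′ , match c l τ rewrite c = _ , _ , at p′ , ~-sym l , ~-sym τ

split-word : ∀ u v {r} → Split {d} (word (u ++ v)) (word u) (word v) r
split-word u v {zero}  = record { cases = λ () ; from₁ = λ () ; from₂ = λ () }
split-word {d} u v {suc r} = record
  { cases = λ { refl p → view p (cut-++⁻ u (at p)) }
  ; from₁ = λ { refl p → fromˡ p (cut-++ˡ (at p)) }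
  ; from₂ = λ { refl p → fromʳ p (cut-++ʳ u (at p)) }
  }
  where
  Caseˡ Caseʳ : Pos (u ++ v) → Set
  Caseˡ p = ∃[ p₁ ] (colour p ≡ colour p₁) × (left p ≈[ r ] left p₁) ×
    Split (word (right p)) (word (right {w = u} p₁)) (word v) r
  Caseʳ p = ∃[ p₂ ] (colour p ≡ colour p₂) ×
    Split (word (left p)) (word u) (word (left {w = v} p₂)) r × (right p ≈[ r ] right p₂)
  atˡ : ∀ {c l τ} → Cut u c l τ → ∀ p → c ≡ colour p → l ≡ left p → τ ++ v ≡ right p → Caseˡ p
  atˡ (at p₁) p a b e = p₁ , sym a , ~-reflexive (sym b) ,
    subst (λ x → Split (word x) _ _ _) e (split-word (right p₁) v)
  atʳ : ∀ {c l τ} → Cut v c l τ → ∀ p → c ≡ colour p → u ++ l ≡ left p → τ ≡ right p → Caseʳ p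
  atʳ (at p₂) p a b e = p₂ , sym a ,
    subst (λ x → Split (word x) _ _ _) b (split-word u (left p₂)) , ~-reflexive (sym e)
  view : ∀ p → ++Cut u v (colour p) (left p) (right p) → Caseˡ p ⊎ Caseʳ p
  view p k = go k refl refl refl
    where
    go : ∀ {c l τ} → ++Cut u v c l τ → c ≡ colour p → l ≡ left p → τ ≡ right p → Caseˡ p ⊎ Caseʳ p
    go (inˡ k) a b e = inj₁ (atˡ k p a b e)
    go (inʳ k) a b e = inj₂ (atʳ k p a b e)
  Fromˡ : Pos u → Set
  Fromˡ p₁ = ∃[ p ] (colour {w = u ++ v} p ≡ colour p₁) × (left p ≈[ r ] left p₁) ×
    Split (word (right p)) (word (right p₁)) (word v) r
  Fromʳ : Pos v → Set
  Fromʳ p₂ = ∃[ p ] (colour {w = u ++ v} p ≡ colour p₂) ×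
    Split (word (left p)) (word u) (word (left p₂)) r × (right p ≈[ r ] right p₂)
  fromˡ : ∀ p₁ → Cut (u ++ v) (colour p₁) (left p₁) (right p₁ ++ v) → Fromˡ p₁
  fromˡ p₁ k = go k refl refl refl
    where
    go : ∀ {c l τ} → Cut (u ++ v) c l τ → c ≡ colour p₁ → l ≡ left p₁ → τ ≡ right p₁ ++ v → Fromˡ p₁
    go (at p) a b e = p , a , ~-reflexive b ,
      subst (λ x → Split (word x) _ _ _) (sym e) (split-word (right p₁) v)
  fromʳ : ∀ p₂ → Cut (u ++ v) (colour p₂) (u ++ left p₂) (right p₂) → Fromʳ p₂
  fromʳ p₂ k = go k refl refl refl
    where
    go : ∀ {c l τ} → Cut (u ++ v) c l τ → c ≡ colour p₂ → l ≡ u ++ left p₂ → τ ≡ right p₂ → Fromʳ p₂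
    go (at p) a b e = p , a , subst (λ x → Split (word x) _ _ _) (sym b) (split-word u (left p₂)) ,
      ~-reflexive e

++-cong : u ≈[ r ] v → l ≈[ r ] τ → u ++ l ≈[ r ] v ++ τ
++-cong {u = u} {v = v} {l = l} {τ = τ} = glue (split-word u l) (split-word v τ)

++-congˡ : ∀ u → v ≈[ r ] w → u ++ v ≈[ r ] u ++ w
++-congˡ u = ++-cong {u = u} ~-refl

++-congʳ : ∀ v → u ≈[ r ] w → u ++ v ≈[ r ] w ++ v
++-congʳ v e = ++-cong e (~-refl {s = word v})

pow-cong : ∀ n → u ≈[ r ] v → pow u n ≈[ r ] pow v n
pow-cong zero    e = ~-refl
pow-cong (suc n) e = ++-cong e (pow-cong n e)

ω-cong : u ≈[ r ] v → [ u ^ω ] ≈[ r ] [ v ^ω ]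
ω-cong {r = zero}  e = ~-zero
ω-cong {r = suc r} e = ≈-suc (half e) (half (~-sym e))
  where
  half : ∀ {u v c l τ} → u ≈[ suc r ] v → Cut [ u ^ω ] c l τ → HasCut r [ v ^ω ] c l τ
  half {u = u} e k with cut-ω⁻ k
  ... | inω n k′ with ≈-cut e k′
  ...   | _ , _ , k″ , e₁ , e₂ =
    _ , _ , cut-ω n k″ , ++-cong (pow-cong n (~-pred (~-sym e))) e₁ ,
      ++-cong e₂ (ω-cong (~-pred (~-sym e)))

-- Both words have the same cuts up to associativity: copy `n` of the tail is copy `suc n` of the
-- whole.
ω-unfold : ∀ (h : Word d) → h ++ [ h ^ω ] ≈[ r ] [ h ^ω ]
ω-unfold {r = zero} h = ~-zero
ω-unfold {r = suc r} h = ≈-suc f g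
  where
  f : ∀ {c l τ} → Cut (h ++ [ h ^ω ]) c l τ → HasCut r [ h ^ω ] c l τ
  f k with cut-++⁻ h k
  ... | inˡ k′ = hasCut (cut-ω 0 k′)
  ... | inʳ k′ with cut-ω⁻ k′
  ...   | inω n k″ = hasCut (cut-≡ (cut-ω (suc n) k″) (++-assoc h (pow h n) _) refl)
  g : ∀ {c l τ} → Cut [ h ^ω ] c l τ → HasCut r (h ++ [ h ^ω ]) c l τ
  g k with cut-ω⁻ k
  ... | inω zero k′    = hasCut (cut-++ˡ k′)
  ... | inω (suc n) k′ = hasCut (cut-≡ (cut-++ʳ h (cut-ω n k′)) (sym (++-assoc h (pow h n) _)) refl)

pow-ω : ∀ n (h : Word d) → pow h n ++ [ h ^ω ] ≈[ r ] [ h ^ω ]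
pow-ω zero    h = ~-refl
pow-ω {r = r} (suc n) h = ~-trans (~-reflexive (++-assoc h (pow h n) [ h ^ω ]))
  (~-trans (++-congˡ h (pow-ω n h)) (ω-unfold h))

-- Literal equality fails only at a point of copy `n` of an ω-power, where rejoining the sides
-- leaves `suc n` copies in front of the ω-power; these are absorbed.
cut-join : Cut h c l τ → ∀ {r} → l ++ letter c ∷ τ ≈[ r ] h
cut-join (at here) = ~-refl
cut-join (at (copy {h} {w} n p)) =
  ~-trans (~-reflexive (trans (++-assoc (pow h n) (left p) _)
    (cong (pow h n ++_) (sym (++-assoc (left p) (letter (colour p) ∷ right p) _)))))
  (~-trans (++-congˡ (pow h n) (++-congʳ (h ^ω ∷ w) (cut-join (at p))))
  (~-trans (~-reflexive (cong (pow h n ++_) (sym (++-assoc h [ h ^ω ] w))))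
  (~-trans (++-congˡ (pow h n) (++-congʳ w (ω-unfold h)))
  (~-trans (~-reflexive (sym (++-assoc (pow h n) [ h ^ω ] w))) (++-congʳ w (pow-ω n h))))))
cut-join (at (there {f} p)) = ++-congˡ [ f ] (cut-join (at p))

Empty : Word d → Set
Empty w = ¬ Pos w

empty-≈ : Empty w → ∀ {r} → w ≈[ r ] []
empty-≈ ¬p = ~-empty ¬p (λ ())

-- The left part has no points but may differ from `[]`, since factors such as `[] ^ω` are empty
-- too.
record First (w : Word d) : Set where
  constructor first
  field
    {c₀}     : Fin d
    {l₀ τ₀}  : Word d
    first-cut : Cut w c₀ l₀ τ₀
    l₀-empty : Empty l₀

first-∷ : ∀ {f} → Empty [ f ] → First w → First (f ∷ w)
first-∷ {f = f} e (first {l₀ = l₀} k e′) = first (cut-∷ k) (e″ f e e′)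
  where
  e″ : ∀ f → Empty [ f ] → Empty l₀ → Empty (f ∷ l₀)
  e″ (letter c) e e′ _ = e here
  e″ (h ^ω) e e′ (copy n p) = e (copy n p)
  e″ (h ^ω) e e′ (there p) = e′ p

empty-or-first : (w : Word d) → Empty w ⊎ First w
empty-or-first [] = inj₁ λ ()
empty-or-first (letter c ∷ w) = inj₂ (first (at here) λ ())
empty-or-first (h ^ω ∷ w) with empty-or-first h
... | inj₂ (first (at p) e) = inj₂ (first (at (copy 0 p)) e)
... | inj₁ e with empty-or-first w
...   | inj₁ e′ = inj₁ λ { (copy n p) → e p ; (there p) → e′ p }
...   | inj₂ k  = inj₂ (first-∷ (λ { (copy n p) → e p }) k)

-- The least size from which on sizes are not distinguished in r rounds.
threshold : ℕ → ℕ
threshold zero    = 0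
threshold (suc r) = threshold r + suc (threshold r)

-- The answer to a move splitting i + suc j when only sizes above the
-- threshold are large.
pow-split : ∀ r i j m → (i + suc j ≡ m ⊎ threshold (suc r) ℕ.≤ i + suc j ×
  threshold (suc r) ℕ.≤ m) →
  ∃₂ λ i′ j′ → i′ + suc j′ ≡ m × (i ≡ i′ ⊎ threshold r ℕ.≤ i × threshold r ℕ.≤ i′)
                               × (j ≡ j′ ⊎ threshold r ℕ.≤ j × threshold r ℕ.≤ j′)
pow-split r i j m (inj₁ e) = i , j , e , inj₁ refl , inj₁ refl
pow-split r i j m (inj₂ (T≤n , T≤m)) with ℕ.<-≤-connex i (threshold r) | ℕ.<-≤-connex j
  (threshold r)
... | inj₁ i<t | inj₁ j<t = ⊥-elim (ℕ.<⇒≱ (ℕ.+-mono-< i<t (s≤s j<t)) T≤n)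
... | inj₁ i<t | inj₂ t≤j = i , m ∸ suc i , e , inj₁ refl , inj₂ (t≤j , t≤)
  where
  i<m : i ℕ.< m
  i<m = ℕ.<-≤-trans i<t (ℕ.≤-trans (ℕ.m≤m+n _ _) T≤m)
  e : i + suc (m ∸ suc i) ≡ m
  e = trans (ℕ.+-suc i _) (ℕ.m+[n∸m]≡n i<m)
  t≤ : threshold r ℕ.≤ m ∸ suc i
  t≤ = ℕ.m+n≤o⇒m≤o∸n (threshold r) (ℕ.≤-trans (ℕ.+-monoʳ-≤ (threshold r) (ℕ.m≤n⇒m≤1+n i<t)) T≤m)
... | inj₂ t≤i | inj₁ j<t = m ∸ suc j , j , ℕ.m∸n+n≡m j<m , inj₂ (t≤i , t≤) , inj₁ refl
  where
  j<m : suc j ℕ.≤ m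
  j<m = ℕ.<-≤-trans j<t (ℕ.≤-trans (ℕ.m≤m+n _ _) T≤m)
  t≤ : threshold r ℕ.≤ m ∸ suc j
  t≤ = ℕ.m+n≤o⇒m≤o∸n (threshold r) (ℕ.≤-trans (ℕ.+-monoʳ-≤ (threshold r) (ℕ.m≤n⇒m≤1+n j<t)) T≤m)
... | inj₂ t≤i | inj₂ t≤j = m ∸ suc (threshold r) , threshold r ,
  ℕ.m∸n+n≡m (ℕ.≤-trans (ℕ.m≤n+m _ (threshold r)) T≤m)
  , inj₂ (t≤i , ℕ.m+n≤o⇒m≤o∸n (threshold r) T≤m) , inj₂ (t≤j , ℕ.≤-refl)

-- A cut of a power lies in one copy and is answered by the same cut of a copy chosen by
-- `pow-split`, so that on either side the exponents are again equal or both large for the rounds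
-- that remain.
pow-≈ : ∀ {r} h n m → (n ≡ m ⊎ threshold r ℕ.≤ n × threshold r ℕ.≤ m) → pow {d} h n ≈[ r ] pow h m
pow-≈ {r = zero}  h n m e = ~-zero
pow-≈ {d = d} {r = suc r} h n m e = ≈-suc (half n m e) (half m n (flip e))
  where
  flip : ∀ {A B : Set} {n m : ℕ} → (n ≡ m ⊎ A × B) → (m ≡ n ⊎ B × A)
  flip (inj₁ e)       = inj₁ (sym e)
  flip (inj₂ (a , b)) = inj₂ (b , a)
  half : ∀ n m → (n ≡ m ⊎ threshold (suc r) ℕ.≤ n × threshold (suc r) ℕ.≤ m) →
         ∀ {c l τ} → Cut (pow h n) c l τ → HasCut r (pow h m) c l τ
  half n m e k with cut-pow⁻ n k
  ... | inPow {l = l} {τ = τ} i j k′ with pow-split r i j m e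
  ...   | i′ , j′ , refl , ei , ej = _ , _ , cut-pow i′ j′ k′ ,
    ++-congʳ l (pow-≈ h i′ i (flip ei)) , ++-congˡ τ (pow-≈ h j′ j (flip ej))

pow-+ : ∀ i j (h : Word d) → pow h (i + j) ≡ pow h i ++ pow h j
pow-+ zero    j h = refl
pow-+ (suc i) j h = trans (cong (h ++_) (pow-+ i j h)) (sym (++-assoc h (pow h i) _))

pow-suc : ∀ {r} (h : Word d) → h ++ pow h (threshold r) ≈[ r ] pow h (threshold r)
pow-suc {r = r} h = pow-≈ h (suc (threshold r)) (threshold r) (inj₂ (ℕ.n≤1+n _ , ℕ.≤-refl))

-- x ≈ u x y forces x ≈ uⁿ x yⁿ, and for large n the powers absorb one more
-- factor.
stableˡ : ∀ {x y : Word d} → x ≈[ r ] u ++ x ++ y → u ++ x ≈[ r ] x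
stableˡ {r = r} {u = u} {x} {y} e = ~-trans (++-congˡ u (iter t))
  (~-trans (~-reflexive (sym (++-assoc u (pow u t) _)))
  (~-trans (++-congʳ _ (pow-suc {r = r} u)) (~-sym (iter t))))
  where
  t = threshold r
  iter : ∀ n → x ≈[ r ] pow u n ++ x ++ pow y n
  iter zero    = ~-reflexive (sym (++-identityʳ x))
  iter (suc n) = ~-trans (iter n) (~-trans (++-congˡ (pow u n) (++-congʳ (pow y n) e))
    (~-reflexive eq))
    where
    comm : ∀ n → pow u n ++ u ≡ u ++ pow u n
    comm n = trans (cong (pow u n ++_) (sym (++-identityʳ u)))
             (trans (sym (pow-+ n 1 u)) (cong (pow u) (ℕ.+-comm n 1)))
    eq : pow u n ++ (u ++ x ++ y) ++ pow y n ≡ (u ++ pow u n) ++ x ++ y ++ pow y n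
    eq = trans (cong (pow u n ++_) (trans (++-assoc u (x ++ y) _) (cong (u ++_) (++-assoc x y _))))
        (trans (sym (++-assoc (pow u n) u _)) (cong (_++ x ++ y ++ pow y n) (comm n)))

-- Two words that are prefix-below and suffix-below each other in opposite
-- directions are equivalent, since the finite monoid of types is aperiodic.
≈-antisym : ∀ {x y : Word d} u z → x ≈[ r ] u ++ y → y ≈[ r ] x ++ z → x ≈[ r ] y
≈-antisym {x = x} u z e f = ~-sym
  -- From `x ≈ u x z` follows `u x ≈ x` by `stableˡ`; hence `y ≈ x z ≈ u x z ≈ u y ≈ x`.
  (~-trans f (~-trans (++-congʳ z (~-sym (stableˡ (~-trans e (++-congˡ u f)))))
  (~-trans (~-reflexive (++-assoc u x z)) (~-trans (++-congˡ u (~-sym f)) (~-sym e)))))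

-- Replacement in context

≈-setoid : ℕ → ℕ → Setoid 0ℓ 0ℓ
≈-setoid d r = record
  { Carrier = Word d ; _≈_ = λ u v → u ≈[ r ] v
  ; isEquivalence = record { refl = ~-refl ; sym = ~-sym ; trans = ~-trans } }

HasChar : ℕ → Word d → Word d → Word d → Fin d → Word d → Word d → Set
HasChar r P E w c L R = ∃₂ λ l τ → Cut w c l τ × P ++ l ≈[ r ] L × τ ++ E ≈[ r ] R

hasChar-≈ : ∀ {P E P′ E′ L R L′ R′ : Word d} → HasChar r P E w c L R → P ≈[ r ] P′ → E ≈[ r ] E′ →
            L ≈[ r ] L′ → R ≈[ r ] R′ → HasChar r P′ E′ w c L′ R′
hasChar-≈ (l , τ , k , e , f) P≈ E≈ L≈ R≈ = l , τ , k
  , ~-trans (++-congʳ l (~-sym P≈)) (~-trans e L≈)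
  , ~-trans (++-congˡ τ (~-sym E≈)) (~-trans f R≈)

-- w may replace v between P and E without changing any r-character.
record CtxEq {d} (r : ℕ) (P E v w : Word d) : Set where
  field
    leftEq  : P ++ v ≈[ r ] P ++ w
    rightEq : v ++ E ≈[ r ] w ++ E
    chars   : ∀ {c l τ} → Cut v c l τ → HasChar r P E w c (P ++ l) (τ ++ E)
    chars⁻  : ∀ {c l τ} → Cut w c l τ → HasChar r P E v c (P ++ l) (τ ++ E)

open CtxEq

module _ {d r : ℕ} {P E : Word d} where

  ctx-refl : CtxEq r P E v v
  ctx-refl = record { leftEq = ~-refl ; rightEq = ~-refl
    ; chars = λ k → _ , _ , k , ~-refl , ~-refl ; chars⁻ = λ k → _ , _ , k , ~-refl , ~-refl }

  ctx-sym : CtxEq r P E v w → CtxEq r P E w v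
  ctx-sym x = record { leftEq = ~-sym (leftEq x) ; rightEq = ~-sym (rightEq x)
    ; chars = chars⁻ x ; chars⁻ = chars x }

  hasChar-ctx : ∀ {c L R} → CtxEq r P E v w → HasChar r P E v c L R → HasChar r P E w c L R
  hasChar-ctx x (_ , _ , k , e , f) = hasChar-≈ (chars x k) ~-refl ~-refl e f

  ctx-trans : CtxEq r P E u v → CtxEq r P E v w → CtxEq r P E u w
  ctx-trans x y = record
    { leftEq = ~-trans (leftEq x) (leftEq y) ; rightEq = ~-trans (rightEq x) (rightEq y)
    ; chars = λ k → hasChar-ctx y (chars x k) ; chars⁻ = λ k →
      hasChar-ctx (ctx-sym x) (chars⁻ y k) }

  ctx-≈ : ∀ {P′ E′} → P ≈[ r ] P′ → E ≈[ r ] E′ → CtxEq r P E v w → CtxEq r P′ E′ v w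
  ctx-≈ {v = v} {w = w} P≈ E≈ x = record
    { leftEq = ~-trans (++-congʳ v (~-sym P≈)) (~-trans (leftEq x) (++-congʳ w P≈))
    ; rightEq = ~-trans (++-congˡ v (~-sym E≈)) (~-trans (rightEq x) (++-congˡ w E≈))
    ; chars = λ {_} {l} {τ} k → hasChar-≈ (chars x k) P≈ E≈ (++-congʳ l P≈) (++-congˡ τ E≈)
    ; chars⁻ = λ {_} {l} {τ} k → hasChar-≈ (chars⁻ x k) P≈ E≈ (++-congʳ l P≈) (++-congˡ τ E≈) }

  ≈⇒ctx : v ≈[ suc r ] w → CtxEq r P E v w
  ≈⇒ctx {v = v} {w = w} e = record
    { leftEq = ++-congˡ P (~-pred e) ; rightEq = ++-congʳ E (~-pred e)
    ; chars = half e ; chars⁻ = half (~-sym e) }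
    where
    half : ∀ {v w c l τ} → v ≈[ suc r ] w → Cut v c l τ → HasChar r P E w c (P ++ l) (τ ++ E)
    half e k with ≈-cut e k
    ... | l′ , τ′ , k′ , el , eτ = l′ , τ′ , k′ , ++-congˡ P el , ++-congʳ E eτ

-- A point of `u` sees the exchanged factor only on its right and a point of `v` only on its left,
-- so `rightEq` and `leftEq` deal with them; `chars` deals with the points of the factor itself.
ctx-wrap : ∀ {P E : Word d} u v {W W′} → CtxEq r (P ++ u) (v ++ E) W W′ →
  CtxEq r P E (u ++ W ++ v) (u ++ W′ ++ v)
ctx-wrap {d} {r} {P} {E} u v {W} {W′} x = record
  { leftEq = wrapˡ x ; rightEq = wrapʳ x {u} ; chars = half {W} {W′} x
    ; chars⁻ = half {W′} {W} (ctx-sym x) }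
  where
  open ≈-Reasoning (≈-setoid d r)
  wrapˡ : ∀ {W W′} → CtxEq r (P ++ u) (v ++ E) W W′ → P ++ u ++ W ++ v ≈[ r ] P ++ u ++ W′ ++ v
  wrapˡ {W} {W′} x = begin
    P ++ u ++ W ++ v     ≡⟨ solve (++-monoid (Factor d)) ⟩
    ((P ++ u) ++ W) ++ v  ≈⟨ ++-congʳ v (leftEq x) ⟩
    ((P ++ u) ++ W′) ++ v ≡⟨ solve (++-monoid (Factor d)) ⟩
    P ++ u ++ W′ ++ v    ∎
  wrapʳ : ∀ {W W′} → CtxEq r (P ++ u) (v ++ E) W W′ → ∀ {u} →
    (u ++ W ++ v) ++ E ≈[ r ] (u ++ W′ ++ v) ++ E
  wrapʳ {W} {W′} x {u} = begin
    (u ++ W ++ v) ++ E  ≡⟨ solve (++-monoid (Factor d)) ⟩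
    u ++ W ++ v ++ E    ≈⟨ ++-congˡ u (rightEq x) ⟩
    u ++ W′ ++ v ++ E   ≡⟨ solve (++-monoid (Factor d)) ⟩
    (u ++ W′ ++ v) ++ E ∎
  half : ∀ {W W′ c l τ} → CtxEq r (P ++ u) (v ++ E) W W′ → Cut (u ++ W ++ v) c l τ →
         HasChar r P E (u ++ W′ ++ v) c (P ++ l) (τ ++ E)
  half {W} {W′} x k with cut-++⁻ u k
  ... | inˡ {τ = τ} k = _ , _ , cut-++ˡ k , ~-refl , ~-sym (wrapʳ x {τ})
  ... | inʳ k with cut-++⁻ W k
  ...   | inˡ {l = l} {τ} k with chars x k
  ...     | l′ , τ′ , k′ , e , f = _ , _ , cut-++ʳ u (cut-++ˡ k′)
    , (begin P ++ u ++ l′   ≡⟨ solve (++-monoid (Factor d)) ⟩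
             (P ++ u) ++ l′ ≈⟨ e ⟩
             (P ++ u) ++ l  ≡⟨ solve (++-monoid (Factor d)) ⟩
             P ++ u ++ l    ∎)
    , (begin (τ′ ++ v) ++ E ≡⟨ solve (++-monoid (Factor d)) ⟩
             τ′ ++ v ++ E   ≈⟨ f ⟩
             τ ++ v ++ E    ≡⟨ solve (++-monoid (Factor d)) ⟩
             (τ ++ v) ++ E  ∎)
  half {W} {W′} x _ | inʳ _ | inʳ {l = l} k = _ , _ , cut-++ʳ u (cut-++ʳ W′ k)
    , (begin P ++ u ++ W′ ++ l     ≡⟨ solve (++-monoid (Factor d)) ⟩
             ((P ++ u) ++ W′) ++ l ≈⟨ ++-congʳ l (~-sym (leftEq x)) ⟩
             ((P ++ u) ++ W) ++ l  ≡⟨ solve (++-monoid (Factor d)) ⟩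
             P ++ u ++ W ++ l      ∎)
    , ~-refl

-- A round is gained because the first move names an r-character of the whole word, and these agree.
ctx⇒≈ : ∀ {P E : Word d} → CtxEq r P E v w → P ++ v ++ E ≈[ suc r ] P ++ w ++ E
ctx⇒≈ {d} {r} {P = P} {E} x = ≈-suc (half x) (half (ctx-sym x))
  where
  open ≈-Reasoning (≈-setoid d r)
  half : ∀ {v w c l τ} → CtxEq r P E v w → Cut (P ++ v ++ E) c l τ → HasCut r (P ++ w ++ E) c l τ
  half {v} {w} x k with cut-++⁻ P k
  ... | inˡ {τ = τ} k = _ , _ , cut-++ˡ k , ~-refl , ++-congˡ τ (~-sym (rightEq x))
  ... | inʳ k with cut-++⁻ v k
  ...   | inˡ k with chars x k
  ...     | l′ , τ′ , k′ , e , f = _ , _ , cut-++ʳ P (cut-++ˡ k′) , e , f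
  half {v} {w} x _ | inʳ _ | inʳ {l = l} k = _ , _ , cut-++ʳ P (cut-++ʳ w k)
    , (begin P ++ w ++ l   ≡⟨ solve (++-monoid (Factor d)) ⟩
             (P ++ w) ++ l ≈⟨ ++-congʳ l (~-sym (leftEq x)) ⟩
             (P ++ v) ++ l ≡⟨ solve (++-monoid (Factor d)) ⟩
             P ++ v ++ l   ∎)
    , ~-refl

-- All copies change at once. With an empty prefix, `leftEq` makes `H` and `H′` equivalent outright,
-- which takes care of the other copies for `r` rounds; the first move in a copy is answered by
-- `chars`, and this gains a round.
ctx-ω : ∀ {H H′ : Word d} → CtxEq r [] [ H ^ω ] H H′ → [ H ^ω ] ≈[ suc r ] [ H′ ^ω ]
ctx-ω {d} {r} {H} {H′} x = ≈-suc f g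
  where
  Hω≈ : [ H ^ω ] ≈[ r ] [ H′ ^ω ]
  Hω≈ = ω-cong (leftEq x)
  f : ∀ {c l τ} → Cut [ H ^ω ] c l τ → HasCut r [ H′ ^ω ] c l τ
  f k with cut-ω⁻ k
  ... | inω n k with chars x k
  ...   | l′ , τ′ , k′ , e , e′ = _ , _ , cut-ω n k′
    , ++-cong (pow-cong n (~-sym (leftEq x))) e , ~-trans (++-congˡ τ′ (~-sym Hω≈)) e′
  g : ∀ {c l τ} → Cut [ H′ ^ω ] c l τ → HasCut r [ H ^ω ] c l τ
  g k with cut-ω⁻ k
  ... | inω {τ = τ} n k with chars⁻ x k
  ...   | l′ , τ′ , k′ , e , e′ = _ , _ , cut-ω n k′
    , ++-cong (pow-cong n (leftEq x)) e , ~-trans e′ (++-congˡ τ Hω≈)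

pow-absorb : ∀ {P} n → P ++ h ≈[ r ] P → P ++ pow h n ≈[ r ] P
pow-absorb {P = P} zero e = ~-reflexive (++-identityʳ P)
pow-absorb {h = h} {P = P} (suc n) e =
  ~-trans (~-reflexive (sym (++-assoc P h (pow h n))))
    (~-trans (++-congʳ (pow h n) e) (pow-absorb n e))

-- Since `P` absorbs `h`, the number of a copy is invisible from the left, and every move can be
-- answered in copy 0.
ctx-ω-body : ∀ {P E h h′ : Word d} → P ++ h ≈[ r ] P → [ h ^ω ] ≈[ r ] [ h′ ^ω ] →
             CtxEq r P ([ h ^ω ] ++ E) h h′ → CtxEq r P E [ h ^ω ] [ h′ ^ω ]
ctx-ω-body {d} {r} {P} {E} {h} {h′} Ph≈P hω≈ x = record
  { leftEq = ++-congˡ P hω≈ ; rightEq = ++-congʳ E hω≈ ; chars = f ; chars⁻ = g }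
  where
  open ≈-Reasoning (≈-setoid d r)
  Ph′≈P : P ++ h′ ≈[ r ] P
  Ph′≈P = ~-trans (~-sym (leftEq x)) Ph≈P
  absorb : ∀ {h} n l → P ++ h ≈[ r ] P → P ++ pow h n ++ l ≈[ r ] P ++ l
  absorb {h} n l e = ~-trans (~-reflexive (sym (++-assoc P (pow h n) l)))
    (++-congʳ l (pow-absorb n e))
  right-ω : ∀ {h h′} τ τ′ → [ h ^ω ] ≈[ r ] [ h′ ^ω ] →
    τ′ ++ [ h ^ω ] ++ E ≈[ r ] τ ++ [ h ^ω ] ++ E →
            (τ′ ++ [ h′ ^ω ]) ++ E ≈[ r ] (τ ++ [ h ^ω ]) ++ E
  right-ω {h} {h′} τ τ′ e f = begin
    (τ′ ++ [ h′ ^ω ]) ++ E ≡⟨ ++-assoc τ′ _ E ⟩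
    τ′ ++ [ h′ ^ω ] ++ E   ≈⟨ ++-congˡ τ′ (++-congʳ E (~-sym e)) ⟩
    τ′ ++ [ h ^ω ] ++ E    ≈⟨ f ⟩
    τ ++ [ h ^ω ] ++ E     ≡⟨ ++-assoc τ _ E ⟨
    (τ ++ [ h ^ω ]) ++ E   ∎
  f : ∀ {c l τ} → Cut [ h ^ω ] c l τ → HasChar r P E [ h′ ^ω ] c (P ++ l) (τ ++ E)
  f k with cut-ω⁻ k
  ... | inω {l = l} {τ} n k with chars x k
  ...   | l′ , τ′ , k′ , e , e′ = _ , _ , cut-ω 0 k′ , ~-trans e (~-sym (absorb n l Ph≈P)) ,
    right-ω τ τ′ hω≈ e′
  g : ∀ {c l τ} → Cut [ h′ ^ω ] c l τ → HasChar r P E [ h ^ω ] c (P ++ l) (τ ++ E)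
  g k with cut-ω⁻ k
  ... | inω {l = l} {τ} n k with chars⁻ x k
  ...   | l′ , τ′ , k′ , e , e′ = _ , _ , cut-ω 0 k′ , ~-trans e (~-sym (absorb n l Ph′≈P))
    , right-ω τ τ′ (~-sym hω≈) (~-trans (++-congˡ τ′ (++-congʳ E (~-sym hω≈)))
      (~-trans e′ (++-congˡ τ (++-congʳ E hω≈))))

pow-clamp : ∀ (h : Word d) N → threshold r ℕ.< N → ∀ n → ∃₂ λ i j → i + suc j ≡ N ×
  pow h i ≈[ r ] pow h n
pow-clamp h (suc M) (s≤s t≤M) n with ℕ.<-≤-connex n (suc M)
... | inj₁ n<N = n , M ∸ n , trans (ℕ.+-suc n _) (ℕ.m+[n∸m]≡n n<N) , ~-refl
-- The last of the `N` copies has `M` copies before it, which must still reach the threshold; hence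
-- the strict inequality between `threshold r` and `N`.
... | inj₂ N≤n = M , 0 , ℕ.+-comm M 1 , pow-≈ h M n (inj₂ (t≤M , ℕ.≤-trans t≤M (ℕ.<⇒≤ N≤n)))

module _ {d : ℕ} {h f g : Word d} (fg≈h : ∀ {r} → f ++ g ≈[ r ] h) where

  -- If the limit cut after h ω looks like the cut f | g of h, both from the
  -- left and from the right, then h ω can be cut down to N copies of h and f.
  collapse-ω : ∀ {P E} N → threshold r ℕ.< N → P ++ pow h N ++ f ≈[ r ] P ++ [ h ^ω ] →
               g ++ [ h ^ω ] ++ E ≈[ r ] E → CtxEq r P E [ h ^ω ] (pow h N ++ f)
  collapse-ω {r} {P} {E} N t<N e₁ e₂ = record
    { leftEq = ~-sym e₁ ; rightEq = ~-trans (~-sym (shift N))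
      (~-reflexive (sym (++-assoc (pow h N) f E)))
    ; chars = to ; chars⁻ = from }
    where
    open ≈-Reasoning (≈-setoid d r)
    -- This is where `f` is needed: `f E ≈ f g hω E ≈ h hω E`, so `f` before `E` has the effect of
    -- `hω`.
    shift : ∀ j → pow h j ++ f ++ E ≈[ r ] [ h ^ω ] ++ E
    shift j = go [ h ^ω ] e₂ (pow-ω j h) (ω-unfold h)
      where
      go : ∀ W → g ++ W ++ E ≈[ r ] E → pow h j ++ W ≈[ r ] W → h ++ W ≈[ r ] W →
           pow h j ++ f ++ E ≈[ r ] W ++ E
      go W e e′ e″ = begin
        pow h j ++ f ++ E             ≈⟨ ++-congˡ (pow h j) (++-congˡ f (~-sym e)) ⟩
        pow h j ++ f ++ g ++ W ++ E   ≡⟨ cong (pow h j ++_) (++-assoc f g (W ++ E)) ⟨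
        pow h j ++ (f ++ g) ++ W ++ E ≈⟨ ++-congˡ (pow h j) (++-congʳ (W ++ E) fg≈h) ⟩
        pow h j ++ h ++ W ++ E        ≡⟨ cong (pow h j ++_) (++-assoc h W E) ⟨
        pow h j ++ (h ++ W) ++ E      ≈⟨ ++-congˡ (pow h j) (++-congʳ E e″) ⟩
        pow h j ++ W ++ E             ≡⟨ ++-assoc (pow h j) W E ⟨
        (pow h j ++ W) ++ E           ≈⟨ ++-congʳ E e′ ⟩
        W ++ E                        ∎
    shift′ : ∀ j τ → ((τ ++ pow h j) ++ f) ++ E ≈[ r ] (τ ++ [ h ^ω ]) ++ E
    shift′ j τ = begin
      ((τ ++ pow h j) ++ f) ++ E ≡⟨ trans (++-assoc (τ ++ pow h j) f E)
        (++-assoc τ (pow h j) (f ++ E)) ⟩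
      τ ++ pow h j ++ f ++ E     ≈⟨ ++-congˡ τ (shift j) ⟩
      τ ++ [ h ^ω ] ++ E         ≡⟨ ++-assoc τ [ h ^ω ] E ⟨
      (τ ++ [ h ^ω ]) ++ E       ∎
    to : ∀ {c l τ} → Cut [ h ^ω ] c l τ → HasChar r P E (pow h N ++ f) c (P ++ l) (τ ++ E)
    to k with cut-ω⁻ k
    ... | inω {l = l} {τ} n k with pow-clamp {r = r} h N t<N n
    ...   | i , j , refl , e = _ , _ , cut-++ˡ (cut-pow i j k) , ++-congˡ P (++-congʳ l e) ,
      shift′ j τ
    from : ∀ {c l τ} → Cut (pow h N ++ f) c l τ → HasChar r P E [ h ^ω ] c (P ++ l) (τ ++ E)
    from k with cut-++⁻ (pow h N) k
    ... | inˡ k with cut-pow⁻ N k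
    ...   | inPow {l = l} {τ} i j k = _ , _ , cut-ω i k , ~-refl , ~-sym (shift′ j τ)
    -- A point of the final `f` is answered by the corresponding point of copy `N`, because `f` is
    -- the beginning of `h`.
    from _ | inʳ {l = f₁} {τ = f₂} k with ≈-cut fg≈h (cut-++ˡ {v = g} k)
    ... | l′ , τ′ , k′ , e , e′ = _ , _ , cut-ω N k′ , ++-congˡ P (++-congˡ (pow h N) e) , (begin
      (τ′ ++ [ h ^ω ]) ++ E     ≈⟨ ++-congʳ E (++-congʳ [ h ^ω ] e′) ⟩
      ((f₂ ++ g) ++ [ h ^ω ]) ++ E ≡⟨ trans (++-assoc (f₂ ++ g) [ h ^ω ] E) (++-assoc f₂ g _) ⟩
      f₂ ++ g ++ [ h ^ω ] ++ E   ≈⟨ ++-congˡ f₂ e₂ ⟩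
      f₂ ++ E                   ∎)

  -- A game move inside P h^N f at the first letter of h^N f is answered in
  -- P h ω by a cut whose right part still ends in h ω.
  limit-absorbed : ∀ {P} N → First (pow h N ++ f) → P ++ pow h N ++ f ≈[ suc r ] P ++ [ h ^ω ] →
                   pow h N ++ f ≈[ r ] [ h ^ω ]
  limit-absorbed {r} {P} N (first {c₀} {l₀} {τ₀} k l₀-empty) e with ≈-cut e (cut-++ʳ P k)
  -- The cut `k` is at the first letter of `y`, so the right part of the answer amounts to `y`
  -- without that letter. This part ends in `hω`, whence `y ≈ u hω` for some `u`; conversely `hω` is
  -- `y` followed by `g hω`.
  ... | l , τ , k′ , _ , τ≈ = ≈-antisym (proj₁ suffix) (g ++ [ h ^ω ]) (proj₂ suffix) prefix
    where
    open ≈-Reasoning (≈-setoid d r)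
    y = pow h N ++ f
    y≈ : y ≈[ r ] letter c₀ ∷ τ
    y≈ = begin
      y                       ≈⟨ cut-join k ⟨
      l₀ ++ letter c₀ ∷ τ₀    ≈⟨ ++-cong (empty-≈ l₀-empty) (++-congˡ [ letter c₀ ] (~-sym τ≈)) ⟩
      letter c₀ ∷ τ           ∎
    suffix : ∃[ u ] y ≈[ r ] u ++ [ h ^ω ]
    suffix with cut-++⁻ P k′
    ... | inˡ {τ = τ′} _ = letter c₀ ∷ τ′ , y≈
    ... | inʳ k″ with cut-ω⁻ k″
    ...   | inω {τ = τ′} _ _ = letter c₀ ∷ τ′ , y≈
    prefix : [ h ^ω ] ≈[ r ] y ++ g ++ [ h ^ω ]
    prefix = go [ h ^ω ] (pow-ω N h) (ω-unfold h)
      where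
      go : ∀ W → pow h N ++ W ≈[ r ] W → h ++ W ≈[ r ] W → W ≈[ r ] y ++ g ++ W
      go W e e′ = begin
        W                              ≈⟨ e ⟨
        pow h N ++ W                   ≈⟨ ++-congˡ (pow h N) e′ ⟨
        pow h N ++ h ++ W              ≈⟨ ++-congˡ (pow h N) (++-congʳ W fg≈h) ⟨
        pow h N ++ (f ++ g) ++ W       ≡⟨ trans (cong (pow h N ++_) (++-assoc f g W))
          (sym (++-assoc (pow h N) f (g ++ W))) ⟩
        (pow h N ++ f) ++ g ++ W       ∎

  -- Dually, a move at the first letter of E.
  return-absorbed : ∀ u v E → let H = u ++ [ h ^ω ] ++ v ; E₀ = v ++ [ H ^ω ] in
    g ++ [ h ^ω ] ++ E₀ ++ E ≈[ suc r ] E₀ ++ E → g ++ [ h ^ω ] ++ E₀ ≈[ r ] E₀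
  return-absorbed {r} u v E e = go [ h ^ω ] [ (u ++ [ h ^ω ] ++ v) ^ω ] (ω-unfold h) (ω-unfold _) e
    where
    open ≈-Reasoning (≈-setoid d r)
    go : ∀ W X → h ++ W ≈[ r ] W → (u ++ W ++ v) ++ X ≈[ r ] X →
         g ++ W ++ (v ++ X) ++ E ≈[ suc r ] (v ++ X) ++ E → g ++ W ++ v ++ X ≈[ r ] v ++ X
    go W X hW≈W HX≈X e with empty-or-first E
    ... | inj₁ E-empty = begin
      g ++ W ++ v ++ X            ≡⟨ cong (λ z → g ++ W ++ z) (++-identityʳ (v ++ X)) ⟨
      g ++ W ++ (v ++ X) ++ []    ≈⟨ ++-congˡ g (++-congˡ W (++-congˡ (v ++ X) (empty-≈ E-empty))) ⟨
      g ++ W ++ (v ++ X) ++ E     ≈⟨ ~-pred e ⟩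
      (v ++ X) ++ E               ≈⟨ ++-congˡ (v ++ X) (empty-≈ E-empty) ⟩
      (v ++ X) ++ []              ≡⟨ ++-identityʳ (v ++ X) ⟩
      v ++ X                      ∎
    ... | inj₂ (first {l₀ = l₀} k l₀-empty) with ≈-cut (~-sym e) (cut-++ʳ (v ++ X) k)
    ... | l , τ , k′ , l≈ , _ = conclude (cut-++⁻ y (subst (λ z → Cut z _ _ _) assoc k′)) l≈E₀
      where
      E₀ y : Word d
      E₀ = v ++ X
      y = g ++ W ++ E₀
      assoc : g ++ W ++ (v ++ X) ++ E ≡ (g ++ W ++ v ++ X) ++ E
      assoc = solve (++-monoid (Factor d))
      l≈E₀ : l ≈[ r ] E₀
      l≈E₀ = begin
        l         ≈⟨ l≈ ⟩
        E₀ ++ l₀  ≈⟨ ++-congˡ E₀ (empty-≈ l₀-empty) ⟩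
        E₀ ++ []  ≡⟨ ++-identityʳ E₀ ⟩
        E₀        ∎
      -- The next copy of `H` within `E₀` contains another `hω`, and writing it as `f g hω` exhibits
      -- `y` as a suffix of `E₀`.
      again : E₀ ≈[ r ] (v ++ u ++ f) ++ y
      again = begin
        v ++ X                               ≈⟨ ++-congˡ v HX≈X ⟨
        v ++ (u ++ W ++ v) ++ X              ≡⟨ solve (++-monoid (Factor d)) ⟩
        (v ++ u) ++ W ++ v ++ X              ≈⟨ ++-congˡ (v ++ u) (++-congʳ (v ++ X) hW≈W) ⟨
        (v ++ u) ++ (h ++ W) ++ v ++ X       ≈⟨ ++-congˡ (v ++ u)
          (++-congʳ (v ++ X) (++-congʳ W fg≈h)) ⟨
        (v ++ u) ++ ((f ++ g) ++ W) ++ v ++ X ≡⟨ solve (++-monoid (Factor d)) ⟩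
        (v ++ u ++ f) ++ g ++ W ++ v ++ X    ∎
      -- The answer to the first letter of `E` has a left part equivalent to `E₀`. If it lies in
      -- `y`, then `E₀` is a prefix of `y`, and `y` is a suffix of `E₀` by `again`. If it lies in
      -- `E`, then `y` is a prefix of `E₀`, which is a suffix of `y`.
      conclude : ∀ {c l τ} → ++Cut y E c l τ → l ≈[ r ] E₀ → y ≈[ r ] E₀
      conclude (inˡ {c = c} {l = l} {τ = τ} k) l≈ = ~-sym
        (≈-antisym (v ++ u ++ f) (letter c ∷ τ) again
        (~-trans (~-sym (cut-join k)) (++-congʳ (letter c ∷ τ) l≈)))
      conclude (inʳ {l = b} k) l≈ = ≈-antisym (g ++ W) b (~-reflexive (sym (++-assoc g W E₀)))
        (~-sym l≈)

  -- The replacement happens in every copy of `H`, so it may depend neither on the prefix `P` nor on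
  -- the suffix `E` outside. `limit-absorbed` and `return-absorbed` strip them at the price of one
  -- round, and `ctx-ω` returns that round.
  collapse-in-ω : ∀ {P} u v E N → threshold (suc r) ℕ.< N → First (pow h N ++ f) →
    let H = u ++ [ h ^ω ] ++ v in
    P ++ pow h N ++ f ≈[ suc r ] P ++ [ h ^ω ] →
    g ++ [ h ^ω ] ++ (v ++ [ H ^ω ]) ++ E ≈[ suc r ] (v ++ [ H ^ω ]) ++ E →
    [ H ^ω ] ≈[ suc r ] [ (u ++ (pow h N ++ f) ++ v) ^ω ]
  collapse-in-ω {r} u v E N t<N first-y e₁ e₂ =
    ctx-ω (ctx-wrap u v (collapse-ω N (ℕ.≤-<-trans (ℕ.m≤m+n _ _) t<N)
      (++-congˡ u (limit-absorbed N first-y e₁)) (return-absorbed u v E e₂)))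

-- Saving depth inside ω-powers

Bounded : ℕ → Word d → Set
Bounded D       []             = ⊤
Bounded D       (letter c ∷ w) = Bounded D w
Bounded zero    (h ^ω ∷ w)     = ⊥
Bounded (suc D) (h ^ω ∷ w)     = Bounded D h × Bounded (suc D) w

bounded-suc : ∀ D (w : Word d) → Bounded D w → Bounded (suc D) w
bounded-suc D       []             b         = tt
bounded-suc D       (letter c ∷ w) b         = bounded-suc D w b
bounded-suc (suc D) (h ^ω ∷ w)     (b₁ , b₂) = bounded-suc D h b₁ , bounded-suc (suc D) w b₂

bounded-≤ : ∀ {D m} (w : Word d) → D ℕ.≤ m → Bounded D w → Bounded m w
bounded-≤ {D = D} {m} w D≤m b = subst (λ m → Bounded m w) (ℕ.m∸n+n≡m D≤m) (go (m ∸ D))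
  where
  go : ∀ k → Bounded (k + D) w
  go zero    = b
  go (suc k) = bounded-suc (k + D) w (go k)

bounded-++ : ∀ D (u : Word d) → Bounded D u → Bounded D v → Bounded D (u ++ v)
bounded-++ D       []             b         b′ = b′
bounded-++ D       (letter c ∷ u) b         b′ = bounded-++ D u b b′
bounded-++ (suc D) (h ^ω ∷ u)     (b₁ , b₂) b′ = b₁ , bounded-++ (suc D) u b₂ b′

bounded-pow : ∀ D (h : Word d) → Bounded D h → ∀ n → Bounded D (pow h n)
bounded-pow D h b zero    = tt
bounded-pow D h b (suc n) = bounded-++ D h b (bounded-pow D h b n)

bounded-left : ∀ D {w : Word d} (p : Pos w) → Bounded D w → Bounded D (left p)
bounded-left D       here                      b         = tt
bounded-left (suc D) (copy {h} n p)            (b₁ , b₂) =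
  bounded-++ (suc D) (pow h n) (bounded-pow (suc D) h (bounded-suc D h b₁) n)
    (bounded-suc D (left p) (bounded-left D p b₁))
bounded-left D       (there {f = letter c} p)  b         = bounded-left D p b
bounded-left (suc D) (there {f = h ^ω} p)      (b₁ , b₂) = b₁ , bounded-left (suc D) p b₂

bounded-cut : ∀ D → Cut w c l τ → Bounded D w → Bounded D l
bounded-cut D (at p) = bounded-left D p

Char : ℕ → Set
Char d = Fin d × Word d × Word d

infix 4 _≈ᶜ[_]_

_≈ᶜ[_]_ : Char d → ℕ → Char d → Set
(c , L , R) ≈ᶜ[ r ] (c′ , L′ , R′) = c ≡ c′ × L ≈[ r ] L′ × R ≈[ r ] R′

≈ᶜ-sym : {x y : Char d} → x ≈ᶜ[ r ] y → y ≈ᶜ[ r ] x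
≈ᶜ-sym (c , L , R) = sym c , ~-sym L , ~-sym R

≈ᶜ-trans : {x y z : Char d} → x ≈ᶜ[ r ] y → y ≈ᶜ[ r ] z → x ≈ᶜ[ r ] z
≈ᶜ-trans (c , L , R) (c′ , L′ , R′) = trans c c′ , ~-trans L L′ , ~-trans R R′

infix 4 _∈ᶜ[_]_

_∈ᶜ[_]_ : Char d → ℕ → List (Char d) → Set
x ∈ᶜ[ r ] K = Any (x ≈ᶜ[ r ]_) K

∈ᶜ-≈ : {x y : Char d} {K : List (Char d)} → x ≈ᶜ[ r ] y → y ∈ᶜ[ r ] K → x ∈ᶜ[ r ] K
∈ᶜ-≈ {x = x} {y} e (here {z} m)  = here (≈ᶜ-trans {x = x} {y} {z} e m)
∈ᶜ-≈ {x = x} {y} e (there m) = there (∈ᶜ-≈ {x = x} {y} e m)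

delete : {x : Char d} {K : List (Char d)} → x ∈ᶜ[ r ] K →
         ∃[ K′ ] length K ≡ suc (length K′)
               × (∀ {y} → y ∈ᶜ[ r ] K → ¬ y ≈ᶜ[ r ] x → y ∈ᶜ[ r ] K′)
delete {d} {r} {x} {z ∷ K} (here e) = K , refl , λ
  { {y} (here e′) y≉x → ⊥-elim (y≉x (≈ᶜ-trans {x = y} {z} {x} e′ (≈ᶜ-sym {x = x} {z} e)))
    ; (there m) _ → m }
delete {K = z ∷ K} (there m) with delete m
... | K′ , e , f = z ∷ K′ , cong suc e ,
  λ { (here e′) _ → here e′ ; (there m′) y≉x → there (f m′ y≉x) }

-- `K` may repeat characters or list too many: only its length matters, as the bound on which the
-- induction runs.
Covers : ℕ → Word d → Word d → Word d → List (Char d) → Set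
Covers r P E w K = ∀ {c l τ} → Cut w c l τ → (c , P ++ l , τ ++ E) ∈ᶜ[ r ] K

covers-ctx : ∀ {P E : Word d} {K} → CtxEq r P E v w → Covers r P E v K → Covers r P E w K
covers-ctx x cov k with chars⁻ x k
... | l , τ , k′ , e , f = ∈ᶜ-≈ (refl , ~-sym e , ~-sym f) (cov k′)

covers-≈ : ∀ {P E P′ E′ : Word d} {K} → P ≈[ r ] P′ → E ≈[ r ] E′ → Covers r P E w K →
  Covers r P′ E′ w K
covers-≈ eP eE cov {l = l} {τ} k = ∈ᶜ-≈ (refl , ++-congʳ l (~-sym eP) , ++-congˡ τ (~-sym eE))
  (cov k)

empty-ω : Empty h → ∀ {r} → [ h ^ω ] ≈[ r ] []
empty-ω e = empty-≈ λ { (copy n p) → e p }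

cut-pos : Cut w c l τ → Pos w
cut-pos (at p) = p

empty-++ˡ : ∀ {u v : Word d} → Empty (u ++ v) → Empty u
empty-++ˡ {v = v} e p = e (cut-pos (cut-++ˡ {v = v} (at p)))

empty-++ʳ : ∀ u {v : Word d} → Empty (u ++ v) → Empty v
empty-++ʳ u e p = e (cut-pos (cut-++ʳ u (at p)))

nonempty-first : Cut w c l τ → First w
nonempty-first {w = w} (at p) with empty-or-first w
... | inj₁ e = ⊥-elim (e p)
... | inj₂ k = k

first-pow : ∀ {f : Word d} → First h → ∀ {n} → 0 ℕ.< n → First (pow h n ++ f)
first-pow (first k _) (s≤s _) = nonempty-first (cut-++ˡ (cut-++ˡ k))

module _ (em : ExcludedMiddle (lsuc 0ℓ)) where

  decide : (P : Set) → Dec P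
  decide P = map′ lower lift (em {Lift (lsuc 0ℓ) P})

  module _ {d : ℕ} (r N : ℕ) (t<N : threshold (suc r) ℕ.< N) where
    private
      Q : ℕ
      Q = suc r

    -- Past the threshold one more copy changes nothing, so a copy of `h` behind `P ++ pow h N` has
    -- the same left context as all later ones. This is the sense in which it is late.
    generic : ∀ P (h : Word d) → (P ++ pow h N) ++ h ≈[ Q ] P ++ pow h N
    generic P h = begin
      (P ++ pow h N) ++ h         ≡⟨ ++-assoc P (pow h N) h ⟩
      P ++ pow h N ++ h           ≡⟨ cong (λ x → P ++ pow h N ++ x) (++-identityʳ h) ⟨
      P ++ pow h N ++ pow h 1     ≡⟨ cong (P ++_) (pow-+ N 1 h) ⟨
      P ++ pow h (N + 1)          ≈⟨ ++-congˡ P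
        (pow-≈ h (N + 1) N (inj₂ (ℕ.≤-trans (ℕ.<⇒≤ t<N) (ℕ.m≤m+n N 1) , ℕ.<⇒≤ t<N))) ⟩
      P ++ pow h N                ∎
      where open ≈-Reasoning (≈-setoid d Q)

    -- This claim for `D` follows from `Shrinks D` and implies `Shrinks (suc D)`, since repeating
    -- the body adds one level. The hypothesis `P ++ h ≈[ Q ] P` says that the copies are late.
    ShrinksBody : ℕ → Set
    ShrinksBody D = ∀ {P E h : Word d} {K} → Bounded (suc D) h → P ++ h ≈[ Q ] P →
      Covers Q P ([ h ^ω ] ++ E) h K → length K ℕ.≤ suc D →
      ∃[ h′ ] Bounded D h′ × [ h ^ω ] ≈[ Q ] [ h′ ^ω ] × CtxEq Q P ([ h ^ω ] ++ E) h h′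

    -- Two equivalences are carried along. The one without context survives repetition of an
    -- enclosing body; the one in context keeps the Q-characters and so the type of the whole word
    -- for `suc Q` rounds.
    Shrinks : ℕ → Set
    Shrinks D = ∀ {P E h : Word d} {K} → Bounded D h → P ++ h ≈[ Q ] P →
      Covers Q P ([ h ^ω ] ++ E) h K → length K ℕ.≤ D →
      ∃[ f ] Bounded D f × [ h ^ω ] ≈[ Q ] f × CtxEq Q P E [ h ^ω ] f

    record Shrunk (D : ℕ) (P E h : Word d) : Set where
      field
        {body}  : Word d
        bounded : Bounded D body
        equal   : [ h ^ω ] ≈[ Q ] body
        ctx     : CtxEq Q P E [ h ^ω ] body

    record Collapsed (D : ℕ) (P E h : Word d) : Set where
      field
        {f g}    : Word d
        bounded  : Bounded D f
        cut      : ∀ {r} → f ++ g ≈[ r ] h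
        limit    : P ++ pow h N ++ f ≈[ Q ] P ++ [ h ^ω ]
        return   : g ++ [ h ^ω ] ++ E ≈[ Q ] E

    -- The character (c₀, P h ω, R₀) of the limit point after h ω either occurs
    -- in a late copy of h, or the copies of h have fewer characters than K.
    limit-step : ∀ {D P E h K c₀ R₀} → Shrinks D → Bounded D h →
      Covers Q (P ++ pow h N) ([ h ^ω ] ++ E) h K → length K ℕ.≤ suc D →
      letter c₀ ∷ R₀ ≈[ Q ] E → (c₀ , P ++ [ h ^ω ] , R₀) ∈ᶜ[ Q ] K →
      Shrunk D P E h ⊎ Collapsed D P E h
    limit-step {D} {P} {E} {h} {K} {c₀} {R₀} shrinks b cov K≤ E≈ x∈K
      with decide (HasChar Q (P ++ pow h N) ([ h ^ω ] ++ E) h c₀ (P ++ [ h ^ω ]) R₀)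
    ... | yes (f , g₀ , k , e₁ , e₂) = inj₂ record
      { bounded = bounded-cut D k b
      ; cut     = cut-join k
      ; limit   = ~-trans (~-reflexive (sym (++-assoc P (pow h N) f))) e₁
      ; return  = ~-trans (++-congˡ [ letter c₀ ] e₂) E≈ }
    ... | no ¬char with delete x∈K
    ...   | K′ , K≡ , K′-covers with shrinks b (generic P h)
      (λ k → K′-covers (cov k) λ { (refl , e₁ , e₂) → ¬char (_ , _ , k , e₁ , e₂) })
        (ℕ.≤-pred (subst (ℕ._≤ suc D) K≡ K≤))
    -- The first `N` copies are left as they are: only the late copies are known to miss the deleted
    -- character.
    ...     | f , f-bounded , hω≈f , x = inj₁ record
      { bounded = bounded-++ D (pow h N) (bounded-pow D h b N) f-bounded
      ; equal   = ~-trans (~-sym (pow-ω N h)) (++-congˡ (pow h N) hω≈f)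
      ; ctx     = ctx-trans (≈⇒ctx (~-sym (pow-ω N h))) wrapped }
      where
      wrapped : CtxEq Q P E (pow h N ++ [ h ^ω ]) (pow h N ++ f)
      wrapped = subst (λ z → CtxEq Q P E (pow h N ++ [ h ^ω ]) (pow h N ++ z)) (++-identityʳ f)
        (ctx-wrap (pow h N) [] x)

    module _ (P E u h v : Word d) (K : List (Char d)) where
      private
        H : Word d
        H = u ++ [ h ^ω ] ++ v

      covers-copies : Covers Q P ([ H ^ω ] ++ E) H K →
                      Covers Q ((P ++ u) ++ pow h N) ([ h ^ω ] ++ v ++ [ H ^ω ] ++ E) h K
      covers-copies cov {c} {l} {τ} k = ∈ᶜ-≈
        (refl , ~-reflexive (assocˡ (pow h N)) , ~-reflexive (assocʳ [ h ^ω ] ([ H ^ω ] ++ E)))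
        (cov (cut-++ʳ u (cut-++ˡ {v = v} (cut-ω N k))))
        where
        assocˡ : ∀ x → ((P ++ u) ++ x) ++ l ≡ P ++ u ++ x ++ l
        assocˡ x = solve (++-monoid (Factor d))
        assocʳ : ∀ W X → τ ++ W ++ v ++ X ≡ ((τ ++ W) ++ v) ++ X
        assocʳ W X = solve (++-monoid (Factor d))

      -- The limit point after `hω` lies in `v`, or else `v` is empty and the point begins a copy of
      -- `H`. In the second case `P ++ H ≈[ Q ] P` turns it into a point of `H` behind `P`, which
      -- `K` covers.
      covers-limit : P ++ H ≈[ Q ] P → Covers Q P ([ H ^ω ] ++ E) H K →
                     ∀ {c l τ} → Cut (v ++ [ H ^ω ]) c l τ → Empty l →
                     (c , (P ++ u) ++ [ h ^ω ] , τ ++ E) ∈ᶜ[ Q ] K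
      covers-limit PH≈P cov k l-empty with cut-++⁻ v k
      ... | inˡ {l = l} {τ} k′ = ∈ᶜ-≈
        (refl , e [ h ^ω ] , ~-reflexive (++-assoc τ [ H ^ω ] E))
        (cov (cut-++ʳ u (cut-++ʳ [ h ^ω ] k′)))
        where
        open ≈-Reasoning (≈-setoid d Q)
        e : ∀ W → (P ++ u) ++ W ≈[ Q ] P ++ u ++ W ++ l
        e W = begin
          (P ++ u) ++ W       ≡⟨ solve (++-monoid (Factor d)) ⟩
          (P ++ u ++ W) ++ [] ≈⟨ ++-congˡ (P ++ u ++ W) (empty-≈ l-empty) ⟨
          (P ++ u ++ W) ++ l  ≡⟨ solve (++-monoid (Factor d)) ⟩
          P ++ u ++ W ++ l    ∎
      ... | inʳ k′ with cut-ω⁻ k′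
      ...   | inω {l = l} {τ} n k″ = ∈ᶜ-≈
        (refl , e [ h ^ω ] PH≈P , ~-reflexive (++-assoc τ [ H ^ω ] E)) (cov k″)
        where
        open ≈-Reasoning (≈-setoid d Q)
        e : ∀ W → P ++ u ++ W ++ v ≈[ Q ] P → (P ++ u) ++ W ≈[ Q ] P ++ l
        e W PH≈P = begin
          (P ++ u) ++ W       ≡⟨ solve (++-monoid (Factor d)) ⟩
          (P ++ u ++ W) ++ [] ≈⟨ ++-congˡ (P ++ u ++ W) (empty-≈ (empty-++ˡ l-empty)) ⟨
          (P ++ u ++ W) ++ v  ≡⟨ solve (++-monoid (Factor d)) ⟩
          P ++ u ++ W ++ v    ≈⟨ PH≈P ⟩
          P                   ≡⟨ ++-identityʳ P ⟨
          P ++ []             ≈⟨ ++-congˡ P (empty-≈ (empty-++ʳ (pow H n) (empty-++ʳ v l-empty))) ⟨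
          P ++ l              ∎

      record Factored (D : ℕ) : Set where
        field
          {body}  : Word d
          bounded : Bounded D body
          ctx     : CtxEq Q P ([ H ^ω ] ++ E) H (u ++ body ++ v)
          equal   : [ H ^ω ] ≈[ Q ] [ (u ++ body ++ v) ^ω ]

      factored : ∀ {D} → First h → Bounded D h →
                 Shrunk D (P ++ u) (v ++ [ H ^ω ] ++ E) h ⊎
                   Collapsed D (P ++ u) (v ++ [ H ^ω ] ++ E) h →
                 Factored D
      factored fst b (inj₁ s) = record
        { bounded = Shrunk.bounded s
        ; ctx     = ctx-wrap u v (Shrunk.ctx s)
        ; equal   = ω-cong (++-congˡ u (++-congʳ v (Shrunk.equal s))) }
      factored {D} fst b (inj₂ s) = record
        { bounded = bounded-++ D (pow h N) (bounded-pow D h b N) bounded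
        ; ctx     = ctx-wrap u v (collapse-ω cut N t<N limit return)
        ; equal   = collapse-in-ω cut u v E N t<N (first-pow fst (ℕ.≤-<-trans z≤n t<N)) limit
            (subst (λ z → g ++ [ h ^ω ] ++ z ≈[ Q ] z) (sym (++-assoc v [ H ^ω ] E)) return) }
        where open Collapsed s

      limit-start : ∀ {c l τ} → Cut (v ++ [ H ^ω ]) c l τ → Empty l →
                    letter c ∷ τ ++ E ≈[ Q ] v ++ [ H ^ω ] ++ E
      limit-start {c} {l} {τ} k l-empty = begin
        letter c ∷ τ ++ E           ≈⟨ ++-congʳ (letter c ∷ τ ++ E) (empty-≈ l-empty) ⟨
        l ++ letter c ∷ τ ++ E      ≡⟨ ++-assoc l (letter c ∷ τ) E ⟨
        (l ++ letter c ∷ τ) ++ E    ≈⟨ ++-congʳ E (cut-join k) ⟩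
        (v ++ [ H ^ω ]) ++ E        ≡⟨ ++-assoc v [ H ^ω ] E ⟩
        v ++ [ H ^ω ] ++ E          ∎
        where open ≈-Reasoning (≈-setoid d Q)

      shrink-factor : ∀ {D} → Shrinks D → Bounded D h → P ++ H ≈[ Q ] P →
                      Covers Q P ([ H ^ω ] ++ E) H K → length K ℕ.≤ suc D → Factored D
      shrink-factor {D} shrinks b PH≈P cov K≤ with empty-or-first h
      ... | inj₁ h-empty = record { body = [] ; bounded = tt ; ctx = ≈⇒ctx H≈ ; equal = ω-cong H≈ }
        where
        H≈ : ∀ {r} → H ≈[ r ] u ++ v
        H≈ = ++-congˡ u (++-congʳ v (empty-ω h-empty))
      -- As `h` has a point, so does the next copy of `H`; inside the body of an ω-power the limit
      -- point after `hω` therefore always exists.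
      ... | inj₂ fst@(first k₁ _) = conclude
        (nonempty-first (cut-++ʳ v (cut-ω 0 (cut-++ʳ u (cut-++ˡ {v = v} (cut-ω 0 k₁))))))
        where
        conclude : First (v ++ [ H ^ω ]) → Factored D
        conclude (first {c₀} {l₀} {τ₀} k l₀-empty) = factored fst b
          (limit-step {P = P ++ u} {E = v ++ [ H ^ω ] ++ E} {h = h} {K = K} {c₀ = c₀} {R₀ = τ₀ ++ E}
            shrinks b (covers-copies cov) K≤ (limit-start k l₀-empty)
              (covers-limit PH≈P cov k l₀-empty))

    -- The ω-powers of the body are treated one at a time from the left. Each replacement changes
    -- the body and the ω-power behind it, so absorption and covering are carried over to the new
    -- body, with the same `K`.
    shrink-body : ∀ {D} → Shrinks D → ShrinksBody D
    shrink-body {D} shrinks {h = H} b = loop [] H tt b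
      where
      loop : ∀ {P E K} u v → Bounded D u → Bounded (suc D) v → P ++ u ++ v ≈[ Q ] P →
        Covers Q P ([ (u ++ v) ^ω ] ++ E) (u ++ v) K → length K ℕ.≤ suc D →
        ∃[ H′ ] Bounded D H′ × [ (u ++ v) ^ω ] ≈[ Q ] [ H′ ^ω ] ×
          CtxEq Q P ([ (u ++ v) ^ω ] ++ E) (u ++ v) H′
      loop u [] bu bv _ _ _ = u ++ [] , bounded-++ D u bu tt , ~-refl , ctx-refl
      loop u (letter c ∷ v) bu bv PH≈P cov K≤ rewrite sym (++-assoc u [ letter c ] v) =
        loop (u ++ [ letter c ]) v (bounded-++ D u bu tt) bv PH≈P cov K≤
      loop {P} {E} {K} u (h ^ω ∷ v) bu (bh , bv) PH≈P cov K≤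
        with shrink-factor P E u h v K shrinks bh PH≈P cov K≤
      ... | record { body = f ; bounded = bf ; ctx = x ; equal = Hω≈ }
        with loop {P} {E} {K} (u ++ f) v (bounded-++ D u bu bf) bv
               (subst (λ z → P ++ z ≈[ Q ] P) (sym (++-assoc u f v))
                 (~-trans (~-sym (leftEq x)) PH≈P))
               (subst (λ z → Covers Q P ([ z ^ω ] ++ E) z K) (sym (++-assoc u f v))
                 (covers-≈ ~-refl (++-congʳ E Hω≈) (covers-ctx x cov))) K≤
      ... | H′ , bH′ , Hω≈′ , x′ = H′ , bH′
        , ~-trans Hω≈ (subst (λ z → [ z ^ω ] ≈[ Q ] [ H′ ^ω ]) (++-assoc u f v) Hω≈′)
        , ctx-trans x (ctx-≈ ~-refl (++-congʳ E (~-sym Hω≈))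
            (subst (λ z → CtxEq Q P ([ z ^ω ] ++ E) z H′) (++-assoc u f v) x′))

    -- Without characters `h` has no points and `hω` vanishes; each further character pays for one
    -- level of nesting.
    shrink : ∀ D → Shrinks D
    shrink zero {K = []} b _ cov _ = [] , tt , hω≈[] , ≈⇒ctx hω≈[]
      where
      hω≈[] : ∀ {r} → _ ≈[ r ] []
      hω≈[] = empty-ω λ p → absurd (cov (at p))
        where
        absurd : ∀ {x : Char d} → ¬ x ∈ᶜ[ Q ] []
        absurd ()
    shrink (suc D) b Ph≈P cov K≤ with shrink-body (shrink D) b Ph≈P cov K≤
    ... | h′ , b′ , hω≈ , x = [ h′ ^ω ] , (b′ , tt) , hω≈ , ctx-ω-body Ph≈P hω≈ x

-- Saving depth at the top level

module _ (em : ExcludedMiddle (lsuc 0ℓ)) {d : ℕ} (r N : ℕ) (t<N : threshold (suc r) ℕ.< N)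
         (Big : Word d → Set) (big-≈ : ∀ {u v} → u ≈[ suc r ] v → Big u → Big v)
         (big-pow : ∀ u {h} l → First h → Big (u ++ pow h N ++ l)) where
  private
    Q : ℕ
    Q = suc r

  -- Only points with a large left part are counted. `Big` is invariant under `≈[ Q ]` and holds
  -- behind `N` copies of a nonempty word, so all points of late copies and all limit points after
  -- nonempty ω-powers are among them.
  BigCovers : Word d → List (Char d) → Set
  BigCovers w K = ∀ {c l τ} → Cut w c l τ → Big l → (c , l , τ) ∈ᶜ[ Q ] K

  bigCovers-≈ : ∀ {w w′ K} → w ≈[ suc Q ] w′ → BigCovers w K → BigCovers w′ K
  bigCovers-≈ e cov k big with ≈-cut (~-sym e) k
  ... | l , τ , k′ , el , eτ = ∈ᶜ-≈ (refl , ~-sym el , ~-sym eτ) (cov k′ (big-≈ (~-sym el) big))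

  bigCovers-copies : ∀ u h v {K} → First h → BigCovers (u ++ [ h ^ω ] ++ v) K →
                     Covers Q (u ++ pow h N) ([ h ^ω ] ++ v) h K
  bigCovers-copies u h v fst cov {l = l} {τ} k = ∈ᶜ-≈
    (refl , ~-reflexive (++-assoc u (pow h N) l) , ~-reflexive (sym (++-assoc τ [ h ^ω ] v)))
    (cov (cut-++ʳ u (cut-++ˡ {v = v} (cut-ω N k))) (big-pow u l fst))

  drop-empty : ∀ u {h : Word d} v → Empty h → ∀ {r} → u ++ [ h ^ω ] ++ v ≈[ r ] u ++ v
  drop-empty u v e = ++-congˡ u (++-congʳ v (empty-ω e))

  -- Points of late copies are big, so at most `D` characters occur there and `shrink` applies to
  -- `h ^ω` behind `N` copies of `h`. Those copies are within depth `D` already.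
  reduce-depth : ∀ {D K w} → Bounded (suc D) w → BigCovers w K → length K ℕ.≤ D →
                 ∃[ w′ ] Bounded D w′ × w ≈[ suc Q ] w′
  reduce-depth {D} {K} {w} b cov K≤ = loop [] w tt b cov
    where
    Reduced : Word d → Set
    Reduced w = ∃[ w′ ] Bounded D w′ × w ≈[ suc Q ] w′
    loop : ∀ u v → Bounded D u → Bounded (suc D) v → BigCovers (u ++ v) K → Reduced (u ++ v)
    step : ∀ u h v → Bounded D u → Bounded D h → Bounded (suc D) v →
      BigCovers (u ++ [ h ^ω ] ++ v) K →
           Empty h ⊎ First h → Reduced (u ++ [ h ^ω ] ++ v)
    continue : ∀ {w} u f v → Bounded D u → Bounded D f → Bounded (suc D) v → BigCovers w K →
           w ≈[ suc Q ] u ++ f ++ v → Reduced w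
    continue u f v bu bf bv cov e with loop (u ++ f) v (bounded-++ D u bu bf) bv
      (bigCovers-≈ (~-trans e (~-reflexive (sym (++-assoc u f v)))) cov)
    ... | w′ , b , e′ = w′ , b , ~-trans e (~-trans (~-reflexive (sym (++-assoc u f v))) e′)
    loop u [] bu bv cov = u ++ [] , bounded-++ D u bu tt , ~-refl
    loop u (letter c ∷ v) bu bv cov = continue u [ letter c ] v bu tt bv cov ~-refl
    loop u (h ^ω ∷ v) bu (bh , bv) cov = step u h v bu bh bv cov (empty-or-first h)
    step u h v bu bh bv cov (inj₁ e) = continue u [] v bu tt bv cov (drop-empty u v e)
    step u h v bu bh bv cov (inj₂ fst)
      with shrink em r N t<N D bh (generic em r N t<N u h) (bigCovers-copies u h v fst cov) K≤
    ... | f , bf , _ , x = continue u (pow h N ++ f) v bu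
      (bounded-++ D (pow h N) (bounded-pow D h bh N) bf) bv cov
      (~-trans (unfold (pow h N) [ h ^ω ] (pow-ω N h))
      (~-trans (ctx⇒≈ x) (~-reflexive (assoc (pow h N)))))
      where
      assoc : ∀ x → (u ++ x) ++ f ++ v ≡ u ++ (x ++ f) ++ v
      assoc x = solve (++-monoid (Factor d))
      unfold : ∀ x W → x ++ W ≈[ suc Q ] W → u ++ W ++ v ≈[ suc Q ] (u ++ x) ++ W ++ v
      unfold x W e = begin
        u ++ W ++ v        ≈⟨ ++-congˡ u (++-congʳ v e) ⟨
        u ++ (x ++ W) ++ v ≡⟨ solve (++-monoid (Factor d)) ⟩
        (u ++ x) ++ W ++ v ∎
        where open ≈-Reasoning (≈-setoid d (suc Q))

  reduce-to : ∀ {K} m → length K ℕ.≤ m → ∀ D {w} → Bounded D w → BigCovers w K →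
              ∃[ w′ ] Bounded m w′ × w ≈[ suc Q ] w′
  reduce-to {K} m K≤m D {w} b cov with ℕ.≤-total D m
  ... | inj₁ D≤m = w , bounded-≤ w D≤m b , ~-refl
  ... | inj₂ m≤D = descend D m≤D b cov
    where
    descend : ∀ D {w} → m ℕ.≤ D → Bounded D w → BigCovers w K → ∃[ w′ ] Bounded m w′ ×
      w ≈[ suc Q ] w′
    descend D {w} m≤D b cov with ℕ.m≤n⇒m<n∨m≡n m≤D
    ... | inj₂ refl = w , b , ~-refl
    ... | inj₁ (s≤s {n = D′} m≤D′) with reduce-depth {w = w} b cov (ℕ.≤-trans K≤m m≤D′)
    ...   | w′ , b′ , e with descend D′ {w′} m≤D′ b′ (bigCovers-≈ e cov)
    ...     | w″ , b″ , e′ = w″ , b″ , ~-trans e e′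

  -- With one character more than `shrink` allows, the limit point has to help: `limit-step` lowers
  -- every nonempty ω-power that has a point after it. Only an ω-power at the very end has no limit
  -- point and may keep depth `suc D`.
  last-ω : ∀ {D K w} → Bounded (suc D) w → BigCovers w K → length K ℕ.≤ suc D →
           ∃₂ λ u h → Bounded D u × Bounded D h × w ≈[ suc Q ] u ++ [ h ^ω ]
  last-ω {D} {K} {w} b cov K≤ = loop [] w tt b cov
    where
    Result : Word d → Set
    Result w = ∃₂ λ u h → Bounded D u × Bounded D h × w ≈[ suc Q ] u ++ [ h ^ω ]
    loop : ∀ u v → Bounded D u → Bounded (suc D) v → BigCovers (u ++ v) K → Result (u ++ v)
    step : ∀ u h v → Bounded D u → Bounded D h → Bounded (suc D) v →
      BigCovers (u ++ [ h ^ω ] ++ v) K →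
           Empty h ⊎ First h → Empty v ⊎ First v → Result (u ++ [ h ^ω ] ++ v)
    continue : ∀ {w} u f v → Bounded D u → Bounded D f → Bounded (suc D) v → BigCovers w K →
           w ≈[ suc Q ] u ++ f ++ v → Result w
    continue u f v bu bf bv cov e with loop (u ++ f) v (bounded-++ D u bu bf) bv
      (bigCovers-≈ (~-trans e (~-reflexive (sym (++-assoc u f v)))) cov)
    ... | w′ , h , b , b′ , e′ = w′ , h , b , b′ ,
      ~-trans e (~-trans (~-reflexive (sym (++-assoc u f v))) e′)
    -- If no ω-power is left at the end, an empty one is appended to give the result its uniform
    -- shape.
    loop u [] bu bv cov = u , [] , bu , tt , ++-congˡ u (~-sym (empty-ω λ ()))
    loop u (letter c ∷ v) bu bv cov = continue u [ letter c ] v bu tt bv cov ~-refl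
    loop u (h ^ω ∷ v) bu (bh , bv) cov = step u h v bu bh bv cov (empty-or-first h)
      (empty-or-first v)
    step u h v bu bh bv cov (inj₁ e) _ = continue u [] v bu tt bv cov (drop-empty u v e)
    step u h v bu bh bv cov (inj₂ _) (inj₁ e) = u , h , bu , bh ,
      ~-trans (++-congˡ u (++-congˡ [ h ^ω ] (empty-≈ e)))
        (~-reflexive (cong (u ++_) (++-identityʳ [ h ^ω ])))
    step u h v bu bh bv cov (inj₂ fst) (inj₂ (first {c₀} {l₀} {τ₀} k l₀-empty))
      with limit-step em r N t<N {D} {u} {v} {h} {K} {c₀} {τ₀} (shrink em r N t<N D) bh
             (bigCovers-copies u h v fst cov) K≤
             (~-trans (++-congʳ (letter c₀ ∷ τ₀) (~-sym (empty-≈ l₀-empty))) (cut-join k))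
             (∈ᶜ-≈ (refl , limit≈ [ h ^ω ] , ~-refl)
               (cov (cut-++ʳ u (cut-++ʳ [ h ^ω ] k))
                 -- The limit point is big because `N` copies of `h` can be unfolded before it.
                 (big-≈ (big-unfold (pow h N) [ h ^ω ] (pow-ω N h))
                   (big-pow u ([ h ^ω ] ++ l₀) fst))))
      where
      limit≈ : ∀ W → u ++ W ≈[ Q ] u ++ W ++ l₀
      limit≈ W = ++-congˡ u (~-trans (~-reflexive (sym (++-identityʳ W)))
        (++-congˡ W (~-sym (empty-≈ l₀-empty))))
      big-unfold : ∀ x W → x ++ W ≈[ Q ] W → u ++ x ++ W ++ l₀ ≈[ Q ] u ++ W ++ l₀
      big-unfold x W e = ++-congˡ u (~-trans (~-reflexive (sym (++-assoc x W l₀))) (++-congʳ l₀ e))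
    ... | inj₁ s = continue u body v bu bounded bv cov (ctx⇒≈ ctx)
      where open Shrunk s
    ... | inj₂ s = continue u (pow h N ++ f) v bu
      (bounded-++ D (pow h N) (bounded-pow D h bh N) bounded) bv cov
      (ctx⇒≈ (collapse-ω cut N t<N limit return))
      where open Collapsed s

-- Types and their defining formulas

-- A type for `suc r` rounds is coded as a set of r-characters, hence the power of 2. These are
-- numbers of codes; not every code need be realised.
typeCount charCount : ℕ → ℕ → ℕ
typeCount d zero    = 1
typeCount d (suc r) = 2 ^ charCount d r
charCount d r = d ℕ.* (typeCount d r ℕ.* typeCount d r)

funToFin-cong : ∀ {m n} {f g : Fin m → Fin n} → (∀ i → f i ≡ g i) → funToFin f ≡ funToFin g
funToFin-cong {zero}  e = refl
funToFin-cong {suc m} e = cong₂ combine (e zero) (funToFin-cong (e ∘ suc))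

bit : {P : Set} → Dec P → Fin 2
bit (yes _) = suc zero
bit (no _)  = zero

bit-cong : {P P′ : Set} (x : Dec P) (y : Dec P′) → (P → P′) → (P′ → P) → bit x ≡ bit y
bit-cong (yes p) (yes p′) f g = refl
bit-cong (yes p) (no ¬p′) f g = ⊥-elim (¬p′ (f p))
bit-cong (no ¬p) (yes p′) f g = ⊥-elim (¬p (g p′))
bit-cong (no ¬p) (no ¬p′) f g = refl

bit-yes : {P : Set} (x : Dec P) → bit x ≡ suc zero → P
bit-yes (yes p) _ = p

yes-bit : {P : Set} (x : Dec P) → P → bit x ≡ suc zero
yes-bit (yes _) _ = refl
yes-bit (no ¬p) p = ⊥-elim (¬p p)

no-bit : {P : Set} (x : Dec P) → ¬ P → bit x ≡ zero
no-bit (yes p) ¬p = ⊥-elim (¬p p)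
no-bit (no _)  _  = refl

-- `nothing` is -∞ as a lower and +∞ as an upper bound.
After Before : (A : ColoredOrdinal d) → Maybe (Carrier A) → Carrier A → Set
After  A nothing  a = ⊤
After  A (just x) a = ColoredOrdinal._<_ A x a
Before A nothing  a = ⊤
Before A (just y) a = ColoredOrdinal._<_ A a y

Between : (A : ColoredOrdinal d) → Maybe (Carrier A) → Maybe (Carrier A) → Carrier A → Set
Between A lo hi a = After A lo a × Before A hi a

after-trans : ∀ (A : ColoredOrdinal d) lo {a b} → After A lo a → ColoredOrdinal._<_ A a b →
  After A lo b
after-trans A nothing  _   _   = tt
after-trans A (just x) x<a a<b = ColoredOrdinal.trans A x<a a<b

before-trans : ∀ (A : ColoredOrdinal d) hi {a b} → Before A hi b → ColoredOrdinal._<_ A a b →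
  Before A hi a
before-trans A nothing  _   _   = tt
before-trans A (just y) b<y a<b = ColoredOrdinal.trans A a<b b<y

between-left : ∀ (A : ColoredOrdinal d) lo hi {a} → Between A lo hi a →
  sub A (λ b → Between A lo hi b × ColoredOrdinal._<_ A b a) ~[ r ] sub A (Between A lo (just a))
between-left A lo hi (_ , a<hi) = sub-cong (λ ((lo<b , _) , b<a) → lo<b , b<a)
  (λ (lo<b , b<a) → (lo<b , before-trans A hi a<hi b<a) , b<a)

between-right : ∀ (A : ColoredOrdinal d) lo hi {a} → Between A lo hi a →
  sub A (λ b → Between A lo hi b × ColoredOrdinal._<_ A a b) ~[ r ] sub A (Between A (just a) hi)
between-right A lo hi (lo<a , _) = sub-cong (λ ((_ , b<hi) , a<b) → a<b , b<hi)
  (λ (a<b , b<hi) → (after-trans A lo lo<a a<b , b<hi) , a<b)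

whole : ColoredOrdinal d → State d
whole A = sub A (λ _ → ⊤)

bound : {X : Set} → Vec X n → Maybe (Fin n) → Maybe X
bound v = Maybe.map (lookup v)

bound-suc : {X : Set} (x : X) (v : Vec X n) (i : Maybe (Fin n)) →
  bound (x ∷ᵛ v) (Maybe.map suc i) ≡ bound v i
bound-suc x v nothing  = refl
bound-suc x v (just i) = refl

⊤′ : Formula d n
⊤′ = ¬′ ⊥′

⋀ : ∀ m → (Fin m → Formula d n) → Formula d n
⋀ zero    φ = ⊤′
⋀ (suc m) φ = φ zero ∧′ ⋀ m (φ ∘ suc)

after before : Maybe (Fin n) → Fin n → Formula d n
after  nothing  x = ⊤′
after  (just i) x = i <′ x
before nothing  x = ⊤′
before (just j) x = x <′ j

signed : Fin 2 → Formula d n → Formula d n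
signed zero    φ = ¬′ φ
signed (suc _) φ = φ

-- The Hintikka formula of a type, relativised to the interval from `lo` to `hi`: it states of each
-- character whether it occurs there. A quantified point only becomes an end of a smaller interval,
-- so the rank does not exceed the number of rounds.
typeFormula : ∀ r → Fin (typeCount d r) → Maybe (Fin n) → Maybe (Fin n) → Formula d n
charFormula : ∀ r → Fin (charCount d r) → Maybe (Fin n) → Maybe (Fin n) → Formula d n
typeFormula zero    t lo hi = ⊤′
typeFormula {d} (suc r) t lo hi = ⋀ (charCount d r)
  (λ ξ → signed (finToFun t ξ) (charFormula r ξ lo hi))
charFormula {d} r ξ lo hi =
  let c , ij = remQuot {d} (typeCount d r ℕ.* typeCount d r) ξ
      i , j  = remQuot {typeCount d r} (typeCount d r) ij
      lo′    = Maybe.map suc lo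
      hi′    = Maybe.map suc hi
  in ∃′ (after lo′ zero ∧′ before hi′ zero ∧′ C c zero
         ∧′ typeFormula r i lo′ (just zero) ∧′ typeFormula r j (just zero) hi′)

module _ {d : ℕ} where

  rank-after : ∀ (i : Maybe (Fin n)) x → quantifierRank {d} (after i x) ≡ 0
  rank-after nothing  x = refl
  rank-after (just i) x = refl

  rank-before : ∀ (i : Maybe (Fin n)) x → quantifierRank {d} (before i x) ≡ 0
  rank-before nothing  x = refl
  rank-before (just i) x = refl

  rank-⋀ : ∀ m (φ : Fin m → Formula d n) → (∀ i → quantifierRank (φ i) ℕ.≤ r) →
    quantifierRank (⋀ m φ) ℕ.≤ r
  rank-⋀ zero    φ h = z≤n
  rank-⋀ (suc m) φ h = ℕ.⊔-lub (h zero) (rank-⋀ m (φ ∘ suc) (h ∘ suc))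

  rank-signed : ∀ β (φ : Formula d n) → quantifierRank (signed β φ) ≡ quantifierRank φ
  rank-signed zero    φ = refl
  rank-signed (suc _) φ = refl

  rank-type : ∀ r t (lo hi : Maybe (Fin n)) → quantifierRank (typeFormula {d} r t lo hi) ℕ.≤ r
  rank-char : ∀ r ξ (lo hi : Maybe (Fin n)) → quantifierRank (charFormula {d} r ξ lo hi) ℕ.≤ suc r
  rank-type zero    t lo hi = z≤n
  rank-type (suc r) t lo hi = rank-⋀ (charCount d r) _ (λ ξ →
    ℕ.≤-trans (ℕ.≤-reflexive (rank-signed (finToFun t ξ) (charFormula r ξ lo hi)))
      (rank-char r ξ lo hi))
  rank-char r ξ lo hi = s≤s (ℕ.⊔-lub
    (ℕ.≤-trans (ℕ.≤-reflexive (rank-after (Maybe.map suc lo) zero)) z≤n)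
    (ℕ.⊔-lub (ℕ.≤-trans (ℕ.≤-reflexive (rank-before (Maybe.map suc hi) zero)) z≤n)
    (ℕ.⊔-lub z≤n (ℕ.⊔-lub (rank-type r _ (Maybe.map suc lo) (just zero))
      (rank-type r _ (just zero) (Maybe.map suc hi))))))

  module _ (A : ColoredOrdinal d) where

    holds-⋀ : ∀ m (φ : Fin m → Formula d n) {v} → (∀ i → ⟦ A ⟧ (φ i) v) → ⟦ A ⟧ (⋀ m φ) v
    holds-⋀ zero    φ h = λ ()
    holds-⋀ (suc m) φ h = h zero , holds-⋀ m (φ ∘ suc) (h ∘ suc)

    ⋀-holds : ∀ m (φ : Fin m → Formula d n) {v} → ⟦ A ⟧ (⋀ m φ) v → ∀ i → ⟦ A ⟧ (φ i) v
    ⋀-holds (suc m) φ (h , _) zero    = h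
    ⋀-holds (suc m) φ (_ , h) (suc i) = ⋀-holds m (φ ∘ suc) h i

    after-holds : ∀ (i : Maybe (Fin n)) x {v} → After A (bound v i) (lookup v x) →
      ⟦ A ⟧ (after i x) v
    after-holds nothing  x _ = λ ()
    after-holds (just i) x h = h

    holds-after : ∀ (i : Maybe (Fin n)) x {v} → ⟦ A ⟧ (after i x) v →
      After A (bound v i) (lookup v x)
    holds-after nothing  x _ = tt
    holds-after (just i) x h = h

    before-holds : ∀ (i : Maybe (Fin n)) x {v} → Before A (bound v i) (lookup v x) →
      ⟦ A ⟧ (before i x) v
    before-holds nothing  x _ = λ ()
    before-holds (just i) x h = h

    holds-before : ∀ (i : Maybe (Fin n)) x {v} → ⟦ A ⟧ (before i x) v →
      Before A (bound v i) (lookup v x)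
    holds-before nothing  x _ = tt
    holds-before (just i) x h = h

module Types (em : ExcludedMiddle (lsuc 0ℓ)) {d : ℕ} where

  -- Excluded middle turns a type into an element of a finite set; Ramsey's theorem and the counting
  -- of characters rest on this.
  code     : ∀ r → State d → Fin (typeCount d r)
  charCode : ∀ r (s : State d) → Position s → Fin (charCount d r)
  code zero    s = zero
  code (suc r) s = funToFin (λ ξ → bit (decide em (∃[ p ] charCode r s p ≡ ξ)))
  charCode r s p = combine (colourₛ s p) (combine (code r (leftₛ s p)) (code r (rightₛ s p)))

  code-bit : ∀ r s ξ → finToFun (code (suc r) s) ξ ≡ bit (decide em (∃[ p ] charCode r s p ≡ ξ))
  code-bit r s = Fin.finToFun-funToFin (λ ξ → bit (decide em (∃[ p ] charCode r s p ≡ ξ)))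

  code-≡⇒~ : ∀ r (s t : State d) → code r s ≡ code r t → s ~[ r ] t
  code-≡⇒~ zero    s t e = ~-zero
  code-≡⇒~ (suc r) s t e = ~-suc (half s t e) (λ p → let p′ , m = half t s (sym e) p in p′ , match-sym m)
    where
    half : ∀ s t → code (suc r) s ≡ code (suc r) t → ∀ p → ∃[ p′ ] Match s p r t p′
    half s t e p =
      let ξ = charCode r s p
          p′ , e′ = bit-yes (decide em (∃[ p ] charCode r t p ≡ ξ)) (trans (sym (code-bit r t ξ))
                     (trans (cong (λ x → finToFun x ξ) (sym e)) (trans (code-bit r s ξ)
                       (yes-bit (decide em (∃[ p ] charCode r s p ≡ ξ)) (p , refl)))))
          ce , lre = Fin.combine-injective _ _ _ _ (sym e′)
          le , re  = Fin.combine-injective _ _ _ _ lre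
      in p′ , match ce (code-≡⇒~ r _ _ le) (code-≡⇒~ r _ _ re)

  ~⇒code-≡ : ∀ r {s t : State d} → s ~[ r ] t → code r s ≡ code r t
  ~⇒code-≡ zero    e = refl
  ~⇒code-≡ (suc r) {s} {t} e = funToFin-cong {charCount d r}
    (λ ξ → bit-cong (decide em _) (decide em _) (half e) (half (~-sym e)))
    where
    half : ∀ {s t ξ} → s ~[ suc r ] t → ∃[ p ] charCode r s p ≡ ξ → ∃[ p ] charCode r t p ≡ ξ
    half e (p , refl) = let p′ , m = forth e refl p in
      p′ , cong₂ combine (sym (colour≡ m))
        (cong₂ combine (sym (~⇒code-≡ r (left~ m))) (sym (~⇒code-≡ r (right~ m))))

  module _ (A : ColoredOrdinal d) where

    interval : Vec (Carrier A) n → Maybe (Fin n) → Maybe (Fin n) → State d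
    interval v lo hi = sub A (Between A (bound v lo) (bound v hi))

    type-holds : ∀ r t lo hi (v : Vec (Carrier A) n) → code r (interval v lo hi) ≡ t →
                 ⟦ A ⟧ (typeFormula r t lo hi) v
    holds-type : ∀ r t lo hi (v : Vec (Carrier A) n) → ⟦ A ⟧ (typeFormula r t lo hi) v →
                 code r (interval v lo hi) ≡ t
    char-holds : ∀ r ξ lo hi (v : Vec (Carrier A) n) → ∃[ p ] charCode r (interval v lo hi) p ≡ ξ →
                 ⟦ A ⟧ (charFormula r ξ lo hi) v
    holds-char : ∀ r ξ lo hi (v : Vec (Carrier A) n) → ⟦ A ⟧ (charFormula r ξ lo hi) v →
                 ∃[ p ] charCode r (interval v lo hi) p ≡ ξ

    type-holds zero    t lo hi v e = λ ()
    type-holds (suc r) t lo hi v refl = holds-⋀ A (charCount d r) _ λ ξ →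
      go ξ (decide em (∃[ p ] charCode r (interval v lo hi) p ≡ ξ))
        (code-bit r (interval v lo hi) ξ)
      where
      go : ∀ ξ (x : Dec (∃[ p ] charCode r (interval v lo hi) p ≡ ξ)) →
           finToFun (code (suc r) (interval v lo hi)) ξ ≡ bit x →
           ⟦ A ⟧ (signed (finToFun (code (suc r) (interval v lo hi)) ξ) (charFormula r ξ lo hi)) v
      go ξ (yes p) e rewrite e = char-holds r ξ lo hi v p
      go ξ (no ¬p) e rewrite e = λ h → ¬p (holds-char r ξ lo hi v h)
    holds-type zero    zero lo hi v h = refl
    holds-type (suc r) t lo hi v h = trans
      (funToFin-cong (λ ξ → go ξ (finToFun t ξ) (⋀-holds A (charCount d r) _ h ξ)))
      (Fin.funToFin-finToFin {charCount d r} {2} t)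
      where
      go : ∀ ξ β → ⟦ A ⟧ (signed β (charFormula r ξ lo hi)) v →
           bit (decide em (∃[ p ] charCode r (interval v lo hi) p ≡ ξ)) ≡ β
      go ξ zero       h = no-bit (decide em _) (λ p → h (char-holds r ξ lo hi v p))
      go ξ (suc zero) h = yes-bit (decide em _) (holds-char r ξ lo hi v h)

    char-holds r ξ lo hi v ((a , lo<a , a<hi) , refl) = a
      , after-holds A (Maybe.map suc lo) zero (subst (λ x → After A x a) (sym lo≡) lo<a)
      , before-holds A (Maybe.map suc hi) zero (subst (λ x → Before A x a) (sym hi≡) a<hi)
      , sym (cong proj₁ q₁)
      , type-holds r _ (Maybe.map suc lo) (just zero) (a ∷ᵛ v)
          (trans (trans (cong (λ x → code r (sub A (Between A x (just a)))) lo≡)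
                 (~⇒code-≡ r (~-sym (between-left A (bound v lo) (bound v hi) (lo<a , a<hi)))))
                   (sym (cong proj₁ q₂)))
      , type-holds r _ (just zero) (Maybe.map suc hi) (a ∷ᵛ v)
          (trans (trans (cong (λ x → code r (sub A (Between A (just a) x))) hi≡)
                 (~⇒code-≡ r (~-sym (between-right A (bound v lo) (bound v hi) (lo<a , a<hi)))))
                   (sym (cong proj₂ q₂)))
      where
      T : ℕ
      T = typeCount d r
      lo≡ = bound-suc a v lo
      hi≡ = bound-suc a v hi
      i j : Fin T
      i = code r (leftₛ (interval v lo hi) (a , lo<a , a<hi))
      j = code r (rightₛ (interval v lo hi) (a , lo<a , a<hi))
      κ : Fin d
      κ = ColoredOrdinal.color A a
      q₁ : remQuot {d} (T ℕ.* T) (combine κ (combine i j)) ≡ (κ , combine i j)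
      q₁ = Fin.remQuot-combine κ (combine i j)
      q₂ : remQuot {T} T (proj₂ (remQuot {d} (T ℕ.* T) (combine κ (combine i j)))) ≡ (i , j)
      q₂ = trans (cong (remQuot {T} T ∘ proj₂) q₁) (Fin.remQuot-combine i j)
    holds-char r ξ lo hi v (a , hlo , hhi , hc , hl , hr) = (a , lo<a , a<hi) , e
      where
      T : ℕ
      T = typeCount d r
      lo≡ = bound-suc a v lo
      hi≡ = bound-suc a v hi
      lo<a : After A (bound v lo) a
      lo<a = subst (λ x → After A x a) lo≡ (holds-after A (Maybe.map suc lo) zero hlo)
      a<hi : Before A (bound v hi) a
      a<hi = subst (λ x → Before A x a) hi≡ (holds-before A (Maybe.map suc hi) zero hhi)
      cij = remQuot {d} (T ℕ.* T) ξ
      ij  = remQuot {T} T (proj₂ cij)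
      el : code r (leftₛ (interval v lo hi) (a , lo<a , a<hi)) ≡ proj₁ ij
      el = trans (~⇒code-≡ r (between-left A (bound v lo) (bound v hi) (lo<a , a<hi)))
           (trans (cong (λ x → code r (sub A (Between A x (just a)))) (sym lo≡))
             (holds-type r (proj₁ ij) (Maybe.map suc lo) (just zero) (a ∷ᵛ v) hl))
      er : code r (rightₛ (interval v lo hi) (a , lo<a , a<hi)) ≡ proj₂ ij
      er = trans (~⇒code-≡ r (between-right A (bound v lo) (bound v hi) (lo<a , a<hi)))
           (trans (cong (λ x → code r (sub A (Between A (just a) x))) (sym hi≡))
             (holds-type r (proj₂ ij) (just zero) (Maybe.map suc hi) (a ∷ᵛ v) hr))
      e : charCode r (interval v lo hi) (a , lo<a , a<hi) ≡ ξ
      e = trans (cong₂ combine hc (trans (cong₂ combine el er)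
        (Fin.combine-remQuot {T} T (proj₂ cij))))
                (Fin.combine-remQuot {d} (T ℕ.* T) ξ)

  -- One sentence suffices: the characteristic sentence of `A` holds in `B` and thereby determines
  -- the code of `B`.
  ≡⇒~ : ∀ {r} {A B : ColoredOrdinal d} → A ≡[ r ] B → whole A ~[ r ] whole B
  ≡⇒~ {r} {A} {B} e = ~-trans (sub-cong (λ _ → tt , tt) (λ _ → tt))
    (~-trans (code-≡⇒~ r _ _ (sym (holds-type B r
      (code r (interval A []ᵛ nothing nothing)) nothing nothing []ᵛ
      (Equivalence.to (e (typeFormula r _ nothing nothing) (rank-type r _ nothing nothing))
        (type-holds A r _ nothing nothing []ᵛ refl)))))
    (sub-cong (λ _ → tt) (λ _ → tt , tt)))

-- The Ehrenfeucht–Fraïssé theorem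

sub-≐ : {A : ColoredOrdinal d} {P P′ : Carrier A → Set} {B : ColoredOrdinal d} {S S′ : Carrier B →
  Set} →
        (∀ {a} → P a → P′ a) → (∀ {a} → P′ a → P a) → (∀ {b} → S b → S′ b) → (∀ {b} → S′ b → S b) →
        sub A P ~[ r ] sub B S → sub A P′ ~[ r ] sub B S′
sub-≐ f g f′ g′ e = ~-trans (sub-cong g f) (~-trans e (sub-cong f′ g′))

sub-empty : {A B : ColoredOrdinal d} {P : Carrier A → Set} {P′ : Carrier B → Set} →
            (∀ {a} → ¬ P a) → (∀ {b} → ¬ P′ b) → ∀ {r} → sub A P ~[ r ] sub B P′
sub-empty e e′ = ~-empty (λ (_ , p) → e p) (λ (_ , p) → e′ p)

module _ {d : ℕ} (A B : ColoredOrdinal d) where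
  private
    module A = ColoredOrdinal A
    module B = ColoredOrdinal B

  singleton : ∀ {a b} → A.color a ≡ B.color b → ∀ {r} → sub A (A._≈ a) ~[ r ] sub B (B._≈ b)
  singleton {a} {b} e = iso {R = λ x y → (x A.≈ a) × (y B.≈ b)} record
    { total      = λ x≈a → b , B.Eq.refl , x≈a , B.Eq.refl
    ; surjective = λ y≈b → a , A.Eq.refl , A.Eq.refl , y≈b
    ; preserves  = λ (x≈a , _) (x′≈a , _) x<x′ →
      ⊥-elim (A.irrefl (A.Eq.trans x≈a (A.Eq.sym x′≈a)) x<x′)
    ; reflects   = λ (_ , y≈b) (_ , y′≈b) y<y′ →
      ⊥-elim (B.irrefl (B.Eq.trans y≈b (B.Eq.sym y′≈b)) y<y′)
    ; colours    = λ (x≈a , y≈b) → trans (A.color-cong x≈a) (trans e (sym (B.color-cong y≈b)))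
    }

module _ (A : ColoredOrdinal d) where
  open ColoredOrdinal A renaming (trans to <-trans)

  before-≈ : ∀ hi {a b} → a ≈ b → Before A hi b → Before A hi a
  before-≈ nothing  a≈b _   = tt
  before-≈ (just z) a≈b b<z = <-respˡ-≈ (Eq.sym a≈b) b<z

  after-≈ : ∀ lo {a b} → a ≈ b → After A lo b → After A lo a
  after-≈ nothing  a≈b _   = tt
  after-≈ (just z) a≈b z<b = <-respʳ-≈ (Eq.sym a≈b) z<b

  from-point : ∀ {lo y hi} → After A lo y → Before A hi y →
    Partition A (Between A lo hi) (Between A lo (just y)) (λ a → (a ≈ y) ⊎ Between A (just y) hi a)
  from-point {lo} {y} {hi} lo<y y<hi = partition into
    (λ (lo<a , a<y) → lo<a , before-trans A hi y<hi a<y)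
    (λ { (inj₁ a≈y) → after-≈ lo a≈y lo<y , before-≈ hi a≈y y<hi
       ; (inj₂ (y<a , a<hi)) → after-trans A lo lo<y y<a , a<hi })
    (λ { (_ , a<y) (inj₁ b≈y) → <-respʳ-≈ (Eq.sym b≈y) a<y ; (_ , a<y) (inj₂ (y<b , _)) →
      <-trans a<y y<b })
    where
    into : ∀ {a} → Between A lo hi a → Between A lo (just y) a ⊎ ((a ≈ y) ⊎ Between A (just y) hi a)
    into {a} (lo<a , a<hi) with compare a y
    ... | tri< a<y _ _ = inj₁ (lo<a , a<y)
    ... | tri≈ _ a≈y _ = inj₂ (inj₁ a≈y)
    ... | tri> _ _ y<a = inj₂ (inj₂ (y<a , a<hi))

  point-first : ∀ {y hi} → Partition A (λ a → (a ≈ y) ⊎ Between A (just y) hi a) (_≈ y)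
    (Between A (just y) hi)
  point-first = partition id inj₁ inj₂ (λ a≈y (y<b , _) → <-respˡ-≈ (Eq.sym a≈y) y<b)

join-intervals : ∀ (A B : ColoredOrdinal d) {lo y hi lo′ y′ hi′} →
  After A lo y → Before A hi y → After B lo′ y′ → Before B hi′ y′ →
  ColoredOrdinal.color A y ≡ ColoredOrdinal.color B y′ →
  sub A (Between A lo (just y)) ~[ r ] sub B (Between B lo′ (just y′)) →
  sub A (Between A (just y) hi) ~[ r ] sub B (Between B (just y′) hi′) →
  sub A (Between A lo hi) ~[ r ] sub B (Between B lo′ hi′)
join-intervals A B {lo} {y} {hi} {lo′} {y′} {hi′} lo<y y<hi lo′<y′ y′<hi′ c≡ e e′ =
  glue (split-sub (from-point A {lo} {y} {hi} lo<y y<hi))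
    (split-sub (from-point B {lo′} {y′} {hi′} lo′<y′ y′<hi′)) e
    (glue (split-sub (point-first A {y} {hi})) (split-sub (point-first B {y′} {hi′}))
      (singleton A B c≡) e′)

-- A position of the game on A and B from which the duplicator survives r
-- more rounds.
record Agree {d n : ℕ} (r : ℕ) (A B : ColoredOrdinal d) (v : Vec (Carrier A) n)
  (v′ : Vec (Carrier B) n) : Set where
  private
    module A = ColoredOrdinal A
    module B = ColoredOrdinal B
  field
    intervals : ∀ i j → sub A (Between A (bound v i) (bound v j)) ~[ r ] sub B
      (Between B (bound v′ i) (bound v′ j))
    <⇒< : ∀ i j → lookup v i A.< lookup v j → lookup v′ i B.< lookup v′ j
    <⇐< : ∀ i j → lookup v′ i B.< lookup v′ j → lookup v i A.< lookup v j
    colors : ∀ i → A.color (lookup v i) ≡ B.color (lookup v′ i)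

open Agree

agree-sym : {A B : ColoredOrdinal d} {v : Vec (Carrier A) n} {v′ : Vec (Carrier B) n} →
            Agree r A B v v′ → Agree r B A v′ v
agree-sym g = record { intervals = λ i j → ~-sym (intervals g i j) ; <⇒< = <⇐< g ; <⇐< = <⇒< g
  ; colors = λ i → sym (colors g i) }

agree-≈ : {A B : ColoredOrdinal d} {v : Vec (Carrier A) n} {v′ : Vec (Carrier B) n} →
  Agree r A B v v′ →
          ∀ i j → ColoredOrdinal._≈_ A (lookup v i) (lookup v j) →
            ColoredOrdinal._≈_ B (lookup v′ i) (lookup v′ j)
agree-≈ {A = A} {B} {v} {v′} g i j e with ColoredOrdinal.compare B (lookup v′ i) (lookup v′ j)
... | tri< lt _ _ = ⊥-elim (ColoredOrdinal.irrefl A e (<⇐< g i j lt))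
... | tri≈ _ eq _ = eq
... | tri> _ _ gt = ⊥-elim (ColoredOrdinal.irrefl A (ColoredOrdinal.Eq.sym A e) (<⇐< g j i gt))

module Games (em : ExcludedMiddle (lsuc 0ℓ)) where

  maximal : {X : Set} (_≺_ : X → X → Set) → (∀ {x} → ¬ x ≺ x) →
    (∀ {x y z} → x ≺ y → y ≺ z → x ≺ z) →
            ∀ {n} (f : Fin n → X) (P : Fin n → Set) →
            (∀ i → ¬ P i) ⊎ ∃[ l ] P l × (∀ k → P k → ¬ f l ≺ f k)
  maximal _≺_ ≺-irrefl ≺-trans {zero}  f P = inj₁ λ ()
  maximal _≺_ ≺-irrefl ≺-trans {suc n} f P
    with maximal _≺_ ≺-irrefl ≺-trans (f ∘ suc) (P ∘ suc) | decide em (P zero)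
  ... | inj₁ none | no ¬P0 = inj₁ λ { zero → ¬P0 ; (suc i) → none i }
  ... | inj₁ none | yes P0 = inj₂
    (zero , P0 , λ { zero _ → ≺-irrefl ; (suc i) p → ⊥-elim (none i p) })
  ... | inj₂ (l , Pl , max) | no ¬P0 = inj₂
    (suc l , Pl , λ { zero P0 → ⊥-elim (¬P0 P0) ; (suc i) → max i })
  ... | inj₂ (l , Pl , max) | yes P0 with decide em (f (suc l) ≺ f zero)
  ...   | yes l≺0 = inj₂ (zero , P0 ,
    λ { zero _ → ≺-irrefl ; (suc i) p 0≺i → max i p (≺-trans l≺0 0≺i) })
  ...   | no l⊀0  = inj₂ (suc l , Pl , λ { zero _ → l⊀0 ; (suc i) → max i })

  module _ {d n r : ℕ} {A B : ColoredOrdinal d} {v : Vec (Carrier A) n} {v′ : Vec (Carrier B) n}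
           (g : Agree (suc r) A B v v′) where
    private
      module A = ColoredOrdinal A
      module B = ColoredOrdinal B

    repeat : ∀ i a → lookup v i A.≈ a → Agree r A B (a ∷ᵛ v) (lookup v′ i ∷ᵛ v′)
    repeat i a e = record
      { intervals = λ x y → sub-≐ (λ (p , q) → After⇒ x p , Before⇒ y q)
        (λ (p , q) → After⇐ x p , Before⇐ y q)
                                  (λ (p , q) → After⇒′ x p , Before⇒′ y q)
                                    (λ (p , q) → After⇐′ x p , Before⇐′ y q)
                                  (~-pred (intervals g (Maybe.map index x) (Maybe.map index y)))
      ; <⇒< = λ x y p → subst₂ B._<_ (index′ x) (index′ y)
          (<⇒< g (index x) (index y) (A.<-respʳ-≈ (A.Eq.sym (index≈ y))
            (A.<-respˡ-≈ (A.Eq.sym (index≈ x)) p)))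
      ; <⇐< = λ x y p → A.<-respʳ-≈ (index≈ y) (A.<-respˡ-≈ (index≈ x)
          (<⇐< g (index x) (index y) (subst₂ B._<_ (sym (index′ x)) (sym (index′ y)) p)))
      ; colors = λ x → trans (sym (A.color-cong (index≈ x)))
        (trans (colors g (index x)) (cong B.color (index′ x)))
      }
      where
      index : Fin (suc n) → Fin n
      index zero    = i
      index (suc k) = k
      index≈ : ∀ k → lookup v (index k) A.≈ lookup (a ∷ᵛ v) k
      index≈ zero    = e
      index≈ (suc k) = A.Eq.refl
      index′ : ∀ k → lookup v′ (index k) ≡ lookup (lookup v′ i ∷ᵛ v′) k
      index′ zero    = refl
      index′ (suc k) = refl
      After⇒ : ∀ x {b} → After A (bound v (Maybe.map index x)) b → After A (bound (a ∷ᵛ v) x) b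
      After⇒ nothing  p = tt
      After⇒ (just x) p = A.<-respˡ-≈ (index≈ x) p
      After⇐ : ∀ x {b} → After A (bound (a ∷ᵛ v) x) b → After A (bound v (Maybe.map index x)) b
      After⇐ nothing  p = tt
      After⇐ (just x) p = A.<-respˡ-≈ (A.Eq.sym (index≈ x)) p
      Before⇒ : ∀ x {b} → Before A (bound v (Maybe.map index x)) b → Before A (bound (a ∷ᵛ v) x) b
      Before⇒ nothing  p = tt
      Before⇒ (just x) p = A.<-respʳ-≈ (index≈ x) p
      Before⇐ : ∀ x {b} → Before A (bound (a ∷ᵛ v) x) b → Before A (bound v (Maybe.map index x)) b
      Before⇐ nothing  p = tt
      Before⇐ (just x) p = A.<-respʳ-≈ (A.Eq.sym (index≈ x)) p
      After⇒′ : ∀ x {b} → After B (bound v′ (Maybe.map index x)) b →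
        After B (bound (lookup v′ i ∷ᵛ v′) x) b
      After⇒′ nothing  p = tt
      After⇒′ (just x) p = subst (B._< _) (index′ x) p
      After⇐′ : ∀ x {b} → After B (bound (lookup v′ i ∷ᵛ v′) x) b →
        After B (bound v′ (Maybe.map index x)) b
      After⇐′ nothing  p = tt
      After⇐′ (just x) p = subst (B._< _) (sym (index′ x)) p
      Before⇒′ : ∀ x {b} → Before B (bound v′ (Maybe.map index x)) b →
        Before B (bound (lookup v′ i ∷ᵛ v′) x) b
      Before⇒′ nothing  p = tt
      Before⇒′ (just x) p = subst (_ B.<_) (index′ x) p
      Before⇐′ : ∀ x {b} → Before B (bound (lookup v′ i ∷ᵛ v′) x) b →
        Before B (bound v′ (Maybe.map index x)) b
      Before⇐′ nothing  p = tt
      Before⇐′ (just x) p = subst (_ B.<_) (sym (index′ x)) p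

    module _ (a : A.Carrier) (new : ∀ i → ¬ lookup v i A.≈ a) where

      -- The chosen points next to `a` on either side, or `nothing` if there are none. The new move
      -- is played in the interval between them.
      Lower Upper : Maybe (Fin n) → Set
      Lower lo = After A (bound v lo) a × (∀ k → lookup v k A.< a →
        ∃[ l ] lo ≡ just l × ¬ lookup v l A.< lookup v k)
      Upper hi = Before A (bound v hi) a × (∀ k → a A.< lookup v k →
        ∃[ u ] hi ≡ just u × ¬ lookup v k A.< lookup v u)

      infimum : ∃ Lower
      infimum with maximal A._<_ (A.irrefl A.Eq.refl) A.trans (lookup v) (λ i → lookup v i A.< a)
      ... | inj₁ none = nothing , tt , λ k p → ⊥-elim (none k p)
      ... | inj₂ (l , l<a , max) = just l , l<a , λ k p → l , refl , max k p

      supremum : ∃ Upper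
      supremum with maximal (λ x y → y A.< x) (A.irrefl A.Eq.refl) (λ p q → A.trans q p) (lookup v)
        (λ i → a A.< lookup v i)
      ... | inj₁ none = nothing , tt , λ k p → ⊥-elim (none k p)
      ... | inj₂ (u , a<u , min) = just u , a<u , λ k p → u , refl , min k p

      -- Among the intervals ending at `a`, only those reaching to `lo` and to `hi` are new; a
      -- longer one is an old interval joined to one of these.
      insert : ∀ {lo hi} → Lower lo → Upper hi → ∀ b →
        Between B (bound v′ lo) (bound v′ hi) b → A.color a ≡ B.color b →
        sub A (Between A (bound v lo) (just a)) ~[ r ] sub B (Between B (bound v′ lo) (just b)) →
        sub A (Between A (just a) (bound v hi)) ~[ r ] sub B (Between B (just b) (bound v′ hi)) →
        Agree r A B (a ∷ᵛ v) (b ∷ᵛ v′)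
      insert {lo} {hi} (lo<a , lowest) (a<hi , highest) b (lo<b , b<hi) c≡ left≈ right≈ = record
        { intervals = intervals′
        ; <⇒< = <⇒<′ ; <⇐< = <⇐<′
        ; colors = λ { zero → c≡ ; (suc i) → colors g i } }
        where
        k<b : ∀ k → lookup v k A.< a → lookup v′ k B.< b
        k<b k k<a with lowest k k<a
        ... | l , refl , l≮k with A.compare (lookup v l) (lookup v k)
        ...   | tri< l<k _ _ = ⊥-elim (l≮k l<k)
        ...   | tri≈ _ l≈k _ = B.<-respˡ-≈ (agree-≈ g l k l≈k) lo<b
        ...   | tri> _ _ k<l = B.trans (<⇒< g k l k<l) lo<b
        b<k : ∀ k → a A.< lookup v k → b B.< lookup v′ k
        b<k k a<k with highest k a<k
        ... | u , refl , k≮u with A.compare (lookup v k) (lookup v u)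
        ...   | tri< k<u _ _ = ⊥-elim (k≮u k<u)
        ...   | tri≈ _ k≈u _ = B.<-respʳ-≈ (B.Eq.sym (agree-≈ g k u k≈u)) b<hi
        ...   | tri> _ _ u<k = B.trans b<hi (<⇒< g u k u<k)
        <⇒<′ : ∀ i j → lookup (a ∷ᵛ v) i A.< lookup (a ∷ᵛ v) j →
          lookup (b ∷ᵛ v′) i B.< lookup (b ∷ᵛ v′) j
        <⇒<′ zero    zero    a<a = ⊥-elim (A.irrefl A.Eq.refl a<a)
        <⇒<′ zero    (suc j) a<j = b<k j a<j
        <⇒<′ (suc i) zero    i<a = k<b i i<a
        <⇒<′ (suc i) (suc j) i<j = <⇒< g i j i<j
        <⇐<′ : ∀ i j → lookup (b ∷ᵛ v′) i B.< lookup (b ∷ᵛ v′) j →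
          lookup (a ∷ᵛ v) i A.< lookup (a ∷ᵛ v) j
        <⇐<′ zero    zero    b<b = ⊥-elim (B.irrefl B.Eq.refl b<b)
        <⇐<′ zero    (suc j) b<j with A.compare (lookup v j) a
        ... | tri< j<a _ _ = ⊥-elim (B.asym b<j (k<b j j<a))
        ... | tri≈ _ j≈a _ = ⊥-elim (new j j≈a)
        ... | tri> _ _ a<j = a<j
        <⇐<′ (suc i) zero    i<b with A.compare (lookup v i) a
        ... | tri< i<a _ _ = i<a
        ... | tri≈ _ i≈a _ = ⊥-elim (new i i≈a)
        ... | tri> _ _ a<i = ⊥-elim (B.asym i<b (b<k i a<i))
        <⇐<′ (suc i) (suc j) i<j = <⇐< g i j i<j
        Lefts Rights : Maybe (Fin n) → Set
        Lefts  i = sub A (Between A (bound v i) (just a)) ~[ r ] sub B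
          (Between B (bound v′ i) (just b))
        Rights j = sub A (Between A (just a) (bound v j)) ~[ r ] sub B
          (Between B (just b) (bound v′ j))
        joinˡ : ∀ i l → lo ≡ just l → After A (bound v i) (lookup v l) →
          After B (bound v′ i) (lookup v′ l) → Lefts i
        joinˡ i l refl i<l i<l′ = join-intervals A B {bound v i} {lookup v l} {just a} {bound v′ i} {lookup v′ l} {just b}
          i<l lo<a i<l′ lo<b (colors g l) (~-pred (intervals g i (just l))) left≈
        joinʳ : ∀ j u → hi ≡ just u → Before A (bound v j) (lookup v u) →
          Before B (bound v′ j) (lookup v′ u) → Rights j
        joinʳ j u refl u<j u<j′ = join-intervals A B {just a} {lookup v u} {bound v j} {just b} {lookup v′ u} {bound v′ j}
          a<hi u<j b<hi u<j′ (colors g u) right≈ (~-pred (intervals g (just u) j))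
        lefts : ∀ i → Lefts i
        lefts nothing = go lo refl
          where
          go : ∀ m → lo ≡ m → Lefts nothing
          go nothing  refl = left≈
          go (just l) e    = joinˡ nothing l e tt tt
        lefts (just i) with A.compare (lookup v i) a
        ... | tri≈ _ i≈a _ = ⊥-elim (new i i≈a)
        ... | tri> _ _ a<i = sub-empty (λ (i<x , x<a) → A.asym a<i (A.trans i<x x<a))
                                       (λ (i<x , x<b) → B.asym (b<k i a<i) (B.trans i<x x<b))
        ... | tri< i<a _ _ with lowest i i<a
        ...   | l , e , l≮i with A.compare (lookup v l) (lookup v i)
        ...     | tri< l<i _ _ = ⊥-elim (l≮i l<i)
        ...     | tri> _ _ i<l = joinˡ (just i) l e i<l (<⇒< g i l i<l)
        ...     | tri≈ _ l≈i _ = same e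
          where
          same : lo ≡ just l → Lefts (just i)
          same refl = sub-≐ (λ (p , q) → A.<-respˡ-≈ l≈i p , q)
            (λ (p , q) → A.<-respˡ-≈ (A.Eq.sym l≈i) p , q)
            (λ (p , q) → B.<-respˡ-≈ (agree-≈ g l i l≈i) p , q)
              (λ (p , q) → B.<-respˡ-≈ (B.Eq.sym (agree-≈ g l i l≈i)) p , q) left≈
        rights : ∀ j → Rights j
        rights nothing = go hi refl
          where
          go : ∀ m → hi ≡ m → Rights nothing
          go nothing  refl = right≈
          go (just u) e    = joinʳ nothing u e tt tt
        rights (just j) with A.compare (lookup v j) a
        ... | tri≈ _ j≈a _ = ⊥-elim (new j j≈a)
        ... | tri< j<a _ _ = sub-empty (λ (a<x , x<j) → A.asym j<a (A.trans a<x x<j))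
                                       (λ (b<x , x<j) → B.asym (k<b j j<a) (B.trans b<x x<j))
        ... | tri> _ _ a<j with highest j a<j
        ...   | u , e , j≮u with A.compare (lookup v j) (lookup v u)
        ...     | tri< j<u _ _ = ⊥-elim (j≮u j<u)
        ...     | tri> _ _ u<j = joinʳ (just j) u e u<j (<⇒< g u j u<j)
        ...     | tri≈ _ j≈u _ = same e
          where
          u≈j = A.Eq.sym j≈u
          same : hi ≡ just u → Rights (just j)
          same refl = sub-≐ (λ (p , q) → p , A.<-respʳ-≈ u≈j q) (λ (p , q) → p , A.<-respʳ-≈ j≈u q)
            (λ (p , q) → p , B.<-respʳ-≈ (agree-≈ g u j u≈j) q)
              (λ (p , q) → p , B.<-respʳ-≈ (agree-≈ g j u j≈u) q) right≈
        intervals′ : ∀ i j → sub A (Between A (bound (a ∷ᵛ v) i) (bound (a ∷ᵛ v) j)) ~[ r ]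
                             sub B (Between B (bound (b ∷ᵛ v′) i) (bound (b ∷ᵛ v′) j))
        intervals′ nothing        nothing        = ~-pred (intervals g nothing nothing)
        intervals′ nothing        (just zero)    = lefts nothing
        intervals′ nothing        (just (suc j)) = ~-pred (intervals g nothing (just j))
        intervals′ (just zero)    nothing        = rights nothing
        intervals′ (just zero)    (just zero)    = sub-empty (λ (p , q) → A.asym p q)
          (λ (p , q) → B.asym p q)
        intervals′ (just zero)    (just (suc j)) = rights (just j)
        intervals′ (just (suc i)) nothing        = ~-pred (intervals g (just i) nothing)
        intervals′ (just (suc i)) (just zero)    = lefts (just i)
        intervals′ (just (suc i)) (just (suc j)) = ~-pred (intervals g (just i) (just j))

    extend : ∀ a → ∃[ b ] Agree r A B (a ∷ᵛ v) (b ∷ᵛ v′)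
    extend a with decide em (∃[ i ] lookup v i A.≈ a)
    ... | yes (i , e) = lookup v′ i , repeat i a e
    ... | no new with infimum a (λ i e → new (i , e)) | supremum a (λ i e → new (i , e))
    ...   | lo , Lo | hi , Hi with forth (intervals g lo hi) refl (a , proj₁ Lo , proj₁ Hi)
    ...     | (b , b∈) , match c l τ = b , insert a (λ i e → new (i , e)) Lo Hi b b∈ c
      (~-trans (~-sym (between-left A (bound v lo) (bound v hi) (proj₁ Lo , proj₁ Hi)))
        (~-trans l (between-left B (bound v′ lo) (bound v′ hi) b∈)))
      (~-trans (~-sym (between-right A (bound v lo) (bound v hi) (proj₁ Lo , proj₁ Hi)))
        (~-trans τ (between-right B (bound v′ lo) (bound v′ hi) b∈)))

  transfer : ∀ {d n r} {A B : ColoredOrdinal d} {v : Vec (Carrier A) n} {v′ : Vec (Carrier B) n}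
    (φ : Formula d n) →
             quantifierRank φ ℕ.≤ r → Agree r A B v v′ → ⟦ A ⟧ φ v → ⟦ B ⟧ φ v′
  transfer (x <′ y) q g h = <⇒< g x y h
  transfer (x ≈′ y) q g h = agree-≈ g x y h
  transfer (C i x)  q g h = trans (sym (colors g x)) h
  transfer ⊥′       q g h = h
  transfer (¬′ φ)   q g h = λ h′ → h (transfer φ q (agree-sym g) h′)
  transfer (φ ∧′ ψ) q g (h , h′) = transfer φ (ℕ.m⊔n≤o⇒m≤o _ _ q) g h ,
    transfer ψ (ℕ.m⊔n≤o⇒n≤o (quantifierRank φ) _ q) g h′
  transfer (φ ∨′ ψ) q g (inj₁ h) = inj₁ (transfer φ (ℕ.m⊔n≤o⇒m≤o _ _ q) g h)
  transfer (φ ∨′ ψ) q g (inj₂ h) = inj₂ (transfer ψ (ℕ.m⊔n≤o⇒n≤o (quantifierRank φ) _ q) g h)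
  transfer (∀′ φ) (s≤s q) g h b = let a , g′ = extend (agree-sym g) b in transfer φ q (agree-sym g′) (h a)
  transfer (∃′ φ) (s≤s q) g (a , h) = let b , g′ = extend g a in b , transfer φ q g′ h

  ~⇒≡ : {A B : ColoredOrdinal d} → whole A ~[ r ] whole B → A ≡[ r ] B
  ~⇒≡ {A = A} {B} e φ q = mk⇔ (transfer φ q (start e)) (transfer φ q (start (~-sym e)))
    where
    start : {A B : ColoredOrdinal d} → whole A ~[ r ] whole B → Agree r A B []ᵛ []ᵛ
    start e = record
      { intervals = λ { nothing nothing →
        sub-≐ (λ _ → tt , tt) (λ _ → tt) (λ _ → tt , tt) (λ _ → tt) e }
      ; <⇒< = λ () ; <⇐< = λ () ; colors = λ () }

-- Words as colored ordinals

record Blocks (A : ColoredOrdinal d) (P : Carrier A → Set) (B : ℕ → Carrier A → Set) : Set where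
  field
    into    : ∀ {a} → P a → ∃[ n ] B n a
    out     : ∀ {n a} → B n a → P a
    ordered : ∀ {m n a b} → m ℕ.< n → B m a → B n b → ColoredOrdinal._<_ A a b

module _ {d : ℕ} {A : ColoredOrdinal d} {h : Word d} where
  open ColoredOrdinal A using (_<_; asym)

  blocks-pow : ∀ {r} n {B : ℕ → Carrier A → Set} → (∀ i → sub A (B i) ~[ r ] word h) →
               (∀ {i j a b} → i ℕ.< j → B i a → B j b → a < b) →
               sub A (λ a → ∃[ i ] i ℕ.< n × B i a) ~[ r ] word (pow h n)
  blocks-pow zero    e ordered = ~-empty (λ { (_ , _ , () , _) }) λ ()
  blocks-pow (suc n) {B} e ordered = glue
    (split-sub {P₁ = B 0} {P₂ = λ a → ∃[ i ] i ℕ.< n × B (suc i) a} (partition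
      (λ { (zero , _ , b) → inj₁ b ; (suc i , s≤s i<n , b) → inj₂ (i , i<n , b) })
      (λ b → 0 , s≤s z≤n , b) (λ (i , i<n , b) → suc i , s≤s i<n , b)
      (λ b (i , _ , b′) → ordered (s≤s z≤n) b b′)))
    (split-word h (pow h n)) (e 0) (blocks-pow n (λ i → e (suc i)) (λ i<j → ordered (s≤s i<j)))

  -- A move in block `n` leaves `n` full blocks and a part of block `n` on its left, and the rest of
  -- the block with ω further blocks on its right, exactly as a move in copy `n` of `h ^ω` does.
  blocks-ω : ∀ r {P} {B : ℕ → Carrier A → Set} → (∀ n → sub A (B n) ~[ r ] word h) → Blocks A P B →
             sub A P ~[ r ] word [ h ^ω ]
  blocks-ω zero    e b = ~-zero
  blocks-ω (suc r) {P} {B} e blocks = ~-suc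
    (λ (a , Pa) → let n , Bna = into Pa
                      p , m   = forth (e n) refl (a , Bna)
                  in copy n p , at-block n Bna Pa p m)
    (λ { (copy n p) → let (a , Bna) , m = back (e n) refl p in (a , out Bna) , at-block n Bna (out Bna) p m
       ; (there ()) })
    where
    open Blocks blocks
    at-block : ∀ n {a} (Bna : B n a) (Pa : P a) (p : Pos h) →
      Match (sub A (B n)) (a , Bna) r (word h) p →
               Match (sub A P) (a , Pa) r (word [ h ^ω ]) (copy n p)
    at-block n {a} Bna Pa p (match c l τ) = match c
      (glue (split-sub {P₁ = λ b → ∃[ i ] i ℕ.< n × B i b} {P₂ = λ b → B n b × b < a} (partition
              (λ (Pb , b<a) → before-a (into Pb) b<a)
              (λ (i , i<n , Bib) → out Bib , ordered i<n Bib Bna) (λ (Bnb , b<a) → out Bnb , b<a)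
              (λ (i , i<n , Bib) (Bnc , _) → ordered i<n Bib Bnc)))
            (split-word (pow h n) (left p)) (blocks-pow n (λ i → ~-pred (e i)) ordered) l)
      (glue (split-sub {P₁ = λ b → B n b × a < b} {P₂ = λ b → ∃[ i ] B (suc n + i) b} (partition
              (λ (Pb , a<b) → after-a (into Pb) a<b)
              (λ (Bnb , a<b) → out Bnb , a<b)
                (λ (i , Bib) → out Bib , ordered (ℕ.m≤m+n (suc n) i) Bna Bib)
              (λ (Bnb , _) (i , Bic) → ordered (ℕ.m≤m+n (suc n) i) Bnb Bic)))
            (split-word (right p) [ h ^ω ]) τ
            (blocks-ω r {B = λ i → B (suc n + i)} (λ i → ~-pred (e (suc n + i))) record
              { into = id ; out = λ {i} b → i , b ; ordered = λ i<j →
                ordered (ℕ.+-monoʳ-< (suc n) i<j) }))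
      where
      before-a : ∀ {b} → ∃[ i ] B i b → b < a → (∃[ i ] i ℕ.< n × B i b) ⊎ B n b × b < a
      before-a (i , Bib) b<a with ℕ.<-cmp i n
      ... | tri< i<n _ _ = inj₁ (i , i<n , Bib)
      ... | tri≈ _ refl _ = inj₂ (Bib , b<a)
      ... | tri> _ _ n<i = ⊥-elim (asym b<a (ordered n<i Bna Bib))
      after-a : ∀ {b} → ∃[ i ] B i b → a < b → B n b × a < b ⊎ (∃[ i ] B (suc n + i) b)
      after-a (i , Bib) a<b with ℕ.<-cmp i n
      ... | tri< i<n _ _ = ⊥-elim (asym a<b (ordered i<n Bib Bna))
      ... | tri≈ _ refl _ = inj₁ (Bib , a<b)
      ... | tri> _ _ n<i = inj₂ (i ∸ suc n , subst (λ j → B j _) (sym (ℕ.m+[n∸m]≡n n<i)) Bib)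

infixl 6 _⊕_

_⊕_ : WellOrder → WellOrder → WellOrder
α ⊕ β = record
  { strictTotalOrder = ⊎-<-strictTotalOrder {d = 0ℓ} {e = 0ℓ} {f = 0ℓ}
    (WellOrder.strictTotalOrder α) (WellOrder.strictTotalOrder β)
  ; <-wellFounded    = ⊎-<-wellFounded (WellOrder.<-wellFounded α) (WellOrder.<-wellFounded β)
  }

⟦_⟧ʷ : Word d → ColoredOrdinal d
⟦_⟧ᶠ : Factor d → ColoredOrdinal d
⟦ [] ⟧ʷ = record { otp = fin 0 ; color = λ () ; color-cong = λ { {()} } }
⟦ f ∷ w ⟧ʷ = record
  { otp        = ColoredOrdinal.otp ⟦ f ⟧ᶠ ⊕ ColoredOrdinal.otp ⟦ w ⟧ʷ
  ; color      = [ ColoredOrdinal.color ⟦ f ⟧ᶠ , ColoredOrdinal.color ⟦ w ⟧ʷ ]′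
  ; color-cong = λ { (inj₁ e) → ColoredOrdinal.color-cong ⟦ f ⟧ᶠ e ; (inj₂ e) →
    ColoredOrdinal.color-cong ⟦ w ⟧ʷ e }
  }
⟦ letter c ⟧ᶠ = record { otp = fin 1 ; color = λ _ → c ; color-cong = λ _ → refl }
⟦ h ^ω ⟧ᶠ = record
  { otp        = ColoredOrdinal.otp ⟦ h ⟧ʷ · ω
  ; color      = λ (_ , x) → ColoredOrdinal.color ⟦ h ⟧ʷ x
  ; color-cong = λ (_ , e) → ColoredOrdinal.color-cong ⟦ h ⟧ʷ e
  }

word-realised   : ∀ (w : Word d) {r} → whole ⟦ w ⟧ʷ ~[ r ] word w
factor-realised : ∀ (f : Factor d) {r} → whole ⟦ f ⟧ᶠ ~[ r ] word [ f ]
word-realised [] = ~-empty (λ ()) (λ ())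
word-realised {d} (f ∷ w) = glue (split-sub {P₁ = Isˡ} {P₂ = Isʳ} (partition
    (λ { {inj₁ x} _ → inj₁ tt ; {inj₂ y} _ → inj₂ tt }) (λ _ → tt) (λ _ → tt)
    (λ { {inj₁ x} {inj₂ y} _ _ → ₁∼₂ })))
  (split-word [ f ] w)
  (~-trans (iso {R = λ z x → z ≡ inj₁ x} record
    { total = λ { {inj₁ x} _ → x , tt , refl } ; surjective = λ {x} _ → inj₁ x , tt , refl
    ; preserves = λ { refl refl (₁∼₁ lt) → lt } ; reflects = λ { refl refl lt → ₁∼₁ lt }
    ; colours = λ { refl → refl } }) (factor-realised f))
  (~-trans (iso {R = λ z y → z ≡ inj₂ y} record
    { total = λ { {inj₂ y} _ → y , tt , refl } ; surjective = λ {y} _ → inj₂ y , tt , refl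
    ; preserves = λ { refl refl (₂∼₂ lt) → lt } ; reflects = λ { refl refl lt → ₂∼₂ lt }
    ; colours = λ { refl → refl } }) (word-realised w))
  where
  Isˡ Isʳ : Carrier ⟦ f ∷ w ⟧ʷ → Set
  Isˡ (inj₁ _) = ⊤
  Isˡ (inj₂ _) = ⊥
  Isʳ (inj₁ _) = ⊥
  Isʳ (inj₂ _) = ⊤
factor-realised (letter c) {zero} = ~-zero
factor-realised (letter c) {suc r} = ~-suc (λ { (zero , _) → here , at-letter })
  (λ { here → (zero , tt) , at-letter ; (there ()) })
  where
  at-letter : Match (whole ⟦ letter c ⟧ᶠ) (zero , tt) r (word [ letter c ]) here
  at-letter = match refl (~-empty (λ { ((zero , _ , ()) ) }) λ ())
    (~-empty (λ { ((zero , _ , ()) ) }) λ ())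
factor-realised (h ^ω) = blocks-ω _ {B = λ n (m , _) → m ≡ n}
  (λ n → ~-trans (iso {R = λ (m , x) y → m ≡ n × x ≡ y} record
    { total = λ { {_ , x} refl → x , tt , refl , refl } ; surjective = λ {y} _ → (n , y) , refl ,
      refl , refl
    ; preserves = λ { (refl , refl) (refl , refl) (inj₁ n<n) → ⊥-elim (ℕ.<-irrefl refl n<n)
      ; (refl , refl) (refl , refl) (inj₂ (_ , lt)) → lt }
    ; reflects = λ { (refl , refl) (refl , refl) lt → inj₂ (refl , lt) }
    ; colours = λ { (refl , refl) → refl } }) (word-realised h))
  record { into = λ _ → _ , refl ; out = λ _ → tt ; ordered = λ { m<n refl refl → inj₁ m<n } }

bottom : ∀ n → WellOrder.Carrier (ω^ n)
bottom zero    = zero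
bottom (suc n) = 0 , bottom n

-- The first coordinate counts the factors passed, across all earlier copies
-- in the case of an ω-power.
rank       : ∀ D (w : Word d) → Bounded D w → Carrier ⟦ w ⟧ʷ → WellOrder.Carrier (ω^ suc D)
factorRank : ∀ D (f : Factor d) → Bounded D [ f ] → Carrier ⟦ f ⟧ᶠ → WellOrder.Carrier (ω^ D)
rank D       (letter c ∷ w) b       (inj₁ x) = 0 , factorRank D (letter c) tt x
rank (suc D) (h ^ω ∷ w)     (b , _) (inj₁ x) = 0 , factorRank (suc D) (h ^ω) (b , tt) x
rank D       (letter c ∷ w) b       (inj₂ y) = let i , z = rank D w b y in suc i , z
rank (suc D) (h ^ω ∷ w)     (_ , b) (inj₂ y) = let i , z = rank (suc D) w b y in suc i , z
factorRank D       (letter c) _       x       = bottom D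
factorRank (suc D) (h ^ω)     (b , _) (n , x) = let i , z = rank D h b x in n ℕ.* length h + i , z

rank-< : ∀ D (w : Word d) b x → proj₁ (rank D w b x) ℕ.< length w
rank-< D       (letter c ∷ w) b       (inj₁ x) = s≤s z≤n
rank-< (suc D) (h ^ω ∷ w)     (b , _) (inj₁ x) = s≤s z≤n
rank-< D       (letter c ∷ w) b       (inj₂ y) = s≤s (rank-< D w b y)
rank-< (suc D) (h ^ω ∷ w)     (_ , b) (inj₂ y) = s≤s (rank-< (suc D) w b y)

rank-mono : ∀ D (w : Word d) b {x y} → ColoredOrdinal._<_ ⟦ w ⟧ʷ x y →
            WellOrder._<_ (ω^ suc D) (rank D w b x) (rank D w b y)
factorRank-mono : ∀ D (f : Factor d) b {x y} → ColoredOrdinal._<_ ⟦ f ⟧ᶠ x y →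
                  WellOrder._<_ (ω^ D) (factorRank D f b x) (factorRank D f b y)
rank-mono D       (letter c ∷ w) b        ₁∼₂      = inj₁ (s≤s z≤n)
rank-mono (suc D) (h ^ω ∷ w)     b        ₁∼₂      = inj₁ (s≤s z≤n)
rank-mono D       (letter c ∷ w) b        (₁∼₁ lt) = inj₂
  (refl , factorRank-mono D (letter c) tt lt)
rank-mono (suc D) (h ^ω ∷ w)     (b , _)  (₁∼₁ lt) = inj₂
  (refl , factorRank-mono (suc D) (h ^ω) (b , tt) lt)
rank-mono D       (letter c ∷ w) b        (₂∼₂ lt) = ×-suc (rank-mono D w b lt)
  where
  ×-suc : ∀ {i j z z′} → WellOrder._<_ (ω^ suc D) (i , z) (j , z′) →
    WellOrder._<_ (ω^ suc D) (suc i , z) (suc j , z′)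
  ×-suc (inj₁ i<j)      = inj₁ (s≤s i<j)
  ×-suc (inj₂ (e , lt)) = inj₂ (cong suc e , lt)
rank-mono (suc D) (h ^ω ∷ w)     (_ , b)  (₂∼₂ lt) = ×-suc (rank-mono (suc D) w b lt)
  where
  ×-suc : ∀ {i j z z′} → WellOrder._<_ (ω^ suc (suc D)) (i , z) (j , z′) →
    WellOrder._<_ (ω^ suc (suc D)) (suc i , z) (suc j , z′)
  ×-suc (inj₁ i<j)      = inj₁ (s≤s i<j)
  ×-suc (inj₂ (e , lt)) = inj₂ (cong suc e , lt)
factorRank-mono D       (letter c) _       {zero} {zero} ()
factorRank-mono (suc D) (h ^ω)     (b , _) {m , x} {n , y} (inj₁ m<n) = inj₁ (begin-strict
  m ℕ.* length h + proj₁ (rank D h b x) <⟨ ℕ.+-monoʳ-< (m ℕ.* length h) (rank-< D h b x) ⟩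
  m ℕ.* length h + length h             ≡⟨ ℕ.+-comm (m ℕ.* length h) (length h) ⟩
  suc m ℕ.* length h                    ≤⟨ ℕ.*-monoˡ-≤ (length h) m<n ⟩
  n ℕ.* length h                        ≤⟨ ℕ.m≤m+n _ _ ⟩
  n ℕ.* length h + proj₁ (rank D h b y) ∎)
  where open ℕ.≤-Reasoning
factorRank-mono (suc D) (h ^ω)     (b , _) {m , x} {m , y}
  (inj₂ (refl , lt)) with rank-mono D h b lt
... | inj₁ i<j       = inj₁ (ℕ.+-monoʳ-< (m ℕ.* length h) i<j)
... | inj₂ (e , lt′) = inj₂ (cong (m ℕ.* length h +_) e , lt′)

-- Differs from `rank` at the final ω-power, which spreads over all first coordinates from
-- `length u` on instead of occupying one. Thus a last factor of depth `suc D` still fits into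
-- `ω^ suc D`.
lastRank : ∀ D (u : Word d) {h} → Bounded D u → Bounded D h → Carrier ⟦ u ++ [ h ^ω ] ⟧ʷ →
  WellOrder.Carrier (ω^ suc D)
lastRank D       []             {h} _        b  (inj₁ x) = factorRank (suc D) (h ^ω) (b , tt) x
lastRank D       (letter c ∷ u)     bu       bh (inj₁ x) = 0 , factorRank D (letter c) tt x
lastRank (suc D) (g ^ω ∷ u)         (b , _)  bh (inj₁ x) = 0 , factorRank (suc D) (g ^ω) (b , tt) x
lastRank D       (letter c ∷ u)     bu       bh (inj₂ y) = let i , z = lastRank D u bu bh y in suc i , z
lastRank (suc D) (g ^ω ∷ u)         (_ , bu) bh (inj₂ y) = let i , z = lastRank (suc D) u bu bh y in suc i , z

lastRank-mono : ∀ D (u : Word d) {h} bu bh {x y} → ColoredOrdinal._<_ ⟦ u ++ [ h ^ω ] ⟧ʷ x y →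
                WellOrder._<_ (ω^ suc D) (lastRank D u bu bh x) (lastRank D u bu bh y)
lastRank-mono D       []             {h} bu bh {inj₁ _} (₁∼₁ lt) = factorRank-mono (suc D) (h ^ω)
  (bh , tt) lt
lastRank-mono D       (letter c ∷ u) bu bh ₁∼₂      = inj₁ (s≤s z≤n)
lastRank-mono (suc D) (g ^ω ∷ u)     bu bh ₁∼₂      = inj₁ (s≤s z≤n)
lastRank-mono D       (letter c ∷ u) bu bh (₁∼₁ lt) = inj₂
  (refl , factorRank-mono D (letter c) tt lt)
lastRank-mono (suc D) (g ^ω ∷ u)     (b , _) bh (₁∼₁ lt) = inj₂
  (refl , factorRank-mono (suc D) (g ^ω) (b , tt) lt)
lastRank-mono D       (letter c ∷ u) bu bh (₂∼₂ lt) with lastRank-mono D u bu bh lt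
... | inj₁ i<j      = inj₁ (s≤s i<j)
... | inj₂ (e , l)  = inj₂ (cong suc e , l)
lastRank-mono (suc D) (g ^ω ∷ u)     (_ , bu) bh (₂∼₂ lt) with lastRank-mono (suc D) u bu bh lt
... | inj₁ i<j      = inj₁ (s≤s i<j)
... | inj₂ (e , l)  = inj₂ (cong suc e , l)

-- Strictly monotone maps and comparison of order types

module Embeddings (em : ExcludedMiddle (lsuc 0ℓ)) where

  least : (β : WellOrder) (P : WellOrder.Carrier β → Set) → ∃ P →
          ∃[ y ] P y × (∀ {z} → P z → ¬ WellOrder._<_ β z y)
  least β P (y , Py) = go y Py (<-wellFounded y)
    where
    open WellOrder β
    go : ∀ y → P y → Acc _<_ y → ∃[ y ] P y × (∀ {z} → P z → ¬ z < y)
    go y Py (acc rs) with decide em (∃[ z ] P z × z < y)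
    ... | yes (z , Pz , z<y) = go z Pz (rs z<y)
    ... | no none = y , Py , λ {z} Pz z<y → none (z , Pz , z<y)

  module _ (α β : WellOrder) (f : WellOrder.Carrier α → WellOrder.Carrier β)
           (f-mono : ∀ {x y} → WellOrder._<_ α x y → WellOrder._<_ β (f x) (f y)) where
    private
      module α = WellOrder α
      module β = WellOrder β

    least-or : (P : β.Carrier → Set) → β.Carrier → Dec (∃ P) → β.Carrier
    least-or P y (yes e) = proj₁ (least β P e)
    least-or P y (no _)  = y

    -- The Mostowski collapse of the image of f; the default value is never
    -- used, since f itself bounds the earlier values.
    collapse : ∀ x → Acc α._<_ x → β.Carrier
    Beyond   : ∀ {x} → (∀ {x′} → x′ α.< x → Acc α._<_ x′) → β.Carrier → Set
    collapse x (acc rs) = least-or (Beyond {x} rs) (f x) (decide em (∃ (Beyond {x} rs)))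
    Beyond {x} rs y = ∀ {x′} (lt : x′ α.< x) → collapse x′ (rs lt) β.< y

    ≤-<-trans : ∀ {x y z} → ¬ y β.< x → y β.< z → x β.< z
    ≤-<-trans {x} {y} y≮x y<z with β.compare x y
    ... | tri< x<y _ _ = β.trans x<y y<z
    ... | tri≈ _ x≈y _ = β.<-respˡ-≈ (β.Eq.sym x≈y) y<z
    ... | tri> _ _ y<x = ⊥-elim (y≮x y<x)

    collapse-least : ∀ x (rs : ∀ {x′} → x′ α.< x → Acc α._<_ x′) →
      Beyond {x} rs (collapse x (acc rs)) × (∀ {z} → Beyond {x} rs z → ¬ z β.< collapse x (acc rs))
    collapse-≤ : ∀ x (a : Acc α._<_ x) → ¬ f x β.< collapse x a
    f-beyond : ∀ x (rs : ∀ {x′} → x′ α.< x → Acc α._<_ x′) → Beyond {x} rs (f x)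
    f-beyond x rs {x′} lt = ≤-<-trans (collapse-≤ x′ (rs lt)) (f-mono lt)
    collapse-least x rs with decide em (∃ (Beyond {x} rs))
    ... | yes e = proj₂ (least β (Beyond {x} rs) e)
    ... | no ¬e = ⊥-elim (¬e (f x , f-beyond x rs))
    collapse-≤ x (acc rs) = proj₂ (collapse-least x rs) (f-beyond x rs)

    collapse-cong : ∀ {x x′} (a : Acc α._<_ x) (a′ : Acc α._<_ x′) → x α.≈ x′ →
      collapse x a β.≈ collapse x′ a′
    collapse-cong {x} {x′} (acc rs) (acc rs′) x≈x′ = ≮⇒≈
      (proj₂ (collapse-least x′ rs′) λ lt →
        β.<-respˡ-≈ (collapse-cong (rs _) (rs′ lt) α.Eq.refl)
          (proj₁ (collapse-least x rs) (α.<-respʳ-≈ (α.Eq.sym x≈x′) lt)))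
      (proj₂ (collapse-least x rs) λ lt →
        β.<-respˡ-≈ (β.Eq.sym (collapse-cong (rs lt) (rs′ _) α.Eq.refl))
          (proj₁ (collapse-least x′ rs′) (α.<-respʳ-≈ x≈x′ lt)))
      where
      ≮⇒≈ : ∀ {y z} → ¬ y β.< z → ¬ z β.< y → y β.≈ z
      ≮⇒≈ {y} {z} y≮z z≮y with β.compare y z
      ... | tri< y<z _ _ = ⊥-elim (y≮z y<z)
      ... | tri≈ _ e _ = e
      ... | tri> _ _ z<y = ⊥-elim (z≮y z<y)

    collapse-mono : ∀ {x x′} (a : Acc α._<_ x) (a′ : Acc α._<_ x′) → x α.< x′ →
      collapse x a β.< collapse x′ a′
    collapse-mono a (acc rs′) lt = β.<-respˡ-≈ (collapse-cong (rs′ lt) a α.Eq.refl)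
      (proj₁ (collapse-least _ rs′) lt)

    -- `collapse` takes the least value beyond all earlier ones, so `y` is not beyond them. Some
    -- earlier value is therefore at least `y`: it equals `y`, or the search goes on below it.
    collapse-down : ∀ x (a : Acc α._<_ x) {y} → y β.< collapse x a → ∃[ x′ ] Σ (Acc α._<_ x′) λ a′ →
      collapse x′ a′ β.≈ y
    collapse-down x (acc rs) {y} y<x with decide em
      (∃[ x′ ] Σ (x′ α.< x) λ lt → ¬ collapse x′ (rs lt) β.< y)
    ... | no none = ⊥-elim (proj₂ (collapse-least x rs) beyond y<x)
      where
      beyond : Beyond {x} rs y
      beyond {x′} lt with decide em (collapse x′ (rs lt) β.< y)
      ... | yes p = p
      ... | no ¬p = ⊥-elim (none (x′ , lt , ¬p))
    ... | yes (x′ , lt , x′≮y) with β.compare (collapse x′ (rs lt)) y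
    ...   | tri< p _ _ = ⊥-elim (x′≮y p)
    ...   | tri≈ _ e _ = x′ , rs lt , e
    ...   | tri> _ _ p = collapse-down x′ (rs lt) p

    private
      to : α.Carrier → β.Carrier
      to x = collapse x (α.<-wellFounded x)

      to-cong : ∀ {x y} → x α.≈ y → to x β.≈ to y
      to-cong {x} {y} = collapse-cong (α.<-wellFounded x) (α.<-wellFounded y)

      to-mono : ∀ {x y} → x α.< y → to x β.< to y
      to-mono {x} {y} = collapse-mono (α.<-wellFounded x) (α.<-wellFounded y)

    mono⇒≤ₒ : α ≤ₒ β
    mono⇒≤ₒ = record
      { to = to
      ; isOrderMonomorphism = record
        { isOrderHomomorphism = record { cong = to-cong ; mono = to-mono }
        ; injective = injective
        ; cancel    = cancel }
      ; downwardClosed = λ {x} lt → let x′ , a′ , e = collapse-down x (α.<-wellFounded x) lt in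
          x′ , β.Eq.trans (collapse-cong (α.<-wellFounded x′) a′ α.Eq.refl) e
      }
      where
      injective : ∀ {x y} → to x β.≈ to y → x α.≈ y
      injective {x} {y} e with α.compare x y
      ... | tri< lt _ _ = ⊥-elim (β.irrefl e (to-mono lt))
      ... | tri≈ _ e′ _ = e′
      ... | tri> _ _ gt = ⊥-elim (β.irrefl (β.Eq.sym e) (to-mono gt))
      cancel : ∀ {x y} → to x β.< to y → x α.< y
      cancel {x} {y} lt with α.compare x y
      ... | tri< lt′ _ _ = lt′
      ... | tri≈ _ e _ = ⊥-elim (β.irrefl (to-cong e) lt)
      ... | tri> _ _ gt = ⊥-elim (β.asym lt (to-mono gt))

-- Every colored ordinal is equivalent to a word

~-≤ : ∀ {s r} {x y : State d} → s ℕ.≤ r → x ~[ r ] y → x ~[ s ] y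
~-≤ {s = s} {r} {x} {y} s≤r e = go (r ∸ s) (subst (λ k → x ~[ k ] y) (sym (ℕ.m∸n+n≡m s≤r)) e)
  where
  go : ∀ k → x ~[ k + s ] y → x ~[ s ] y
  go zero    e = e
  go (suc k) e = go k (~-pred e)

ascending : ∀ {X : Set} {_≺_ : X → X → Set} → (∀ {x y z} → x ≺ y → y ≺ z → x ≺ z) →
            (f : ℕ → X) → (∀ n → f n ≺ f (suc n)) → ∀ {m n} → m ℕ.< n → f m ≺ f n
ascending {_≺_ = _≺_} ≺-trans f f-suc {m} {suc n} (s≤s m≤n) with ℕ.m≤n⇒m<n∨m≡n m≤n
... | inj₁ m<n  = ≺-trans (ascending {_≺_ = _≺_} ≺-trans f f-suc m<n) (f-suc n)
... | inj₂ refl = f-suc n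

-- Ramsey's theorem for pairs

module Ramsey (em : ExcludedMiddle (lsuc 0ℓ)) where

  Infinite : (ℕ → Set) → Set
  Infinite S = ∀ m → ∃[ s ] m ℕ.< s × S s

  upper-bound : ∀ n (f : Fin n → ℕ) → ∃[ M ] ∀ i → f i ℕ.≤ M
  upper-bound zero    f = 0 , λ ()
  upper-bound (suc n) f = let M , b = upper-bound n (f ∘ suc) in
    f zero ℕ.⊔ M , λ { zero → ℕ.m≤m⊔n _ _ ; (suc i) → ℕ.≤-trans (b i) (ℕ.m≤n⊔m (f zero) M) }

  infinite-fibre : ∀ {n S} → Infinite S → (f : ℕ → Fin n) → ∃[ e ] Infinite (λ s → S s × f s ≡ e)
  infinite-fibre {n} {S} inf f with decide em (∃[ e ] Infinite (λ s → S s × f s ≡ e))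
  ... | yes p = p
  ... | no none = ⊥-elim (let s , M<s , Ss = inf (proj₁ M) in
    proj₂ (bounded (f s)) (s , ℕ.≤-<-trans (proj₂ M (f s)) M<s , Ss , refl))
    where
    bounded : ∀ e → ∃[ m ] ¬ (∃[ s ] m ℕ.< s × S s × f s ≡ e)
    bounded e with decide em (∃[ m ] ¬ (∃[ s ] m ℕ.< s × S s × f s ≡ e))
    ... | yes p = p
    ... | no ¬p = ⊥-elim (none (e , λ m → found m (decide em _)))
      where
      found : ∀ m → Dec (∃[ s ] m ℕ.< s × S s × f s ≡ e) → ∃[ s ] m ℕ.< s × S s × f s ≡ e
      found m (yes p) = p
      found m (no ¬q) = ⊥-elim (¬p (m , ¬q))
    M : ∃[ m ] ∀ i → proj₁ (bounded i) ℕ.≤ m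
    M = upper-bound n (λ i → proj₁ (bounded i))

  module _ {n : ℕ} (χ : ℕ → ℕ → Fin n) where

    Stage : Set₁
    Stage = Σ (ℕ → Set) Infinite

    pick : Stage → ℕ
    pick (S , inf) = proj₁ (inf 0)

    beyond : (x : Stage) → Infinite (λ s → proj₁ x s × pick x ℕ.< s)
    beyond x@(S , inf) m = let s , lt , Ss = inf (m ℕ.⊔ pick x) in
      s , ℕ.≤-<-trans (ℕ.m≤m⊔n m (pick x)) lt , Ss , ℕ.≤-<-trans (ℕ.m≤n⊔m m (pick x)) lt

    fibre : (x : Stage) → ∃[ e ] Infinite (λ s → (proj₁ x s × pick x ℕ.< s) × χ (pick x) s ≡ e)
    fibre x = infinite-fibre (beyond x) (χ (pick x))

    -- Each stage keeps an infinite set of later numbers that form pairs of one color with the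
    -- number picked. The color of a pair of picked numbers then depends only on the smaller one,
    -- and one more pigeonhole argument makes it constant.
    stage : ℕ → Stage
    stage zero    = (λ _ → ⊤) , λ m → suc m , ℕ.n<1+n m , tt
    stage (suc k) = _ , proj₂ (fibre (stage k))

    chosen : ℕ → ℕ
    chosen k = pick (stage k)

    later : ∀ k j {s} → proj₁ (stage (suc k + j)) s → chosen k ℕ.< s ×
      χ (chosen k) s ≡ proj₁ (fibre (stage k))
    later k zero    {s} p with subst (λ i → proj₁ (stage (suc i)) s) (ℕ.+-identityʳ k) p
    ... | ((_ , lt) , e) = lt , e
    later k (suc j) {s} p with subst (λ i → proj₁ (stage (suc i)) s) (ℕ.+-suc k j) p
    ... | ((q , _) , _) = later k j q

    chosen-later : ∀ {k l} → k ℕ.< l → chosen k ℕ.< chosen l ×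
      χ (chosen k) (chosen l) ≡ proj₁ (fibre (stage k))
    chosen-later {k} {l} k<l = later k (l ∸ suc k)
      (subst (λ i → proj₁ (stage i) (chosen l)) (sym (ℕ.m+[n∸m]≡n k<l))
      (proj₂ (proj₂ (proj₂ (stage l) 0))))

    homogeneous : ∃₂ λ (g : ℕ → ℕ) e → (∀ {i j} → i ℕ.< j → g i ℕ.< g j) ×
      (∀ {i j} → i ℕ.< j → χ (g i) (g j) ≡ e)
    homogeneous with infinite-fibre {S = λ _ → ⊤} (λ m → suc m , ℕ.n<1+n m , tt)
      (λ k → proj₁ (fibre (stage k)))
    ... | e , inf = chosen ∘ κ , e , (λ i<j → proj₁ (chosen-later (κ-mono i<j)))
      , (λ {i} i<j → trans (proj₂ (chosen-later (κ-mono i<j))) (κ-fibre i))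
      where
      κ : ℕ → ℕ
      κ zero    = proj₁ (inf 0)
      κ (suc i) = proj₁ (inf (κ i))
      κ-mono : ∀ {i j} → i ℕ.< j → κ i ℕ.< κ j
      κ-mono = ascending {_≺_ = ℕ._<_} ℕ.<-trans κ (λ i → proj₁ (proj₂ (inf (κ i))))
      κ-fibre : ∀ i → proj₁ (fibre (stage (κ i))) ≡ e
      κ-fibre zero    = proj₂ (proj₂ (proj₂ (inf 0)))
      κ-fibre (suc i) = proj₂ (proj₂ (proj₂ (inf (κ i))))

-- A countable substructure and its decomposition into blocks

module Normalise (em : ExcludedMiddle (lsuc 0ℓ)) {d : ℕ} (A : ColoredOrdinal d) (R : ℕ) where
  open Types em
  open Ramsey em
  open Embeddings em using (least)
  open ColoredOrdinal A renaming (trans to <-trans; Carrier to ∣A∣)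

  -- The layers exhaust a countable substructure that realises, between any two
  -- of its points (or ±∞), every character realised there in A.
  witnesses : Maybe ∣A∣ → Maybe ∣A∣ → Fin (charCount d R) → List ∣A∣
  witnesses lo hi ξ with decide em (∃[ p ] charCode R (sub A (Between A lo hi)) p ≡ ξ)
  ... | yes ((a , _) , _) = [ a ]
  ... | no _              = []

  bounds : List ∣A∣ → List (Maybe ∣A∣)
  bounds as = nothing ∷ map just as

  layer : ℕ → List ∣A∣
  layer zero    = []
  layer (suc n) = layer n ++ concatMap
    (λ lo → concatMap (λ hi → concatMap (witnesses lo hi) (allFin (charCount d R)))
    (bounds (layer n))) (bounds (layer n))

  layer-≤ : ∀ {m n a} → m ℕ.≤ n → a ∈ layer m → a ∈ layer n
  layer-≤ {m} {n} {a} m≤n a∈ = subst (λ k → a ∈ layer k) (ℕ.m∸n+n≡m m≤n) (go (n ∸ m))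
    where
    go : ∀ k → a ∈ layer (k + m)
    go zero    = a∈
    go (suc k) = ∈-++⁺ˡ (go k)

  witness : ∀ lo hi (p : Position (sub A (Between A lo hi))) →
            ∃[ a ] a ∈ witnesses lo hi (charCode R (sub A (Between A lo hi)) p) ×
              Σ (Between A lo hi a) λ b → charCode R (sub A (Between A lo hi)) (a , b) ≡ charCode R
                (sub A (Between A lo hi)) p
  witness lo hi p with decide em (∃[ p′ ] charCode R (sub A (Between A lo hi)) p′ ≡ charCode R
    (sub A (Between A lo hi)) p)
  ... | yes ((a , b) , e) = a , here refl , b , e
  ... | no ¬p = ⊥-elim (¬p (p , refl))

  Chosen : ∣A∣ → Set
  Chosen a = ∃[ n ] a ∈ layer n

  ChosenBound : Maybe ∣A∣ → Set
  ChosenBound nothing  = ⊤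
  ChosenBound (just a) = Chosen a

  bound-layer : ∀ x → ChosenBound x → ∃[ n ] ∀ {k} → n ℕ.≤ k → x ∈ bounds (layer k)
  bound-layer nothing  _        = 0 , λ _ → here refl
  bound-layer (just a) (n , a∈) = n , λ n≤k → there (∈-map⁺ just (layer-≤ n≤k a∈))

  closed : ∀ lo hi → ChosenBound lo → ChosenBound hi → (p : Position (sub A (Between A lo hi))) →
           ∃[ a ] Chosen a × Σ (Between A lo hi a) λ b →
             charCode R (sub A (Between A lo hi)) (a , b) ≡ charCode R (sub A (Between A lo hi)) p
  closed lo hi clo chi p =
    let m , lo∈ = bound-layer lo clo
        n , hi∈ = bound-layer hi chi
        a , a∈ , b , e = witness lo hi p
    in a , (suc (m ℕ.⊔ n) , ∈-++⁺ʳ (layer (m ℕ.⊔ n))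
         (∈-concatMap⁺ (λ lo → concatMap
           (λ hi → concatMap (witnesses lo hi) (allFin (charCount d R))) (bounds (layer (m ℕ.⊔ n))))
         (lose (lo∈ (ℕ.m≤m⊔n m n))
         (∈-concatMap⁺ (λ hi → concatMap (witnesses lo hi) (allFin (charCount d R)))
         (lose (hi∈ (ℕ.m≤n⊔m m n)) (∈-concatMap⁺ (witnesses lo hi) (lose (∈-allFin _) a∈)))))))
       , b , e

  -- The Tarski-Vaught argument: a character realised in an interval with chosen ends is realised
  -- there by a chosen point, and both smaller intervals again have chosen ends. The closure is with
  -- respect to R-characters, so `s` stays below `R`.
  chosen-interval : ∀ s → s ℕ.≤ R → ∀ lo hi → ChosenBound lo → ChosenBound hi →
                    sub A (λ a → Chosen a × Between A lo hi a) ~[ s ] sub A (Between A lo hi)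
  chosen-interval zero    _   lo hi clo chi = ~-zero
  chosen-interval (suc s) s<R lo hi clo chi = ~-suc
    (λ (a , ca , b) → (a , b) , at-point ca b)
    (λ p → let a , ca , b , e = closed lo hi clo chi p
               ce , lre = Fin.combine-injective _ _ _ _ e
               le , re  = Fin.combine-injective _ _ _ _ lre
           in (a , ca , b) , match-trans (at-point ca b)
                (match ce (~-≤ s≤R (code-≡⇒~ R _ _ le)) (~-≤ s≤R (code-≡⇒~ R _ _ re))))
    where
    s≤R = ℕ.<⇒≤ s<R
    at-point : ∀ {a} (ca : Chosen a) (b : Between A lo hi a) →
               Match (sub A (λ a → Chosen a × Between A lo hi a)) (a , ca , b) s
                 (sub A (Between A lo hi)) (a , b)
    at-point {a} ca b@(lo<a , a<hi) = match refl
      (~-trans (sub-cong (λ ((cx , lo<x , _) , x<a) → cx , lo<x , x<a)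
                         (λ (cx , lo<x , x<a) → (cx , lo<x , before-trans A hi a<hi x<a) , x<a))
        (~-trans (chosen-interval s s≤R lo (just a) clo ca) (~-sym (between-left A lo hi b))))
      (~-trans (sub-cong (λ ((cx , _ , x<hi) , a<x) → cx , a<x , x<hi)
                         (λ (cx , a<x , x<hi) → (cx , after-trans A lo lo<a a<x , x<hi) , a<x))
        (~-trans (chosen-interval s s≤R (just a) hi ca chi) (~-sym (between-right A lo hi b))))

  HasWord : (∣A∣ → Set) → Set
  HasWord P = ∃[ w ] sub A P ~[ R ] word w

  -- A half-open interval of chosen points from `y` on. Its end is given by a set, in the uses a
  -- downward closed one, so that an interval without upper end is included.
  Segment : ∣A∣ → (∣A∣ → Set) → ∣A∣ → Set
  Segment y J a = Chosen a × ¬ a < y × J a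

  hasWord-point : ∀ z → Chosen z → HasWord (λ a → Chosen a × a ≈ z)
  hasWord-point z cz = [ letter (color z) ] , single R
    where
    single : ∀ r → sub A (λ a → Chosen a × a ≈ z) ~[ r ] word [ letter (color z) ]
    single zero    = ~-zero
    single (suc r) = ~-suc (λ (a , p) → here , at-letter p)
      (λ { here → (z , cz , Eq.refl) , at-letter (cz , Eq.refl) ; (there ()) })
      where
      at-letter : ∀ {a} (p : Chosen a × a ≈ z) →
        Match (sub A (λ a → Chosen a × a ≈ z)) (a , p) r (word [ letter (color z) ]) here
      at-letter (_ , a≈z) = match (color-cong a≈z)
        (~-empty (λ (_ , (_ , x≈z) , x<a) → irrefl (Eq.trans x≈z (Eq.sym a≈z)) x<a) λ ())
        (~-empty (λ (_ , (_ , x≈z) , a<x) → irrefl (Eq.trans a≈z (Eq.sym x≈z)) a<x) λ ())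

  hasWord-++ : ∀ {P P₁ P₂} → Partition A P P₁ P₂ → HasWord P₁ → HasWord P₂ → HasWord P
  hasWord-++ part (u , e) (v , f) = u ++ v , glue (split-sub part) (split-word u v) e f

  ≮-<-trans : ∀ {x y z} → ¬ y < x → y < z → x < z
  ≮-<-trans {x} {y} y≮x y<z with compare x y
  ... | tri< x<y _ _ = <-trans x<y y<z
  ... | tri≈ _ x≈y _ = <-respˡ-≈ (Eq.sym x≈y) y<z
  ... | tri> _ _ y<x = ⊥-elim (y≮x y<x)

  <-≮-trans : ∀ {x y z} → x < y → ¬ z < y → x < z
  <-≮-trans {x} {y} {z} x<y z≮y with compare y z
  ... | tri< y<z _ _ = <-trans x<y y<z
  ... | tri≈ _ y≈z _ = <-respʳ-≈ y≈z x<y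
  ... | tri> _ _ z<y = ⊥-elim (z≮y z<y)

  module _ (J : ∣A∣ → Set) (J-down : ∀ {a b} → J b → ¬ b < a → J a)
           (before-J : ∀ z → J z → ∀ y → HasWord (Segment y (_< z))) (y : ∣A∣) where

    private
      K : ∣A∣ → Set
      K = Segment y J

    hasWord-max : ∀ z → K z → (∀ {a} → K a → ¬ z < a) → HasWord K
    hasWord-max z Kz@(cz , z≮y , Jz) max = hasWord-++ {P₁ = Segment y (_< z)} {P₂ = λ a → Chosen a ×
      a ≈ z}
      (partition into (λ (ca , a≮y , a<z) → ca , a≮y , J-down Jz (asym a<z))
        (λ (ca , a≈z) → ca , (λ a<y → z≮y (<-respˡ-≈ a≈z a<y)) , J-down Jz (irrefl (Eq.sym a≈z)))
        (λ (_ , _ , a<z) (_ , b≈z) → <-respʳ-≈ (Eq.sym b≈z) a<z))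
      (before-J z Jz y) (hasWord-point z cz)
      where
      into : ∀ {a} → K a → Segment y (_< z) a ⊎ Chosen a × a ≈ z
      into {a} Ka@(ca , a≮y , Ja) with compare a z
      ... | tri< a<z _ _ = inj₁ (ca , a≮y , a<z)
      ... | tri≈ _ a≈z _ = inj₂ (ca , a≈z)
      ... | tri> _ _ z<a = ⊥-elim (max Ka z<a)

    module _ (x₀ : ∣A∣) (Kx₀ : K x₀) (next : ∀ {z} → K z → ∃[ z′ ] K z′ × z < z′) where

      above-list : (as : List ∣A∣) → ∀ x → K x → ∃[ z ] K z × x < z × (∀ {a} → a ∈ as → K a → a < z)
      above-list []       x Kx = let z , Kz , x<z = next Kx in z , Kz , x<z , λ ()
      above-list (a ∷ as) x Kx with above-list as x Kx
      ... | z , Kz , x<z , as<z with decide em (K a × ¬ a < z)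
      ...   | no ¬p = z , Kz , x<z , λ
        { (here refl) Ka → below-z Ka ; (there a∈) → as<z a∈ }
        where
        below-z : K a → a < z
        below-z Ka with decide em (a < z)
        ... | yes a<z = a<z
        ... | no a≮z = ⊥-elim (¬p (Ka , a≮z))
      ...   | yes (Ka , a≮z) = let z′ , Kz′ , a<z′ = next Ka in
        z′ , Kz′ , <-trans x<z (≮-<-trans a≮z a<z′)
        , λ { (here refl) _ → a<z′ ; (there b∈) Kb → <-trans (as<z b∈ Kb) (≮-<-trans a≮z a<z′) }

      -- Every layer is finite and `K` has no last point, so the next term can be put above all
      -- points of `layer n` in `K`. As the layers exhaust the chosen points, the sequence is
      -- cofinal; this is what countability is for.
      seq : ℕ → ∃ K
      seq zero    = x₀ , Kx₀
      seq (suc n) = let x , Kx = seq n ; z , Kz , _ = above-list (layer n) x Kx in z , Kz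

      s : ℕ → ∣A∣
      s n = proj₁ (seq n)

      s-mono : ∀ {m n} → m ℕ.< n → s m < s n
      s-mono = ascending {_≺_ = _<_} <-trans s
        (λ n → proj₁ (proj₂ (proj₂ (above-list (layer n) _ (proj₂ (seq n))))))

      s-cofinal : ∀ {a} → K a → ∃[ n ] a < s n
      s-cofinal Ka@((n , a∈) , _) = suc n ,
        proj₂ (proj₂ (proj₂ (above-list (layer n) _ (proj₂ (seq n))))) a∈ Ka

      J-s : ∀ n → J (s n)
      J-s n = proj₂ (proj₂ (proj₂ (seq n)))

      s-≮y : ∀ n → ¬ s n < y
      s-≮y n = proj₁ (proj₂ (proj₂ (seq n)))

      module _ (g : ℕ → ℕ) (g-mono : ∀ {i j} → i ℕ.< j → g i ℕ.< g j) (e : Fin (typeCount d R))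
               (g-hom : ∀ {i j} → i ℕ.< j → code R
                 (sub A (Segment (s (g i)) (_< s (g j)))) ≡ e) where

        block : ℕ → ∣A∣ → Set
        block n = Segment (s (g n)) (_< s (g (suc n)))

        -- One word serves all blocks because their types agree. The blocks must follow each other
        -- without gaps, and so the type has to be constant on pairs of a subsequence: this calls
        -- for Ramsey's theorem and not just a pigeonhole argument.
        block-word : HasWord (block 0)
        block-word = before-J (s (g 1)) (J-s (g 1)) (s (g 0))

        block-~ : ∀ n → sub A (block n) ~[ R ] word (proj₁ block-word)
        block-~ n = ~-trans (code-≡⇒~ R (sub A (block n)) (sub A (block 0))
          (trans (g-hom (ℕ.n<1+n n)) (sym (g-hom (ℕ.n<1+n 0))))) (proj₂ block-word)

        s-≤ : ∀ {m n} → m ℕ.≤ n → ¬ s (g n) < s (g m)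
        s-≤ {m} {n} m≤n with ℕ.m≤n⇒m<n∨m≡n m≤n
        ... | inj₁ m<n  = asym (s-mono (g-mono m<n))
        ... | inj₂ refl = irrefl Eq.refl

        g-≥ : ∀ n → n ℕ.≤ g n
        g-≥ zero    = z≤n
        g-≥ (suc n) = ℕ.≤-<-trans (g-≥ n) (g-mono (ℕ.n<1+n n))

        s-g : ∀ {n a} → a < s n → a < s (g n)
        s-g {n} {a} a<s with ℕ.m≤n⇒m<n∨m≡n (g-≥ n)
        ... | inj₁ lt  = <-trans a<s (s-mono lt)
        ... | inj₂ n≡g = subst (λ k → a < s k) n≡g a<s

        locate : ∀ {a} → Segment (s (g 0)) J a → ∃[ n ] block n a
        locate {a} (ca , a≮s₀ , Ja) = let n , a<s = s-cofinal (ca , a≮y , Ja) in search n (s-g a<s)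
          where
          a≮y : ¬ a < y
          a≮y a<y = s-≮y (g 0) (≮-<-trans a≮s₀ a<y)
          search : ∀ n → a < s (g n) → ∃[ n ] block n a
          search zero    a<s = ⊥-elim (a≮s₀ a<s)
          search (suc n) a<s with decide em (a < s (g n))
          ... | yes a<s′ = search n a<s′
          ... | no a≮s′  = n , ca , a≮s′ , a<s

        blocks : Blocks A (Segment (s (g 0)) J) block
        blocks = record
          { into    = locate
          ; out     = λ {n} (ca , a≮s , a<s) → ca , (λ a<s₀ → a≮s (<-≮-trans a<s₀ (s-≤ z≤n))) ,
            J-down (J-s (g (suc n))) (asym a<s)
          ; ordered = λ m<n (_ , _ , a<s) (_ , b≮s , _) → <-≮-trans (<-≮-trans a<s (s-≤ m<n)) b≮s }

        first-block : Partition A K (Segment y (_< s (g 0))) (Segment (s (g 0)) J)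
        first-block = partition into
          (λ (ca , a≮y , a<s) → ca , a≮y , J-down (J-s (g 0)) (asym a<s))
          (λ (ca , a≮s , Ja) → ca , (λ a<y → s-≮y (g 0) (≮-<-trans a≮s a<y)) , Ja)
          (λ (_ , _ , a<s) (_ , b≮s , _) → <-≮-trans a<s b≮s)
          where
          into : ∀ {a} → K a → Segment y (_< s (g 0)) a ⊎ Segment (s (g 0)) J a
          into {a} (ca , a≮y , Ja) with decide em (a < s (g 0))
          ... | yes a<s = inj₁ (ca , a≮y , a<s)
          ... | no a≮s  = inj₂ (ca , a≮s , Ja)

        hasWord-homogeneous : HasWord K
        hasWord-homogeneous = hasWord-++ first-block (before-J (s (g 0)) (J-s (g 0)) y)
          ([ proj₁ block-word ^ω ] , blocks-ω R block-~ blocks)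

      hasWord-limit : HasWord K
      hasWord-limit = let g , e , g-mono , g-hom = homogeneous (λ i j → code R (sub A (Segment (s i) (_< s j))))
                      in hasWord-homogeneous g g-mono e g-hom

    hasWord-segment : HasWord K
    hasWord-segment with decide em (∃ K)
    ... | no none = [] , ~-empty none (λ ())
    ... | yes (x₀ , Kx₀) with decide em (∃[ z ] K z × (∀ {a} → K a → ¬ z < a))
    ...   | yes (z , Kz , max) = hasWord-max z Kz max
    ...   | no ¬max = hasWord-limit x₀ Kx₀ next
      where
      next : ∀ {z} → K z → ∃[ z′ ] K z′ × z < z′
      next {z} Kz with decide em (∃[ z′ ] K z′ × z < z′)
      ... | yes p = p
      ... | no ¬p = ⊥-elim (¬max (z , Kz , λ {a} Ka z<a → ¬p (a , Ka , z<a)))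

  hasWord-below : ∀ x → Acc _<_ x → ∀ y → HasWord (Segment y (_< x))
  hasWord-below x (acc rs) = hasWord-segment (_< x) (λ b<x b≮a → ≮-<-trans b≮a b<x)
    (λ z z<x → hasWord-below z (rs z<x))

  word-of : ∃[ w ] whole A ~[ R ] word w
  word-of with decide em ∣A∣
  ... | no empty = [] , ~-empty (λ (a , _) → empty a) (λ ())
  ... | yes a with least otp (λ _ → ⊤) (a , tt)
  ...   | y , _ , y-least with hasWord-segment (λ _ → ⊤) (λ _ _ → tt)
    (λ z _ → hasWord-below z (<-wellFounded z)) y
  ...     | w , e = w , ~-trans (sub-cong (λ _ → tt , tt) (λ _ → tt))
    (~-trans (~-sym (chosen-interval R ℕ.≤-refl nothing nothing tt tt))
    (~-trans (sub-cong (λ (ca , _) → ca , y-least tt , tt) (λ (ca , _) → ca , tt , tt)) e))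

-- Counting characters

suc-threshold : ∀ r → suc (threshold r) ≡ 2 ^ r
suc-threshold zero    = refl
suc-threshold (suc r) = trans (cong₂ _+_ (suc-threshold r) (suc-threshold r))
  (cong (2 ^ r +_) (sym (ℕ.+-identityʳ (2 ^ r))))

-- A witness, valid within r rounds, that s has at least n elements.
AtLeast : ℕ → ℕ → State d → Set
AtLeast r       zero    s = ⊤
AtLeast zero    (suc n) s = ⊥
AtLeast (suc r) (suc n) s = ∃[ p ] ∃₂ λ i j → i + j ≡ n × AtLeast r i (leftₛ s p) ×
  AtLeast r j (rightₛ s p)

atLeast-~ : ∀ r n {s t : State d} → s ~[ r ] t → AtLeast r n s → AtLeast r n t
atLeast-~ r       zero    e _ = tt
atLeast-~ (suc r) (suc n) e (p , i , j , i+j , al , ar) =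
  let p′ , match _ l τ = forth e refl p in p′ , i , j , i+j , atLeast-~ r i l al , atLeast-~ r j τ ar

-- Since `threshold (suc r)` is twice `threshold r` plus one, a middle point leaves on each side a
-- number that the remaining rounds can witness.
halve : ∀ r n → n ℕ.< threshold (suc r) → ∃₂ λ i j → i + j ≡ n × i ℕ.≤ threshold r ×
  j ℕ.≤ threshold r
halve r n n< with ℕ.≤-total n (threshold r)
... | inj₁ n≤ = n , 0 , ℕ.+-identityʳ n , n≤ , z≤n
... | inj₂ t≤ = threshold r , n ∸ threshold r , ℕ.m+[n∸m]≡n t≤ , ℕ.≤-refl
  , ℕ.m≤n+o⇒m∸n≤o n (threshold r)
    (ℕ.≤-pred (subst (n ℕ.<_) (ℕ.+-suc (threshold r) (threshold r)) n<))

atLeast-pow : ∀ r n M (u v : Word d) → Cut h c l τ → n ℕ.≤ threshold r → n ℕ.≤ M →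
              AtLeast r n (word (u ++ pow h M ++ v))
atLeast-pow r       zero    M u v k _ _ = tt
atLeast-pow (suc r) (suc n) M u v k n< n<M with halve r n n<
atLeast-pow {h = h} {c = c} {l = l} {τ = τ} (suc r) (suc n) M u v k n< n<M | i , j , refl , i≤ ,
  j≤ =
  go (cut-++ʳ u (cut-++ˡ {v = v} (subst
    (λ x → Cut (pow h x) c (pow h i ++ l) (τ ++ pow h j′)) i+j′≡M (cut-pow i j′ k))))
  where
  i<M : i ℕ.< M
  i<M = ℕ.≤-<-trans (ℕ.m≤m+n i j) n<M
  j′ : ℕ
  j′ = M ∸ suc i
  i+j′≡M : i + suc j′ ≡ M
  i+j′≡M = trans (ℕ.+-suc i j′) (ℕ.m+[n∸m]≡n i<M)
  j≤j′ : j ℕ.≤ j′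
  j≤j′ = ℕ.m+n≤o⇒m≤o∸n j (subst (ℕ._≤ M) (trans (cong suc (ℕ.+-comm i j)) (sym (ℕ.+-suc j i))) n<M)
  go : Cut (u ++ pow h M ++ v) c (u ++ pow h i ++ l) ((τ ++ pow h j′) ++ v) →
    AtLeast (suc r) (suc (i + j)) (word (u ++ pow h M ++ v))
  go k′ = at-cut k′ refl refl
    where
    at-cut : ∀ {c x y} → Cut (u ++ pow h M ++ v) c x y → x ≡ u ++ pow h i ++ l →
      y ≡ (τ ++ pow h j′) ++ v →
             AtLeast (suc r) (suc (i + j)) (word (u ++ pow h M ++ v))
    at-cut (at p) ex ey = p , i , j , refl
      , subst (λ x → AtLeast r i (word x)) (sym ex) (atLeast-pow r i i u l k i≤ ℕ.≤-refl)
      , subst (λ y → AtLeast r j (word y)) (sym (trans ey (++-assoc τ (pow h j′) v)))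
        (atLeast-pow r j j′ τ v k j≤ j≤j′)

bounded-some : (w : Word d) → ∃[ D ] Bounded D w
bounded-some []             = 0 , tt
bounded-some (letter c ∷ w) = bounded-some w
bounded-some (h ^ω ∷ w)     =
  let D₁ , b₁ = bounded-some h
      D₂ , b₂ = bounded-some w
  in suc (D₁ ℕ.⊔ D₂) , bounded-≤ h (ℕ.m≤m⊔n D₁ D₂) b₁ , bounded-≤ w (ℕ.m≤n⇒m≤1+n (ℕ.m≤n⊔m D₁ D₂)) b₂

remove : {X : Set} {x : X} {xs : List X} → x ∈ xs → ∃[ xs′ ] length xs ≡ suc (length xs′) ×
  (∀ {y} → y ∈ xs → ¬ x ≡ y → y ∈ xs′)
remove {xs = x ∷ xs} (here refl) = xs , refl ,
  λ { (here refl) x≢x → ⊥-elim (x≢x refl) ; (there m) _ → m }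
remove {xs = z ∷ xs} (there m) = let xs′ , e , f = remove m in
  z ∷ xs′ , cong suc e , λ { (here e) _ → here e ; (there m′) x≢y → there (f m′ x≢y) }

-- Meant for discarding the characters of the first points: the length is exact, and it becomes the
-- bound on the depth.
avoiding : ∀ a {k} (g : Fin a → Fin k) → Injective _≡_ _≡_ g →
           ∃[ xs ] length xs + a ≡ k × (∀ x → (∀ i → ¬ g i ≡ x) → x ∈ xs)
avoiding zero    {k} g inj = allFin k , trans (ℕ.+-identityʳ _) (length-tabulate id) , λ x _ →
  ∈-allFin x
avoiding (suc a) {k} g inj =
  let xs , e , f    = avoiding a (g ∘ suc) (λ e → Fin.suc-injective (inj e))
      xs′ , e′ , f′ = remove (f (g zero) (λ i eq → 0≢suc (inj (sym eq))))
  in xs′ , trans (ℕ.+-suc (length xs′) a) (trans (cong (_+ a) (sym e′)) e)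
     , λ x avoids → f′ (f x (avoids ∘ suc)) (avoids zero)
  where
  0≢suc : ∀ {n} {i : Fin n} → ¬ zero ≡ suc i
  0≢suc ()

module Finale (em : ExcludedMiddle (lsuc 0ℓ)) {d : ℕ} (A : ColoredOrdinal d) where
  open Types em
  open Games em using (~⇒≡)
  open Embeddings em
  open ColoredOrdinal A renaming (trans to <-trans; Carrier to ∣A∣)

  enumerate : ∀ K (P : Fin K → Set) → ∃₂ λ k (g : Fin k → Fin K) →
              Injective _≡_ _≡_ g × (∀ i → P (g i)) × (∀ {x} → P x → ∃[ i ] g i ≡ x)
  enumerate zero    P = 0 , (λ ()) , (λ { {()} }) , (λ ()) , λ { {()} }
  enumerate (suc K) P with enumerate K (P ∘ suc) | decide em (P zero)
  ... | k , g , inj , sound , complete | no ¬P0 = k , suc ∘ g , (λ e → inj (Fin.suc-injective e)) ,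
    sound
    , λ { {zero} P0 → ⊥-elim (¬P0 P0) ; {suc x} Px → let i , e = complete Px in i , cong suc e }
  ... | k , g , inj , sound , complete | yes P0 = suc k , g′ , (λ {i} {j} → inj′ i j)
    , (λ { zero → P0 ; (suc i) → sound i })
    , λ { {zero} _ → zero , refl ; {suc x} Px → let i , e = complete Px in suc i , cong suc e }
    where
    g′ : Fin (suc k) → Fin (suc K)
    g′ zero    = zero
    g′ (suc i) = suc (g i)
    inj′ : ∀ i j → g′ i ≡ g′ j → i ≡ j
    inj′ zero    zero    e = refl
    inj′ (suc i) (suc j) e = cong suc (inj (Fin.suc-injective e))

  module Chars (Q : ℕ) where

    lefts rights : ∣A∣ → State d
    lefts  a = leftₛ (whole A) (a , tt)
    rights a = rightₛ (whole A) (a , tt)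

    char : ∣A∣ → Fin (charCount d Q)
    char a = charCode Q (whole A) (a , tt)

    char-~ : ∀ {a b} → char a ≡ char b → Match (whole A) (a , tt) Q (whole A) (b , tt)
    char-~ e = let ce , lre = Fin.combine-injective _ _ _ _ e
                   le , re  = Fin.combine-injective _ _ _ _ lre
               in match ce (code-≡⇒~ Q _ _ le) (code-≡⇒~ Q _ _ re)

    -- `ρ` is defined by substructures and the game by predicates on a fixed carrier; this passes
    -- from one to the other.
    restricted : ∀ {P : ∣A∣ → Set} {r} → whole (substructure A P) ~[ r ] sub A (λ b → ⊤ × P b)
    restricted = iso {R = λ x b → proj₁ x ≡ b} record
      { total = λ { {b , Pb} _ → b , (tt , Pb) , refl }
        ; surjective = λ { {b} (_ , Pb) → (b , Pb) , tt , refl }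
      ; preserves = λ { refl refl lt → lt } ; reflects = λ { refl refl lt → lt }
        ; colours = λ { refl → refl } }

    infix 4 _≈ρ_
    _≈ρ_ : ∣A∣ → ∣A∣ → Set
    _≈ρ_ = Setoid._≈_ (ρ Q A)

    char⇒ρ : ∀ {a b} → char a ≡ char b → a ≈ρ b
    char⇒ρ e = let match c l τ = char-~ e in
      c , ~⇒≡ (~-trans restricted (~-trans l (~-sym restricted))) ,
        ~⇒≡ (~-trans restricted (~-trans τ (~-sym restricted)))

    ρ⇒char : ∀ {a b} → a ≈ρ b → char a ≡ char b
    ρ⇒char (c , l , τ) = cong₂ combine c (cong₂ combine
      (~⇒code-≡ Q (~-trans (~-sym restricted) (~-trans (≡⇒~ l) restricted)))
      (~⇒code-≡ Q (~-trans (~-sym restricted) (~-trans (≡⇒~ τ) restricted))))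

    abstract
      enum : ∃₂ λ k (g : Fin k → Fin (charCount d Q)) → Injective _≡_ _≡_ g
             × (∀ i → ∃[ a ] char a ≡ g i) × (∀ {x} → ∃[ a ] char a ≡ x → ∃[ i ] g i ≡ x)
      enum = enumerate (charCount d Q) (λ ξ → ∃[ a ] char a ≡ ξ)

    k : ℕ
    k = proj₁ enum

    rep : Fin k → ∣A∣
    rep i = proj₁ (proj₁ (proj₂ (proj₂ (proj₂ enum))) i)

    index : ∣A∣ → Fin k
    index a = proj₁ (proj₂ (proj₂ (proj₂ (proj₂ enum))) (a , refl))

    rep-injective : ∀ {i j} → char (rep i) ≡ char (rep j) → i ≡ j
    rep-injective {i} {j} e = proj₁ (proj₂ (proj₂ enum))
      (trans (sym (proj₂ (proj₁ (proj₂ (proj₂ (proj₂ enum))) i)))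
        (trans e (proj₂ (proj₁ (proj₂ (proj₂ (proj₂ enum))) j))))

    rep-index : ∀ a → char (rep (index a)) ≡ char a
    rep-index a = trans (proj₂ (proj₁ (proj₂ (proj₂ (proj₂ enum))) (index a)))
                        (proj₂ (proj₂ (proj₂ (proj₂ (proj₂ enum))) (a , refl)))

    index-char : ∀ {a b} → index a ≡ index b → char a ≡ char b
    index-char {a} {b} e = trans (sym (rep-index a)) (trans (cong (char ∘ rep) e) (rep-index b))

    ρ-card : ∣ ρ Q A ∣≡ k
    ρ-card = record
      { to        = rep
      ; cong      = λ { {i} refl → char⇒ρ {rep i} {rep i} refl }
      ; bijective = (λ {i} {j} e → rep-injective (ρ⇒char {rep i} {rep j} e))
                  , λ a → index a , λ { {z} refl → char⇒ρ {rep (index a)} {a} (rep-index a) }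
      }

  -- The first `n` points of `A`, listed in order. `elem` is total for convenience; its values from
  -- `n` on are arbitrary.
  record Initial (n : ℕ) : Set where
    field
      elem    : ℕ → ∣A∣
      mono    : ∀ {i j} → i ℕ.< j → j ℕ.< n → elem i < elem j
      initial : ∀ {i x} → i ℕ.< n → x < elem i → ∃[ j ] j ℕ.< i × elem j ≈ x

  open Initial

  Exhausts : ∀ {n} → Initial n → Set
  Exhausts {n} I = ∀ x → ∃[ i ] i ℕ.< n × elem I i ≈ x

  extend-initial : ∀ {n} (I : Initial n) → Exhausts I ⊎ Initial (suc n)
  extend-initial {n} I with decide em (∃[ x ] ∀ i → i ℕ.< n → ¬ elem I i ≈ x)
  ... | no none = inj₁ λ x → found x (decide em _)
    where
    found : ∀ x → Dec (∃[ i ] i ℕ.< n × elem I i ≈ x) → ∃[ i ] i ℕ.< n × elem I i ≈ x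
    found x (yes p) = p
    found x (no ¬p) = ⊥-elim (none (x , λ i i<n e → ¬p (i , i<n , e)))
  ... | yes p with least otp (λ x → ∀ i → i ℕ.< n → ¬ elem I i ≈ x) p
  ...   | x , missed , x-least = inj₂ record { elem = elem′ ; mono = mono′ ; initial = initial′ }
    where
    elem′ : ℕ → ∣A∣
    elem′ i with i ℕ.≟ n
    ... | yes _ = x
    ... | no _  = elem I i
    old : ∀ {i} → i ℕ.< n → elem′ i ≡ elem I i
    old {i} i<n with i ℕ.≟ n
    ... | yes refl = ⊥-elim (ℕ.<-irrefl refl i<n)
    ... | no _     = refl
    new : elem′ n ≡ x
    new with n ℕ.≟ n
    ... | yes _  = refl
    ... | no n≢n = ⊥-elim (n≢n refl)
    elem<x : ∀ {i} → i ℕ.< n → elem I i < x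
    elem<x {i} i<n with compare (elem I i) x
    ... | tri< lt _ _ = lt
    ... | tri≈ _ e _  = ⊥-elim (missed i i<n e)
    ... | tri> _ _ gt = let j , j<i , e = initial I i<n gt in ⊥-elim (missed j (ℕ.<-trans j<i i<n) e)
    mono′ : ∀ {i j} → i ℕ.< j → j ℕ.< suc n → elem′ i < elem′ j
    mono′ {i} {j} i<j (s≤s j≤n) with ℕ.m≤n⇒m<n∨m≡n j≤n
    ... | inj₁ j<n  = subst₂ _<_ (sym (old (ℕ.<-trans i<j j<n))) (sym (old j<n)) (mono I i<j j<n)
    ... | inj₂ refl = subst₂ _<_ (sym (old i<j)) (sym new) (elem<x i<j)
    initial′ : ∀ {i y} → i ℕ.< suc n → y < elem′ i → ∃[ j ] j ℕ.< i × elem′ j ≈ y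
    initial′ {i} {y} (s≤s i≤n) lt with ℕ.m≤n⇒m<n∨m≡n i≤n
    ... | inj₁ i<n = let j , j<i , e = initial I i<n (subst (y <_) (old i<n) lt) in
      j , j<i , subst (_≈ y) (sym (old (ℕ.<-trans j<i i<n))) e
    ... | inj₂ refl = hit (decide em (∃[ j ] j ℕ.< n × elem I j ≈ y))
      where
      hit : Dec (∃[ j ] j ℕ.< n × elem I j ≈ y) → ∃[ j ] j ℕ.< n × elem′ j ≈ y
      hit (yes (j , j<n , e)) = j , j<n , subst (_≈ y) (sym (old j<n)) e
      hit (no ¬hit) = ⊥-elim (x-least (λ j j<n e → ¬hit (j , j<n , e)) (subst (y <_) new lt))

  initial-or-exhausted : ∣A∣ → ∀ n → (∃[ m ] m ℕ.< n × Σ (Initial m) Exhausts) ⊎ Initial n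
  initial-or-exhausted a zero = inj₂ record { elem = λ _ → a ; mono = λ _ () ; initial = λ () }
  initial-or-exhausted a (suc n) with initial-or-exhausted a n
  ... | inj₁ (m , m<n , I , ex) = inj₁ (m , ℕ.m≤n⇒m≤1+n m<n , I , ex)
  ... | inj₂ I with extend-initial I
  ...   | inj₁ ex = inj₁ (n , ℕ.n<1+n n , I , ex)
  ...   | inj₂ I′ = inj₂ I′

  exhausted-≅ : ∀ {n} (I : Initial n) → Exhausts I → otp ≅ fin n
  exhausted-≅ {n} I ex = record
    { to = to
    ; isOrderIsomorphism = record
      { isOrderMonomorphism = record
        { isOrderHomomorphism = record { cong = to-cong ; mono = to-mono }
        ; injective = λ {x} {y} e → Eq.trans (Eq.sym (position-≈ x))
          (Eq.trans (Eq.reflexive (cong (elem I) (toℕ-≡ e))) (position-≈ y))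
        ; cancel = λ {x} {y} lt → cancel x y lt }
      ; surjective = λ i → elem I (toℕ i) , λ {z} e →
        Fin.toℕ-injective (trans (toℕ-to z)
          (elem-injective (position-< z) (Fin.toℕ<n i) (Eq.trans (position-≈ z) e))) } }
    where
    position : ∣A∣ → ℕ
    position x = proj₁ (ex x)
    position-< : ∀ x → position x ℕ.< n
    position-< x = proj₁ (proj₂ (ex x))
    position-≈ : ∀ x → elem I (position x) ≈ x
    position-≈ x = proj₂ (proj₂ (ex x))
    to : ∣A∣ → Fin n
    to x = fromℕ< (position-< x)
    toℕ-to : ∀ x → toℕ (to x) ≡ position x
    toℕ-to x = Fin.toℕ-fromℕ< (position-< x)
    elem-injective : ∀ {i j} → i ℕ.< n → j ℕ.< n → elem I i ≈ elem I j → i ≡ j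
    elem-injective {i} {j} i<n j<n e with ℕ.<-cmp i j
    ... | tri< lt _ _ = ⊥-elim (irrefl e (mono I lt j<n))
    ... | tri≈ _ eq _ = eq
    ... | tri> _ _ gt = ⊥-elim (irrefl (Eq.sym e) (mono I gt i<n))
    elem-cancel : ∀ {i j} → i ℕ.< n → elem I i < elem I j → i ℕ.< j
    elem-cancel {i} {j} i<n lt with ℕ.<-cmp i j
    ... | tri< i<j _ _ = i<j
    ... | tri≈ _ refl _ = ⊥-elim (irrefl Eq.refl lt)
    ... | tri> _ _ j<i = ⊥-elim (asym lt (mono I j<i i<n))
    toℕ-≡ : ∀ {x y} → to x ≡ to y → position x ≡ position y
    toℕ-≡ {x} {y} e = trans (sym (toℕ-to x)) (trans (cong toℕ e) (toℕ-to y))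
    to-cong : ∀ {x y} → x ≈ y → to x ≡ to y
    to-cong {x} {y} e = Fin.toℕ-injective (trans (toℕ-to x) (trans
      (elem-injective (position-< x) (position-< y)
        (Eq.trans (position-≈ x) (Eq.trans e (Eq.sym (position-≈ y)))))
      (sym (toℕ-to y))))
    to-mono : ∀ {x y} → x < y → toℕ (to x) ℕ.< toℕ (to y)
    to-mono {x} {y} lt = subst₂ ℕ._<_ (sym (toℕ-to x)) (sym (toℕ-to y))
      (elem-cancel (position-< x) (<-respʳ-≈ (Eq.sym (position-≈ y))
        (<-respˡ-≈ (Eq.sym (position-≈ x)) lt)))
    cancel : ∀ x y → toℕ (to x) ℕ.< toℕ (to y) → x < y
    cancel x y lt = <-respʳ-≈ (position-≈ y) (<-respˡ-≈ (position-≈ x)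
      (mono I (subst₂ ℕ._<_ (toℕ-to x) (toℕ-to y) lt) (position-< y)))

  module _ {n : ℕ} (I : Initial n) where

    atLeast-initial : ∀ r m i {P : ∣A∣ → Set} → m ℕ.≤ threshold r → i + m ℕ.≤ n →
                      (∀ {j} → i ℕ.≤ j → j ℕ.< i + m → P (elem I j)) → AtLeast r m (sub A P)
    atLeast-initial r       zero    i _ _ _ = tt
    atLeast-initial (suc r) (suc m) i {P} m≤ i+m≤n P-elem with halve r m m≤
    ... | a , b , refl , a≤ , b≤ = (elem I (i + a) , P-elem (ℕ.m≤m+n i a) i+a<) , a , b , refl
      , atLeast-initial r a i a≤ (ℕ.≤-trans (ℕ.<⇒≤ i+a<) i+m≤n)
          (λ i≤j j< → P-elem i≤j (ℕ.<-trans j< i+a<) , mono I j< (ℕ.<-≤-trans i+a< i+m≤n))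
      , atLeast-initial r b (suc (i + a)) b≤ (ℕ.≤-trans (ℕ.≤-reflexive end) i+m≤n)
          (λ i≤j j< → P-elem (ℕ.≤-trans (ℕ.m≤m+n i a) (ℕ.<⇒≤ i≤j))
            (ℕ.<-≤-trans j< (ℕ.≤-reflexive end))
            , mono I i≤j (ℕ.<-≤-trans j< (ℕ.≤-trans (ℕ.≤-reflexive end) i+m≤n)))
      where
      end : suc (i + a) + b ≡ i + suc (a + b)
      end = trans (cong suc (ℕ.+-assoc i a b)) (sym (ℕ.+-suc i (a + b)))
      i+a< : i + a ℕ.< i + suc (a + b)
      i+a< = ℕ.+-monoʳ-< i (s≤s (ℕ.m≤m+n a b))

    -- The marked points have distinct indices: each splits the range from `i` to `j` at its own
    -- index, and the recursion counts on both sides.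
    atLeast-bound : ∀ r m i j {P : ∣A∣ → Set} → i ℕ.≤ j → j ℕ.≤ n →
      (∀ {x} → P x → ∃[ l ] i ℕ.≤ l × l ℕ.< j × elem I l ≈ x) →
                    AtLeast r m (sub A P) → i + m ℕ.≤ j
    atLeast-bound r       zero    i j i≤j _ _ _ = subst (ℕ._≤ j) (sym (ℕ.+-identityʳ i)) i≤j
    atLeast-bound (suc r) (suc m) i j {P} i≤j j≤n P⊆ ((x , Px) , a , b , refl , al , ar) with P⊆ Px
    ... | l , i≤l , l<j , e = begin
      i + suc (a + b)   ≡⟨ trans (ℕ.+-suc i (a + b)) (cong suc (sym (ℕ.+-assoc i a b))) ⟩
      suc (i + a) + b   ≤⟨ ℕ.+-monoˡ-≤ b
        (s≤s (atLeast-bound r a i l i≤l (ℕ.≤-trans (ℕ.<⇒≤ l<j) j≤n) below-l al)) ⟩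
      suc l + b         ≤⟨ atLeast-bound r b (suc l) j l<j j≤n above-l ar ⟩
      j                 ∎
      where
      open ℕ.≤-Reasoning
      l<n : l ℕ.< n
      l<n = ℕ.<-≤-trans l<j j≤n
      ordered : ∀ {i j} → i ℕ.< n → elem I i < elem I j → i ℕ.< j
      ordered {i} {j} i<n lt with ℕ.<-cmp i j
      ... | tri< i<j _ _ = i<j
      ... | tri≈ _ refl _ = ⊥-elim (irrefl Eq.refl lt)
      ... | tri> _ _ j<i = ⊥-elim (asym lt (mono I j<i i<n))
      below-l : ∀ {y} → P y × y < x → ∃[ l′ ] i ℕ.≤ l′ × l′ ℕ.< l × elem I l′ ≈ y
      below-l (Py , y<x) with P⊆ Py
      ... | l′ , i≤l′ , l′<j , e′ = l′ , i≤l′ ,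
        ordered (ℕ.<-≤-trans l′<j j≤n) (<-respʳ-≈ (Eq.sym e) (<-respˡ-≈ (Eq.sym e′) y<x)) , e′
      above-l : ∀ {y} → P y × x < y → ∃[ l′ ] suc l ℕ.≤ l′ × l′ ℕ.< j × elem I l′ ≈ y
      above-l (Py , x<y) with P⊆ Py
      ... | l′ , i≤l′ , l′<j , e′ = l′ ,
        ordered l<n (<-respʳ-≈ (Eq.sym e′) (<-respˡ-≈ (Eq.sym e) x<y)) , l′<j , e′

    module _ (Q : ℕ) where
      open Chars Q

      lefts-atMost : ∀ {i m} → i ℕ.< n → AtLeast Q m (lefts (elem I i)) → m ℕ.≤ i
      lefts-atMost {i} {m} i<n = atLeast-bound Q m 0 i z≤n (ℕ.<⇒≤ i<n)
        (λ (_ , x<) → let j , j<i , e = initial I i<n x< in j , z≤n , j<i , e)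

      lefts-atLeast : ∀ {i m} → i ℕ.< n → m ℕ.≤ i → m ℕ.≤ threshold Q →
        AtLeast Q m (lefts (elem I i))
      lefts-atLeast {i} {m} i<n m≤i m≤t = atLeast-initial Q m 0 m≤t (ℕ.≤-trans m≤i (ℕ.<⇒≤ i<n))
        (λ _ j<m → tt , mono I (ℕ.<-≤-trans j<m m≤i) i<n)

      -- Of two points, the later has more predecessors than the index of the earlier. That many,
      -- being at most `threshold Q`, can be witnessed in `Q` rounds, so the left types differ.
      char-injective : n ℕ.≤ suc (threshold Q) → ∀ {i j} → i ℕ.< n → j ℕ.< n →
        char (elem I i) ≡ char (elem I j) → i ≡ j
      char-injective n≤ {i} {j} i<n j<n e with ℕ.<-cmp i j
      ... | tri< i<j _ _ = ⊥-elim (ℕ.1+n≰n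
        (lefts-atMost i<n (atLeast-~ Q (suc i) (~-sym (left~ (char-~ e)))
              (lefts-atLeast j<n i<j (ℕ.≤-pred (ℕ.≤-trans (ℕ.≤-trans (s≤s i<j) j<n) n≤))))))
      ... | tri≈ _ eq _ = eq
      ... | tri> _ _ j<i = ⊥-elim (ℕ.1+n≰n (lefts-atMost j<n (atLeast-~ Q (suc j) (left~ (char-~ e))
              (lefts-atLeast i<n j<i (ℕ.≤-pred (ℕ.≤-trans (ℕ.≤-trans (s≤s j<i) i<n) n≤))))))

      index-injective : n ℕ.≤ suc (threshold Q) →
        Injective _≡_ _≡_ (λ (i : Fin n) → index (elem I (toℕ i)))
      index-injective n≤ {i} {j} e = Fin.toℕ-injective
        (char-injective n≤ (Fin.toℕ<n i) (Fin.toℕ<n j)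
        (index-char {elem I (toℕ i)} {elem I (toℕ j)} e))

  exhausted-count : ∀ {n} (I : Initial n) → Exhausts I → ∀ Q → n ℕ.≤ suc (threshold Q) →
    Chars.k Q ≡ n
  exhausted-count {n} I ex Q n≤ = ℕ.≤-antisym
    (Fin.injective⇒≤ {f = λ i → fromℕ< (proj₁ (proj₂ (ex (rep i))))} inj)
    (Fin.injective⇒≤ (index-injective I Q n≤))
    where
    open Chars Q
    inj : ∀ {i j} → fromℕ< (proj₁ (proj₂ (ex (rep i)))) ≡ fromℕ< (proj₁ (proj₂ (ex (rep j)))) →
      i ≡ j
    inj {i} {j} e = rep-injective (~-char (Eq.trans (Eq.sym (proj₂ (proj₂ (ex (rep i)))))
      (Eq.trans (Eq.reflexive (cong (elem I)
        (Fin.fromℕ<-injective _ _ (proj₁ (proj₂ (ex (rep i)))) (proj₁ (proj₂ (ex (rep j)))) e)))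
          (proj₂ (proj₂ (ex (rep j)))))))
      where
      ~-char : ∀ {a b} → a ≈ b → char a ≡ char b
      ~-char e = cong₂ combine (color-cong e) (cong₂ combine
        (~⇒code-≡ Q (sub-cong (λ (t , lt) → t , <-respʳ-≈ e lt)
          (λ (t , lt) → t , <-respʳ-≈ (Eq.sym e) lt)))
        (~⇒code-≡ Q (sub-cong (λ (t , lt) → t , <-respˡ-≈ e lt)
          (λ (t , lt) → t , <-respˡ-≈ (Eq.sym e) lt))))

  module _ (r : ℕ) (I : Initial (suc (threshold (suc r)))) where
    private
      Q N : ℕ
      Q = suc r
      N = suc (threshold Q)
    open Chars Q

    N≤k : N ℕ.≤ k
    N≤k = Fin.injective⇒≤ (index-injective I Q ℕ.≤-refl)

    Big : Word d → Set
    Big w = AtLeast Q (threshold Q) (word w)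

    big-≈ : ∀ {u v} → u ≈[ Q ] v → Big u → Big v
    big-≈ e = atLeast-~ Q (threshold Q) e

    big-pow : ∀ u {h} l → First h → Big (u ++ pow h N ++ l)
    big-pow u l fst = atLeast-pow Q (threshold Q) N u l (First.first-cut fst) ℕ.≤-refl (ℕ.n≤1+n _)

    -- There are `N` initial points with distinct characters, but only `threshold Q` of these are
    -- small: the last one already has `threshold Q` predecessors.
    small : Fin (threshold Q) → Fin k
    small i = index (elem I (toℕ i))

    small-injective : Injective _≡_ _≡_ small
    small-injective {i} {j} e = Fin.toℕ-injective (char-injective I Q ℕ.≤-refl
      (ℕ.<-trans (Fin.toℕ<n i) (ℕ.n<1+n _)) (ℕ.<-trans (Fin.toℕ<n j) (ℕ.n<1+n _))
      (index-char {elem I (toℕ i)} {elem I (toℕ j)} e))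

    small-not-big : ∀ {a} → AtLeast Q (threshold Q) (lefts a) → ∀ i → ¬ small i ≡ index a
    small-not-big {a} big i e = ℕ.<⇒≱ (Fin.toℕ<n i)
      (lefts-atMost I Q (ℕ.<-trans (Fin.toℕ<n i) (ℕ.n<1+n _))
      (atLeast-~ Q (threshold Q) (~-sym (left~ (char-~ (index-char {elem I (toℕ i)} {a} e)))) big))

    module _ {w : Word d} (e : whole A ~[ suc Q ] word w) where

      pos : ∀ i → ∃[ p ] Match (whole A) (rep i , tt) Q (word w) p
      pos i = forth e refl (rep i , tt)

      charIn : Fin k → Char d
      charIn i = let p , _ = pos i in colour p , left p , right p

      charIn-index : ∀ {a p} → Match (whole A) (a , tt) Q (word w) p →
        (colour p , left p , right p) ≈ᶜ[ Q ] charIn (index a)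
      charIn-index {a} m = let match c l τ = match-trans (match-sym m) (match-trans (match-sym (char-~ (rep-index a))) (proj₂ (pos (index a))))
                           in c , l , τ

      find : ∀ {x i is} → x ≈ᶜ[ Q ] charIn i → i ∈ is → x ∈ᶜ[ Q ] map charIn is
      find e (here refl) = here e
      find e (there m)   = there (find e m)

      big-cover : ∃[ K ] length K ≡ suc (k ∸ N) × BigCovers em r N ℕ.≤-refl Big big-≈ big-pow w K
      big-cover = let is , len , covers = avoiding (threshold Q) small small-injective in
        map charIn is , trans (length-map charIn is) (length≡ is len) ,
          λ { (at p) big → cover covers p big }
        where
        length≡ : ∀ (is : List (Fin k)) → length is + threshold Q ≡ k → length is ≡ suc (k ∸ N)
        length≡ is len = trans (sym (ℕ.m+n∸n≡m (length is) (threshold Q)))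
          -- `N` is one more than `threshold Q` and at most `k`, so discarding `threshold Q`
          -- characters leaves `suc (k ∸ N)`.
          (trans (cong (_∸ threshold Q) len) (ℕ.+-∸-assoc 1 {k} {N} N≤k))
        cover : ∀ {is} → (∀ x → (∀ i → ¬ small i ≡ x) → x ∈ is) →
                ∀ p → Big (left p) → (colour p , left p , right p) ∈ᶜ[ Q ] map charIn is
        cover covers p big = let (a , _) , m = back e refl p in
          find (charIn-index m) (covers (index a)
            (small-not-big {a} (atLeast-~ Q (threshold Q) (~-sym (left~ m)) big)))

    short-word : ∃₂ λ u h → Bounded (k ∸ N) u × Bounded (k ∸ N) h ×
      whole A ~[ suc Q ] word (u ++ [ h ^ω ])
    short-word =
      let w , A~w      = Normalise.word-of em A (suc Q)
          D , bw       = bounded-some w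
          K , len , cov = big-cover A~w
          len≤         = ℕ.≤-reflexive len
          w₁ , b₁ , e₁ = reduce-to em r N ℕ.≤-refl Big big-≈ big-pow (suc (k ∸ N)) len≤ D bw cov
          u , h , bu , bh , e₂ = last-ω em r N ℕ.≤-refl Big big-≈ big-pow b₁
            (bigCovers-≈ em r N ℕ.≤-refl Big big-≈ big-pow e₁ cov) len≤
      in u , h , bu , bh , ~-trans A~w (~-trans e₁ e₂)

    -- Minimality makes `A` an initial segment of the order of any equivalent word, in particular of
    -- the short one. The composite with `lastRank` is merely strictly monotone, which `mono⇒≤ₒ`
    -- turns into an initial embedding.
    bounded-otp : HasLeastOrderType (suc Q) A → otp ≤ₒ ω^ suc (k ∸ N)
    bounded-otp least-otp =
      let u , h , bu , bh , A~w = short-word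
          A≤B = least-otp ⟦ u ++ [ h ^ω ] ⟧ʷ
            (~⇒≡ (~-trans (word-realised (u ++ [ h ^ω ])) (~-sym A~w)))
      in mono⇒≤ₒ otp (ω^ suc (k ∸ N)) (λ x → lastRank (k ∸ N) u bu bh (_≤ₒ_.to A≤B x))
           (λ lt → lastRank-mono (k ∸ N) u bu bh
             (IsOrderMonomorphism.mono (_≤ₒ_.isOrderMonomorphism A≤B) lt))

corollary1 : ExcludedMiddle (lsuc 0ℓ) →
    ∀ (d q : ℕ) → d ≥ 1 → q ≥ 2 →
    ∀ (A : ColoredOrdinal d) → HasLeastOrderType q A →
    ∃[ k ] (∣ ρ (q ∸ 1) A ∣≡ k)
    × (k ≤ 2 ^ (q ∸ 1) ∸ 1 → ColoredOrdinal.otp A ≅ fin k)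
    × (k > 2 ^ (q ∸ 1) ∸ 1 → ColoredOrdinal.otp A ≤ₒ ω^ (k ∸ 2 ^ (q ∸ 1) + 1))
corollary1 em d (suc (suc r)) _ (s≤s (s≤s _)) A least-otp = k , ρ-card , conclude (decide em ∣A∣)
  where
  open Finale em A
  open Chars (suc r)
  open ColoredOrdinal A using (otp) renaming (Carrier to ∣A∣)
  Q = suc r
  2^Q≡ : 2 ^ Q ≡ suc (threshold Q)
  2^Q≡ = sym (suc-threshold Q)
  Conclusion : Set
  Conclusion = (k ℕ.≤ 2 ^ Q ∸ 1 → otp ≅ fin k) × (k ℕ.> 2 ^ Q ∸ 1 → otp ≤ₒ ω^ (k ∸ 2 ^ Q + 1))
  exhausted : ∀ {n} (I : Initial n) → Exhausts I → n ℕ.≤ threshold Q → Conclusion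
  exhausted {n} I ex n≤ = (λ _ → subst (λ n → otp ≅ fin n) (sym k≡n) (exhausted-≅ I ex))
    , λ k> → ⊥-elim (ℕ.<⇒≱ (subst (λ x → x ∸ 1 ℕ.< k) 2^Q≡ k>)
      (subst (ℕ._≤ threshold Q) (sym k≡n) n≤))
    where
    k≡n : k ≡ n
    k≡n = exhausted-count I ex Q (ℕ.m≤n⇒m≤1+n n≤)
  many : Initial (suc (threshold Q)) → Conclusion
  many I = (λ k≤ → ⊥-elim (ℕ.<⇒≱ (N≤k r I) (subst (λ x → k ℕ.≤ x ∸ 1) 2^Q≡ k≤)))
    , λ _ → subst (λ D → otp ≤ₒ ω^ D)
      (trans (cong (λ x → suc (k ∸ x)) (sym 2^Q≡)) (ℕ.+-comm 1 (k ∸ 2 ^ Q)))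
        (bounded-otp r I least-otp)
  empty-conclusion : ¬ ∣A∣ → Conclusion
  empty-conclusion empty = (λ _ → subst (λ n → otp ≅ fin n) (sym k≡0) record
      { to = λ a → ⊥-elim (empty a)
      ; isOrderIsomorphism = record
        { isOrderMonomorphism = record
          { isOrderHomomorphism = record { cong = λ {a} → ⊥-elim (empty a) ; mono = λ {a} →
            ⊥-elim (empty a) }
          ; injective = λ {a} → ⊥-elim (empty a)
          ; cancel    = λ {a} → ⊥-elim (empty a) }
        ; surjective = λ () } })
    , λ k> → ⊥-elim (ℕ.<⇒≱ k> (subst (ℕ._≤ _) (sym k≡0) z≤n))
    where
    no-elements : ∀ n → (Fin n → ∣A∣) → n ≡ 0
    no-elements zero    f = refl
    no-elements (suc n) f = ⊥-elim (empty (f zero))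
    k≡0 : k ≡ 0
    k≡0 = no-elements k rep
  conclude : Dec ∣A∣ → Conclusion
  conclude (no empty) = empty-conclusion empty
  -- Either `A` has at most `threshold Q` points and `k` is their number, or it has `2 ^ Q` first
  -- points with distinct characters and `k` is at least `2 ^ Q`. Each case contradicts the premise
  -- of one implication.
  conclude (yes a) with initial-or-exhausted a (suc (threshold Q))
  ... | inj₁ (n , s≤s n≤ , I , ex) = exhausted I ex n≤
  ... | inj₂ I = many I
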